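{- There is no superhigh weakly 2-random set; that is, no set $R\subseteq\mathbb{N}$ is both superhigh and weakly 2-random.
   Context: A set $A$ is superhigh if $A'\ge_{tt}\emptyset''$, where $A'$ is the Turing jump of $A$ and $\le_{tt}$ is truth-table reducibility. A set $R$ is weakly 2-random if $R$ belongs to no (lightface) $\Pi^0_2$ class $\mathcal{S}\subseteq 2^{\mathbb{N}}$ that is null, i.e. has fair-coin Lebesgue measure $0$. -}

module Defs where

open import Data.Bool using (Bool; true; false; T; if_then_else_)
open import Data.Fin using (Fin; toℕ)
open import Data.List using (List; []; _∷_; length; lookup; foldr; applyUpTo)
open import Data.Nat using (ℕ; zero; suc; _+_; _*_; _<_)
open import Data.Nat.Properties using (+-suc; +-identityʳ)
open import Data.Product using (_×_; _,_; proj₁; proj₂; ∃-syntax)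
open import Data.Rational as ℚ using (ℚ; 0ℚ; 1ℚ; ½)
open import Data.Sum using (_⊎_)
open import Function.Base using (_∘_)
open import Function.Bundles using (_⇔_)
open import Level using (0ℓ)
open import Relation.Binary.PropositionalEquality using (_≡_; refl; sym; trans; cong)
open import Relation.Nullary using (¬_)
open import Relation.Unary using (Pred; ∅; _∈_; _∉_)

-- Subsets of ℕ, identified with the points of Cantor space 2^ℕ.
Subset : Set₁
Subset = Pred ℕ 0ℓ

Class : Set₁
Class = Pred Subset 0ℓ

------------------------------------------------------------------------
-- Cantor pairing

triangle : ℕ → ℕ
triangle zero    = 0
triangle (suc n) = suc (triangle n + n)

⟨_,_⟩ : ℕ → ℕ → ℕ
⟨ x , y ⟩ = triangle (x + y) + y

-- Successor in the enumeration (0,0), (1,0), (0,1), (2,0), (1,1), …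
nextPair : ℕ × ℕ → ℕ × ℕ
nextPair (zero  , y) = suc y , 0
nextPair (suc x , y) = x , suc y

unpair : ℕ → ℕ × ℕ
unpair zero    = 0 , 0
unpair (suc n) = nextPair (unpair n)

π₁ π₂ : ℕ → ℕ
π₁ = proj₁ ∘ unpair
π₂ = proj₂ ∘ unpair

unpair-⟨⟩ : ∀ x y → unpair ⟨ x , y ⟩ ≡ (x , y)
unpair-⟨⟩ x y = go (x + y) x y refl
  where
  go : ∀ s x y → x + y ≡ s → unpair (triangle s + y) ≡ (x , y)
  go s x (suc y) eq rewrite +-suc (triangle s) y =
    cong nextPair (go s (suc x) y (trans (sym (+-suc x y)) eq))
  go zero zero zero _ = refl
  go (suc s) x zero eq with refl ← trans (sym (+-identityʳ x)) eq
    rewrite +-identityʳ (triangle s + s) = cong nextPair (go s 0 s refl)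

------------------------------------------------------------------------
-- Oracle computation: partial recursive functions ℕ ⇀ ℕ relative to an
-- oracle, functions of several arguments being reduced to unary ones by
-- pairing

data Code : Set where
  zero succ left right oracle : Code
  pair comp prec              : Code → Code → Code
  mu                          : Code → Code

infix 4 _⊢_[_]↦_

-- A ⊢ c [ n ]↦ k : the program c with oracle A halts on input n with
-- output k.  The code prec c d denotes h with h⟨a,0⟩ = c(a) and
-- h⟨a,k+1⟩ = d⟨a,⟨k,h⟨a,k⟩⟩⟩; the code mu c denotes n ↦ μk. c⟨n,k⟩ = 0,
-- which is defined only if c⟨n,j⟩ is defined for every j < k.
data _⊢_[_]↦_ (A : Subset) : Code → ℕ → ℕ → Set where
  zero       : ∀ {n} → A ⊢ zero [ n ]↦ 0
  succ       : ∀ {n} → A ⊢ succ [ n ]↦ suc n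
  left       : ∀ {n} → A ⊢ left [ n ]↦ π₁ n
  right      : ∀ {n} → A ⊢ right [ n ]↦ π₂ n
  oracle-yes : ∀ {n} → n ∈ A → A ⊢ oracle [ n ]↦ 1
  oracle-no  : ∀ {n} → n ∉ A → A ⊢ oracle [ n ]↦ 0
  pair       : ∀ {c d n x y} → A ⊢ c [ n ]↦ x → A ⊢ d [ n ]↦ y →
               A ⊢ pair c d [ n ]↦ ⟨ x , y ⟩
  comp       : ∀ {c d n m k} → A ⊢ d [ n ]↦ m → A ⊢ c [ m ]↦ k →
               A ⊢ comp c d [ n ]↦ k
  prec-zero  : ∀ {c d n x} → π₂ n ≡ 0 → A ⊢ c [ π₁ n ]↦ x →
               A ⊢ prec c d [ n ]↦ x
  prec-suc   : ∀ {c d n k x y} → π₂ n ≡ suc k →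
               A ⊢ prec c d [ ⟨ π₁ n , k ⟩ ]↦ x →
               A ⊢ d [ ⟨ π₁ n , ⟨ k , x ⟩ ⟩ ]↦ y →
               A ⊢ prec c d [ n ]↦ y
  mu         : ∀ {c n k} → A ⊢ c [ ⟨ n , k ⟩ ]↦ 0 →
               (∀ j → j < k → ∃[ y ] A ⊢ c [ ⟨ n , j ⟩ ]↦ suc y) →
               A ⊢ mu c [ n ]↦ k

Computable : (ℕ → ℕ) → Set
Computable f = ∃[ c ] ∀ n → ∅ ⊢ c [ n ]↦ f n

-- An injective Gödel numbering of programs.
⌜_⌝ : Code → ℕ
⌜ zero ⌝     = ⟨ 0 , 0 ⟩
⌜ succ ⌝     = ⟨ 1 , 0 ⟩
⌜ left ⌝     = ⟨ 2 , 0 ⟩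
⌜ right ⌝    = ⟨ 3 , 0 ⟩
⌜ oracle ⌝   = ⟨ 4 , 0 ⟩
⌜ pair c d ⌝ = ⟨ 5 , ⟨ ⌜ c ⌝ , ⌜ d ⌝ ⟩ ⟩
⌜ comp c d ⌝ = ⟨ 6 , ⟨ ⌜ c ⌝ , ⌜ d ⌝ ⟩ ⟩
⌜ prec c d ⌝ = ⟨ 7 , ⟨ ⌜ c ⌝ , ⌜ d ⌝ ⟩ ⟩
⌜ mu c ⌝     = ⟨ 8 , ⌜ c ⌝ ⟩

-- The Turing jump {e : φₑᴬ(e)↓}, where φₑ is nowhere defined if e is
-- not the number of a program.
_′ : Subset → Subset
(A ′) e = ∃[ c ] (e ≡ ⌜ c ⌝ × ∃[ k ] A ⊢ c [ e ]↦ k)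

------------------------------------------------------------------------
-- Truth-table reducibility

-- Truth-table conditions, presented as Boolean formulas whose atoms
-- are the oracle questions.
data Formula : Set where
  atom    : ℕ → Formula
  not     : Formula → Formula
  and or  : Formula → Formula → Formula

infix 4 _⊨_

_⊨_ : Subset → Formula → Set
B ⊨ atom n  = n ∈ B
B ⊨ not φ   = ¬ (B ⊨ φ)
B ⊨ and φ ψ = (B ⊨ φ) × (B ⊨ ψ)
B ⊨ or φ ψ  = (B ⊨ φ) ⊎ (B ⊨ ψ)

encodeFormula : Formula → ℕ
encodeFormula (atom n)  = ⟨ 0 , n ⟩
encodeFormula (not φ)   = ⟨ 1 , encodeFormula φ ⟩
encodeFormula (and φ ψ) = ⟨ 2 , ⟨ encodeFormula φ , encodeFormula ψ ⟩ ⟩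
encodeFormula (or φ ψ)  = ⟨ 3 , ⟨ encodeFormula φ , encodeFormula ψ ⟩ ⟩

infix 4 _≤tt_

_≤tt_ : Subset → Subset → Set
A ≤tt B = ∃[ φ ] (Computable (encodeFormula ∘ φ) × (∀ x → x ∈ A ⇔ B ⊨ φ x))

Superhigh : Subset → Set
Superhigh A = ∅ ′ ′ ≤tt A ′

------------------------------------------------------------------------
-- Π⁰₂ classes and null classes in Cantor space

infix 4 _≺_

-- σ is an initial segment of the characteristic sequence of X; the
-- cylinder [σ] is {X : σ ≺ X}.
_≺_ : List Bool → Subset → Set
σ ≺ X = ∀ (i : Fin (length σ)) → toℕ i ∈ X ⇔ T (lookup σ i)

-- Bijective base-2 numeration.
encodeString : List Bool → ℕ
encodeString []          = 0
encodeString (false ∷ σ) = 1 + 2 * encodeString σ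
encodeString (true  ∷ σ) = 2 + 2 * encodeString σ

ComputableRelation : (ℕ → List Bool → Bool) → Set
ComputableRelation P = ∃[ c ] ∀ y σ →
  ∅ ⊢ c [ ⟨ y , encodeString σ ⟩ ]↦ (if P y σ then 1 else 0)

-- Lightface Π⁰₂: S = {X : ∀y ∃z P(y, X↾z)} for a computable relation P.
IsΠ⁰₂ : Class → Set₁
IsΠ⁰₂ S = ∃[ P ] (ComputableRelation P ×
  (∀ X → X ∈ S ⇔ (∀ y → ∃[ σ ] (σ ≺ X × T (P y σ)))))

-- The fair-coin measure 2^(-|σ|) of the cylinder [σ].
μ[_] : List Bool → ℚ
μ[ σ ] = foldr (λ _ q → ½ ℚ.* q) 1ℚ σ

∑[_]_ : ℕ → (ℕ → ℚ) → ℚ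
∑[ n ] f = foldr ℚ._+_ 0ℚ (applyUpTo f n)

-- λ(S) = 0, where λ is the (outer) measure given by the infimum of
-- Σᵢ μ[σᵢ] over all countable covers of S by cylinders [σᵢ].
Null : Class → Set₁
Null S = ∀ ε → 0ℚ ℚ.< ε → ∃[ σ ]
  ((∀ X → X ∈ S → ∃[ i ] σ i ≺ X) × (∀ n → (∑[ n ] (μ[_] ∘ σ)) ℚ.≤ ε))

Weakly2Random : Subset → Set₁
Weakly2Random R = ∀ S → IsΠ⁰₂ S → Null S → R ∉ S

-- Suppose ∅″ ≤tt R′ via formulas φ_x.  Truth of φ_x in X′ is a Boolean
-- combination of Σ⁰₁ events, so it is the limit of approximations computed
-- from initial segments of X, and these change only finitely often on every
-- path, the changes being counted by a bounded monotone function.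
--
-- For each k take N = 2 (k + 1) numbers e_0, …, e_{N-1} of programs with
-- oracle ∅′ and the disjoint events D_i, approximated by clopen sets, that
-- Σ_j j φ_{e_j} = i, reading formulas as truth values.  A target i < N is
-- moved cyclically whenever the approximation to D_i has measure more than
-- 1/(k + 1).  Because the measures stabilise and the D_i are disjoint, the
-- target has a limit.  The programs know their own numbers, so e_i can be
-- arranged to be in ∅″ iff i is the limit of the target, a Σ⁰₁(∅′) event.
-- Then R lies in D_i for the limit target i.  Hence R lies in the class of
-- all X whose initial segments are on target infinitely often for every k.
-- This class is Π⁰₂ since the target is computable at every stage, and
-- null since, up to a set of small measure, it is contained for each k in
-- a clopen set of measure at most 1/(k + 1).

module Submission where

open import Defs
open import Axiom.ExcludedMiddle using (ExcludedMiddle)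
open import Data.Product using (_×_; ∃-syntax)
open import Relation.Nullary using (¬_)
open import Algebra.Properties.Monoid.Mult using (×-assocˡ; ×-homo-+)
open import Data.Bool using (Bool; true; false; T; if_then_else_)
open import Data.Fin using (Fin; zero; suc)
open import Data.Integer as ℤ using (+[1+_]; -[1+_]; +≤+)
open import Data.List using (List; []; _∷_; length; _++_; take; drop; replicate)
open import Data.List.Properties using (length-++; length-replicate; take++drop≡id)
open import Data.Nat using (ℕ; zero; suc; _+_; _*_; _∸_; _^_; _≤_; _<_; z≤n; s≤s; _⊔_; _≟_)
open import Data.Nat.Induction using (<-rec)
open import Data.Nat.Properties
open import Data.Nat.Solver using (module +-*-Solver)
open import Data.Product using (_,_; proj₁; proj₂)
open import Data.Rational as ℚ using (ℚ; mkℚ; 0ℚ; 1ℚ; ½; toℚᵘ)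
import Data.Rational.Properties as ℚ
open import Data.Rational.Unnormalised as ℚᵘ using (mkℚᵘ)
import Data.Rational.Unnormalised.Properties as ℚᵘ
open import Data.Sum using (_⊎_; inj₁; inj₂)
open import Data.Unit using (⊤; tt)
open import Data.Vec using (Vec; []; _∷_)
import Data.Vec as Vec
open import Function.Base using (_∘_; id)
open import Function.Bundles using (_⇔_; mk⇔; Equivalence)
open import Level using (0ℓ)
open import Relation.Binary.Definitions using (tri<; tri≈; tri>)
open import Relation.Binary.PropositionalEquality
open import Relation.Nullary using (yes; no; contradiction)
open import Relation.Nullary.Decidable using (decidable-stable)
open import Relation.Unary using (Pred; Decidable; ∅; _∈_; _∉_)
open import Algebra.Definitions.RawMonoid ℚ.+-0-rawMonoid using () renaming (_×_ to _·_)

-- Pairing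

-- Truth-table reducibility enters through uniformity: the formulas, hence their finitely many
-- atoms, are fixed before `X` is given. For each k this bounds the changes along all paths at once,
-- including paths on which the reduction computes nothing sensible. The mean number of changes over
-- the strings of one length is therefore nondecreasing and bounded, so beyond some level only a set
-- of small measure changes again. Self-reference needs no recursion theorem. Membership of e in a
-- jump asks whether program e halts on e, so a program that pairs its input with constants sees its
-- own number, and the number m of the common search program can be decoded from that. The target is
-- computed with m as a parameter, before any particular m is chosen. Halting relative to a finite
-- oracle is approximated by checking numbered derivations rather than by running programs for a
-- number of steps: one rule table then yields soundness, monotonicity in the oracle and
-- computability.

⟨⟩-nextPair : ∀ x y → let (x′ , y′) = nextPair (x , y) in ⟨ x′ , y′ ⟩ ≡ suc ⟨ x , y ⟩
⟨⟩-nextPair zero y = trans (+-identityʳ _) (cong (λ z → suc (triangle z + z)) (+-identityʳ y))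
⟨⟩-nextPair (suc x) y rewrite +-suc x y = +-suc _ y

⟨⟩-unpair : ∀ n → ⟨ π₁ n , π₂ n ⟩ ≡ n
⟨⟩-unpair zero = refl
⟨⟩-unpair (suc n) = trans (⟨⟩-nextPair (π₁ n) (π₂ n)) (cong suc (⟨⟩-unpair n))

-- Transparent pairs of literals unfold to large terms.
infixr 5 _⊗_
opaque
  _⊗_ : ℕ → ℕ → ℕ
  x ⊗ y = ⟨ x , y ⟩

  ⊗≡⟨⟩ : ∀ x y → x ⊗ y ≡ ⟨ x , y ⟩
  ⊗≡⟨⟩ x y = refl

  π₁-⊗ : ∀ x y → π₁ (x ⊗ y) ≡ x
  π₁-⊗ x y = cong proj₁ (unpair-⟨⟩ x y)

  π₂-⊗ : ∀ x y → π₂ (x ⊗ y) ≡ y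
  π₂-⊗ x y = cong proj₂ (unpair-⟨⟩ x y)

  ⊗-π : ∀ n → π₁ n ⊗ π₂ n ≡ n
  ⊗-π = ⟨⟩-unpair

  m≤triangle : ∀ n → n ≤ triangle n
  m≤triangle zero = z≤n
  m≤triangle (suc n) = s≤s (m≤n+m n (triangle n))

  ⊗-≤₁ : ∀ x y → x ≤ x ⊗ y
  ⊗-≤₁ x y = ≤-trans (m≤m+n x y) (≤-trans (m≤triangle (x + y)) (m≤m+n _ y))

  ⊗-≤₂ : ∀ x y → y ≤ x ⊗ y
  ⊗-≤₂ x y = m≤n+m y (triangle (x + y))

  ⊗-<₂ : ∀ x y → y < suc x ⊗ y
  ⊗-<₂ x y = s≤s (m≤n+m y _)

⊗-injective : ∀ {x y x′ y′} → x ⊗ y ≡ x′ ⊗ y′ → x ≡ x′ × y ≡ y′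
⊗-injective {x} {y} {x′} {y′} eq =
  trans (sym (π₁-⊗ x y)) (trans (cong π₁ eq) (π₁-⊗ x′ y′)) ,
  trans (sym (π₂-⊗ x y)) (trans (cong π₂ eq) (π₂-⊗ x′ y′))

π₁-≤ : ∀ n → π₁ n ≤ n
π₁-≤ n = subst (π₁ n ≤_) (⊗-π n) (⊗-≤₁ _ _)

π₂-≤ : ∀ n → π₂ n ≤ n
π₂-≤ n = subst (π₂ n ≤_) (⊗-π n) (⊗-≤₂ _ _)

π₂-< : ∀ {t} n → π₁ n ≡ suc t → π₂ n < n
π₂-< {t} n eq = subst (π₂ n <_) (trans (cong (_⊗ π₂ n) (sym eq)) (⊗-π n)) (⊗-<₂ t (π₂ n))

-- Arithmetic functions

natrec : {X : Set} → X → (ℕ → X → X) → ℕ → X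
natrec z s zero = z
natrec z s (suc n) = s n (natrec z s n)

ifz : {X : Set} → ℕ → X → X → X
ifz zero a b = a
ifz (suc _) a b = b

dist : ℕ → ℕ → ℕ
dist x y = (x ∸ y) + (y ∸ x)

ifeq : ℕ → ℕ → ℕ → ℕ
ifeq x y v = ifz (dist x y) v 0

dist-refl : ∀ x → dist x x ≡ 0
dist-refl x rewrite n∸n≡0 x = refl

dist≡0 : ∀ x y → dist x y ≡ 0 → x ≡ y
dist≡0 x y eq = ≤-antisym (m∸n≡0⇒m≤n (m+n≡0⇒m≡0 _ eq)) (m∸n≡0⇒m≤n (m+n≡0⇒n≡0 (x ∸ y) eq))

ifeq-refl : ∀ x v → ifeq x x v ≡ v
ifeq-refl x v rewrite dist-refl x = refl

ifeq-≡ : ∀ {x y} v → x ≡ y → ifeq x y v ≡ v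
ifeq-≡ {x} v refl = ifeq-refl x v

ifeq-elim : ∀ {ℓ} (P : ℕ → Set ℓ) x y {v} → (x ≡ y → P v) → P 0 → P (ifeq x y v)
ifeq-elim P x y f p with dist x y in eq
... | zero = f (dist≡0 x y eq)
... | suc _ = p

ifeq-≢0 : ∀ x y {v} → ifeq x y v ≢ 0 → x ≡ y × v ≢ 0
ifeq-≢0 x y {v} = ifeq-elim (λ w → w ≢ 0 → x ≡ y × v ≢ 0) x y (λ e p → e , p) (λ p → contradiction refl p)

ifeq-≢ : ∀ {x y} v → x ≢ y → ifeq x y v ≡ 0
ifeq-≢ {x} {y} v ne = ifeq-elim (_≡ 0) x y (λ e → contradiction e ne) refl

sum< : (ℕ → ℕ) → ℕ → ℕ
sum< f zero = 0
sum< f (suc n) = sum< f n + f n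

sum<-cong : ∀ {f g : ℕ → ℕ} n → (∀ i → i < n → f i ≡ g i) → sum< f n ≡ sum< g n
sum<-cong zero eq = refl
sum<-cong (suc n) eq = cong₂ _+_ (sum<-cong n (λ i i<n → eq i (m<n⇒m<1+n i<n))) (eq n ≤-refl)

sum<-mono : ∀ {f g : ℕ → ℕ} n → (∀ i → i < n → f i ≤ g i) → sum< f n ≤ sum< g n
sum<-mono zero le = z≤n
sum<-mono (suc n) le = +-mono-≤ (sum<-mono n (λ i i<n → le i (m<n⇒m<1+n i<n))) (le n ≤-refl)

sum<-≢0 : ∀ f n → sum< f n ≢ 0 → ∃[ i ] (i < n × f i ≢ 0)
sum<-≢0 f zero ne = contradiction refl ne
sum<-≢0 f (suc n) ne with f n in eq
... | suc _ = n , ≤-refl , λ e → 0≢1+n (trans (sym e) eq)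
... | zero with sum<-≢0 f n (λ e → ne (trans (+-identityʳ _) e))
...   | i , i<n , p = i , m<n⇒m<1+n i<n , p

sum<-term : ∀ f n i → i < n → f i ≤ sum< f n
sum<-term f (suc n) i i<1+n with m≤n⇒m<n∨m≡n (≤-pred i<1+n)
... | inj₁ i<n = ≤-trans (sum<-term f n i i<n) (m≤m+n _ _)
... | inj₂ refl = m≤n+m (f n) (sum< f n)

nth : List ℕ → ℕ → ℕ
nth [] _ = 0
nth (x ∷ xs) zero = x
nth (x ∷ xs) (suc t) = nth xs t

sg : ℕ → ℕ
sg n = ifz n 0 1

constCode : ℕ → Code
constCode zero = zero
constCode (suc n) = comp succ (constCode n)

⊢-constCode : ∀ {A} n {x} → A ⊢ constCode n [ x ]↦ n
⊢-constCode zero = zero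
⊢-constCode (suc n) = comp (⊢-constCode n) succ

⊢-cast : ∀ {A c n n′ k k′} → n ≡ n′ → k ≡ k′ → A ⊢ c [ n ]↦ k → A ⊢ c [ n′ ]↦ k′
⊢-cast refl refl d = d

-- Computable functions, as terms over a context of variables

pattern v0 = zero
pattern v1 = suc zero
pattern v2 = suc (suc zero)
pattern v3 = suc (suc (suc zero))
pattern v4 = suc (suc (suc (suc zero)))
pattern v5 = suc (suc (suc (suc (suc zero))))

module Terms (A : Subset) where

  encodeEnv : ∀ {n} → Vec ℕ n → ℕ
  encodeEnv [] = 0
  encodeEnv (x ∷ ρ) = x ⊗ encodeEnv ρ

  -- A term carries a function with a program for it, so that a function is shown computable by
  -- writing it once more as a term.
  record Tm (n : ℕ) : Set where
    field
      eval : Vec ℕ n → ℕ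
      code : Code
      correct : ∀ ρ → A ⊢ code [ encodeEnv ρ ]↦ eval ρ
  open Tm public

  ⊢-pair : ∀ {c d n x y} → A ⊢ c [ n ]↦ x → A ⊢ d [ n ]↦ y → A ⊢ pair c d [ n ]↦ (x ⊗ y)
  ⊢-pair {x = x} {y} p q = ⊢-cast refl (sym (⊗≡⟨⟩ x y)) (pair p q)

  ⊢-left : ∀ {x y} → A ⊢ left [ x ⊗ y ]↦ x
  ⊢-left {x} {y} = ⊢-cast refl (π₁-⊗ x y) left

  ⊢-right : ∀ {x y} → A ⊢ right [ x ⊗ y ]↦ y
  ⊢-right {x} {y} = ⊢-cast refl (π₂-⊗ x y) right

  conv : ∀ {n} (t : Tm n) {f : Vec ℕ n → ℕ} → (∀ ρ → eval t ρ ≡ f ρ) → Tm n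
  conv t {f} eq = record { eval = f ; code = code t ; correct = λ ρ → ⊢-cast refl (eq ρ) (correct t ρ) }

  varCode : ∀ {n} → Fin n → Code
  varCode zero = left
  varCode (suc i) = comp (varCode i) right

  var : ∀ {n} → Fin n → Tm n
  var i = record { eval = λ ρ → Vec.lookup ρ i ; code = varCode i ; correct = go i }
    where
    go : ∀ {n} (i : Fin n) (ρ : Vec ℕ n) → A ⊢ varCode i [ encodeEnv ρ ]↦ Vec.lookup ρ i
    go zero (x ∷ ρ) = ⊢-left
    go (suc i) (x ∷ ρ) = comp ⊢-right (go i ρ)

  lit : ∀ {n} → ℕ → Tm n
  lit k = record { eval = λ _ → k ; code = constCode k ; correct = λ _ → ⊢-constCode k }

  unary : ∀ {n} (c : Code) (f : ℕ → ℕ) → (∀ x → A ⊢ c [ x ]↦ f x) → Tm n → Tm n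
  unary c f p t = record
    { eval = λ ρ → f (eval t ρ) ; code = comp c (code t) ; correct = λ ρ → comp (correct t ρ) (p _) }

  sucT fstT sndT : ∀ {n} → Tm n → Tm n
  sucT = unary succ suc (λ _ → succ)
  fstT = unary left π₁ (λ _ → left)
  sndT = unary right π₂ (λ _ → right)

  infixr 5 _⊗T_
  _⊗T_ : ∀ {n} → Tm n → Tm n → Tm n
  t ⊗T u = record
    { eval = λ ρ → eval t ρ ⊗ eval u ρ ; code = pair (code t) (code u)
    ; correct = λ ρ → ⊢-pair (correct t ρ) (correct u ρ) }

  app : ∀ {m n} → Tm m → Vec (Tm n) m → Tm n
  app {m} {n} f ts = record
    { eval = λ ρ → eval f (Vec.map (λ t → eval t ρ) ts)
    ; code = comp (code f) (codes ts)
    ; correct = λ ρ → comp (go ts ρ) (correct f _) }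
    where
    codes : ∀ {m} → Vec (Tm n) m → Code
    codes [] = zero
    codes (t ∷ ts) = pair (code t) (codes ts)
    go : ∀ {m} (ts : Vec (Tm n) m) ρ → A ⊢ codes ts [ encodeEnv ρ ]↦ encodeEnv (Vec.map (λ t → eval t ρ) ts)
    go [] ρ = zero
    go (t ∷ ts) ρ = ⊢-pair (correct t ρ) (go ts ρ)

  rec : ∀ {n} → Tm n → Tm (suc (suc n)) → Tm n → Tm n
  rec {n} b s t = record
    { eval = λ ρ → natrec (eval b ρ) (λ k a → eval s (k ∷ a ∷ ρ)) (eval t ρ)
    -- The program `pair left right` is the identity, since pairing is onto; it passes the
    -- environment on as the parameter of the recursion.
    ; code = comp loop (pair (pair left right) (code t))
    ; correct = λ ρ → comp (⊢-pair (⊢-cast refl (⊗-π _) (⊢-pair left right)) (correct t ρ)) (go ρ (eval t ρ)) }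
    where
    loop : Code
    loop = prec (code b) (comp (code s) (pair (comp left right) (pair (comp right right) left)))
    go : ∀ ρ k → A ⊢ loop [ encodeEnv ρ ⊗ k ]↦ natrec (eval b ρ) (λ k a → eval s (k ∷ a ∷ ρ)) k
    go ρ zero = prec-zero (π₂-⊗ _ 0) (⊢-cast (sym (π₁-⊗ _ 0)) refl (correct b ρ))
    go ρ (suc k) =
      prec-suc (π₂-⊗ _ (suc k))
        (⊢-cast (trans (⊗≡⟨⟩ _ k) (cong (λ z → ⟨ z , k ⟩) (sym (π₁-⊗ _ (suc k))))) refl (go ρ k))
        (⊢-cast eq refl (comp (⊢-pair (comp ⊢-right ⊢-left)
          (⊢-pair (comp ⊢-right ⊢-right) ⊢-left)) (correct s _)))
      where
      x = natrec (eval b ρ) (λ k a → eval s (k ∷ a ∷ ρ)) k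
      eq : encodeEnv ρ ⊗ (k ⊗ x) ≡ ⟨ π₁ (encodeEnv ρ ⊗ suc k) , ⟨ k , x ⟩ ⟩
      eq rewrite π₁-⊗ (encodeEnv ρ) (suc k) | ⊗≡⟨⟩ k x = ⊗≡⟨⟩ _ _

  lift : ∀ {n} → Tm n → Tm (suc n)
  lift t = record
    { eval = λ { (_ ∷ ρ) → eval t ρ } ; code = comp (code t) right
    ; correct = λ { (_ ∷ ρ) → comp ⊢-right (correct t ρ) } }

  infixl 6 _+T_ _∸T_
  infixl 7 _*T_
  _+T_ _*T_ _∸T_ : ∀ {n} → Tm n → Tm n → Tm n
  t +T u = conv (rec u (sucT (var v1)) t) (λ ρ → go (eval t ρ) (eval u ρ))
    where
    go : ∀ x y → natrec y (λ _ a → suc a) x ≡ x + y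
    go zero y = refl
    go (suc x) y = cong suc (go x y)

  predT : ∀ {n} → Tm n → Tm n
  predT t = conv (rec (lit 0) (var v0) t) (λ ρ → go (eval t ρ))
    where
    go : ∀ x → natrec 0 (λ k _ → k) x ≡ x ∸ 1
    go zero = refl
    go (suc x) = refl

  t ∸T u = conv (rec t (predT (var v1)) u) (λ ρ → go (eval t ρ) (eval u ρ))
    where
    go : ∀ x y → natrec x (λ _ a → a ∸ 1) y ≡ x ∸ y
    go x zero = refl
    go x (suc y) = trans (cong (_∸ 1) (go x y)) (trans (∸-+-assoc x y 1) (cong (x ∸_) (+-comm y 1)))

  t *T u = conv (rec (lit 0) (lift (lift u) +T var v1) t) (λ ρ → go (eval t ρ) (eval u ρ))
    where
    go : ∀ x y → natrec 0 (λ _ a → y + a) x ≡ x * y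
    go zero y = refl
    go (suc x) y = cong (y +_) (go x y)

  2^T : ∀ {n} → Tm n → Tm n
  2^T t = conv (rec (lit 1) (lit 2 *T var v1) t) (λ ρ → go (eval t ρ))
    where
    go : ∀ x → natrec 1 (λ _ a → 2 * a) x ≡ 2 ^ x
    go zero = refl
    go (suc x) = cong (2 *_) (go x)

  ifzT : ∀ {n} → Tm n → Tm n → Tm n → Tm n
  ifzT t u w = conv (rec u (lift (lift w)) t) (λ ρ → go (eval t ρ))
    where
    go : ∀ {a b} x → natrec a (λ _ _ → b) x ≡ ifz x a b
    go zero = refl
    go (suc x) = refl

  sgT : ∀ {n} → Tm n → Tm n
  sgT t = ifzT t (lit 0) (lit 1)

  ifeqT : ∀ {n} → Tm n → Tm n → Tm n → Tm n
  ifeqT t u w = ifzT ((t ∸T u) +T (u ∸T t)) w (lit 0)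

  sumT : ∀ {n} → Tm (suc n) → Tm n → Tm n
  sumT {n} b t = conv (rec (lit 0) (var v1 +T b′) t) (λ ρ → go ρ (eval t ρ))
    where
    b′ : Tm (suc (suc n))
    b′ = record { eval = λ { (k ∷ _ ∷ ρ) → eval b (k ∷ ρ) }
                ; code = comp (code b) (pair left (comp right right))
                ; correct = λ { (k ∷ _ ∷ ρ) → comp (⊢-pair ⊢-left (comp ⊢-right ⊢-right)) (correct b (k ∷ ρ)) } }
    go : ∀ ρ x → natrec 0 (λ k a → a + eval b (k ∷ ρ)) x ≡ sum< (λ k → eval b (k ∷ ρ)) x
    go ρ zero = refl
    go ρ (suc x) = cong (_+ eval b (x ∷ ρ)) (go ρ x)

  nthT : ∀ {n} → List (Tm n) → Tm n → Tm n
  nthT {n} ts t = conv (sel ts t) (λ ρ → go ts t ρ)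
    where
    sel : List (Tm n) → Tm n → Tm n
    sel [] t = lit 0
    sel (u ∷ us) t = ifzT t u (sel us (predT t))
    evals : List (Tm n) → Vec ℕ n → List ℕ
    evals [] ρ = []
    evals (t ∷ ts) ρ = eval t ρ ∷ evals ts ρ
    go : ∀ ts t ρ → eval (sel ts t) ρ ≡ nth (evals ts ρ) (eval t ρ)
    go [] t ρ = refl
    go (u ∷ us) t ρ with eval t ρ in eq
    ... | zero = refl
    ... | suc x = trans (go us (predT t) ρ) (cong (nth (evals us ρ)) (cong (_∸ 1) eq))

  fun₁ : (f : ℕ → ℕ) (t : Tm 1) → (∀ x → eval t (x ∷ []) ≡ f x) → Tm 1
  fun₁ f t eq = conv t {λ ρ → f (Vec.lookup ρ v0)} λ { (x ∷ []) → eq x }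

  fun₂ : (f : ℕ → ℕ → ℕ) (t : Tm 2) → (∀ x y → eval t (x ∷ y ∷ []) ≡ f x y) → Tm 2
  fun₂ f t eq = conv t {λ ρ → f (Vec.lookup ρ v0) (Vec.lookup ρ v1)} λ { (x ∷ y ∷ []) → eq x y }

  fun₃ : (f : ℕ → ℕ → ℕ → ℕ) (t : Tm 3) → (∀ x y z → eval t (x ∷ y ∷ z ∷ []) ≡ f x y z) → Tm 3
  fun₃ f t eq = conv t {λ ρ → f (Vec.lookup ρ v0) (Vec.lookup ρ v1) (Vec.lookup ρ v2)}
    λ { (x ∷ y ∷ z ∷ []) → eq x y z }

  fun₄ : (f : ℕ → ℕ → ℕ → ℕ → ℕ) (t : Tm 4) → (∀ x y z u → eval t (x ∷ y ∷ z ∷ u ∷ []) ≡ f x y z u) → Tm 4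
  fun₄ f t eq = conv t {λ ρ → f (Vec.lookup ρ v0) (Vec.lookup ρ v1) (Vec.lookup ρ v2) (Vec.lookup ρ v3)}
    λ { (x ∷ y ∷ z ∷ u ∷ []) → eq x y z u }

  unaryCode : Tm 1 → Code
  unaryCode t = comp (code t) (pair (pair left right) zero)

  ⊢-unaryCode : ∀ t n → A ⊢ unaryCode t [ n ]↦ eval t (n ∷ [])
  ⊢-unaryCode t n = comp (⊢-pair (⊢-cast refl (⊗-π n) (⊢-pair left right)) zero) (correct t (n ∷ []))

  binaryCode : Tm 2 → Code
  binaryCode t = comp (code t) (pair left (pair right zero))

  ⊢-binaryCode : ∀ t x y → A ⊢ binaryCode t [ ⟨ x , y ⟩ ]↦ eval t (x ∷ y ∷ [])
  ⊢-binaryCode t x y = ⊢-cast (⊗≡⟨⟩ x y) refl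
    (comp (⊢-pair ⊢-left (⊢-pair ⊢-right zero)) (correct t (x ∷ y ∷ [])))

-- Course-of-values recursion

iterπ₂ : ℕ → ℕ → ℕ
iterπ₂ t = natrec t (λ _ → π₂)

covTable : (ℕ → ℕ → ℕ) → ℕ → ℕ
covTable G = natrec 0 (λ w t → G w t ⊗ t)

-- The latest value is outermost in the table, so the value at `i` lies under `w ∸ suc i` later
-- ones.
covGet : ℕ → ℕ → ℕ → ℕ
covGet w t i = π₁ (iterπ₂ t (w ∸ suc i))

cov : (ℕ → ℕ → ℕ) → ℕ → ℕ
cov G w = G w (covTable G w)

covGet-cov : ∀ G {w i} → i < w → covGet w (covTable G w) i ≡ cov G i
covGet-cov G {w} {i} i<w =
  trans (cong (λ w → π₁ (iterπ₂ (covTable G w) d)) (sym (m∸n+n≡m i<w)))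
    (trans (cong π₁ (unwind d)) (π₁-⊗ _ _))
  where
  d = w ∸ suc i
  shift : ∀ t d → iterπ₂ t (suc d) ≡ iterπ₂ (π₂ t) d
  shift t zero = refl
  shift t (suc d) = cong π₂ (shift t d)
  unwind : ∀ d → iterπ₂ (covTable G (d + suc i)) d ≡ covTable G (suc i)
  unwind zero = refl
  unwind (suc d) = trans (shift _ d) (trans (cong (λ t → iterπ₂ t d) (π₂-⊗ _ _)) (unwind d))

-- Judgments derived by the checker: 1 ⊗ c ⊗ n ⊗ k stands for φ_c(n) = k;
-- 2 ⊗ c ⊗ n ⊗ k for φ_c⟨n,j⟩ > 0 for all j < k; 3 ⊗ c ⊗ 0 for c being
-- the number of a program; 4 ⊗ c ⊗ 0 for φ_c(c)↓.

kindOf progOf inputOf outputOf : ℕ → ℕ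
kindOf F = π₁ F
progOf F = π₁ (π₂ F)
inputOf F = π₁ (π₂ (π₂ F))
outputOf F = π₂ (π₂ (π₂ F))

computes : ℕ → ℕ → ℕ → ℕ
computes c n k = 1 ⊗ c ⊗ n ⊗ k

positiveBelow : ℕ → ℕ → ℕ → ℕ
positiveBelow c n k = 2 ⊗ c ⊗ n ⊗ k

isCode : ℕ → ℕ
isCode c = 3 ⊗ c ⊗ 0

halts : ℕ → ℕ
halts c = 4 ⊗ c ⊗ 0

-- Conclusion of the rule t with immediate data a, b and premises ra, rb;
-- qa is the oracle's answer at a: 0 unknown, 1 no, 2 yes.
opaque
  rule : (qa t a b ra rb : ℕ) → ℕ
  rule qa t a b ra rb = nth
    ( 0
    ∷ computes ⌜ zero ⌝ a 0
    ∷ computes ⌜ succ ⌝ a (suc a)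
    ∷ computes ⌜ left ⌝ a (π₁ a)
    ∷ computes ⌜ right ⌝ a (π₂ a)
    ∷ ifz qa 0 (computes ⌜ oracle ⌝ a (qa ∸ 1))
    ∷ ifeq (kindOf ra) 1 (ifeq (kindOf rb) 1 (ifeq (inputOf rb) (inputOf ra)
        (computes (5 ⊗ progOf ra ⊗ progOf rb) (inputOf ra) (outputOf ra ⊗ outputOf rb))))
    ∷ ifeq (kindOf ra) 1 (ifeq (kindOf rb) 1 (ifeq (inputOf rb) (outputOf ra)
        (computes (6 ⊗ progOf rb ⊗ progOf ra) (inputOf ra) (outputOf rb))))
    -- Here `b` may be the number of no program; that a number is one is certified separately, by
    -- `isCode`.
    ∷ ifeq (kindOf ra) 1 (computes (7 ⊗ progOf ra ⊗ b) (inputOf ra ⊗ 0) (outputOf ra))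
    ∷ ifeq (kindOf ra) 1 (ifeq (kindOf rb) 1 (ifeq (π₁ (progOf ra)) 7
        (ifeq (progOf rb) (π₂ (π₂ (progOf ra)))
        (ifeq (inputOf rb) (π₁ (inputOf ra) ⊗ π₂ (inputOf ra) ⊗ outputOf ra)
        (computes (progOf ra) (π₁ (inputOf ra) ⊗ suc (π₂ (inputOf ra))) (outputOf rb))))))
    ∷ ifeq (kindOf ra) 2 (ifeq (kindOf rb) 1 (ifeq (progOf rb) (progOf ra)
        (ifeq (inputOf rb) (inputOf ra ⊗ outputOf ra) (ifeq (outputOf rb) 0
        (computes (8 ⊗ progOf ra) (inputOf ra) (outputOf ra))))))
    ∷ positiveBelow a b 0
    ∷ ifeq (kindOf ra) 2 (ifeq (kindOf rb) 1 (ifeq (progOf rb) (progOf ra)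
        (ifeq (inputOf rb) (inputOf ra ⊗ outputOf ra) (ifz (outputOf rb) 0
        (positiveBelow (progOf ra) (inputOf ra) (suc (outputOf ra)))))))
    ∷ ifz (5 ∸ a) 0 (isCode (a ⊗ 0))
    ∷ ifeq (kindOf ra) 3 (ifeq (kindOf rb) 3 (isCode (5 ⊗ progOf ra ⊗ progOf rb)))
    ∷ ifeq (kindOf ra) 3 (ifeq (kindOf rb) 3 (isCode (6 ⊗ progOf ra ⊗ progOf rb)))
    ∷ ifeq (kindOf ra) 3 (ifeq (kindOf rb) 3 (isCode (7 ⊗ progOf ra ⊗ progOf rb)))
    ∷ ifeq (kindOf ra) 3 (isCode (8 ⊗ progOf ra))
    ∷ ifeq (kindOf ra) 1 (ifeq (kindOf rb) 3 (ifeq (progOf rb) (progOf ra)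
        (ifeq (inputOf ra) (progOf ra) (halts (progOf ra)))))
    ∷ []) t

-- A witness reads as `t ⊗ a ⊗ b`, where `a` and `b` serve both as immediate data and as numbers of
-- the derivations of the premises.
checkStep : (ℕ → ℕ) → ℕ → ℕ → ℕ
checkStep q w t = rule (q (π₁ (π₂ w))) (π₁ w) (π₁ (π₂ w)) (π₂ (π₂ w))
  (covGet w t (π₁ (π₂ w))) (covGet w t (π₂ (π₂ w)))

check : (ℕ → ℕ) → ℕ → ℕ
check q = cov (checkStep q)

opaque
  unfolding rule
  -- A witness with tag `0` need not exceed the numbers of its premises, the number `0` being an
  -- example; course-of-values recursion survives because such witnesses derive nothing.
  rule-zero : ∀ {qa t a b ra rb} → t ≡ 0 → rule qa t a b ra rb ≡ 0
  rule-zero refl = refl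

check-unfold : ∀ q w → check q w ≡
  rule (q (π₁ (π₂ w))) (π₁ w) (π₁ (π₂ w)) (π₂ (π₂ w)) (check q (π₁ (π₂ w))) (check q (π₂ (π₂ w)))
check-unfold q w = go _ refl
  where
  a = π₁ (π₂ w)
  b = π₂ (π₂ w)
  go : ∀ t → π₁ w ≡ t → check q w ≡ rule (q a) (π₁ w) a b (check q a) (check q b)
  go zero eq = trans (rule-zero eq) (sym (rule-zero eq))
  go (suc t) eq = cong₂ (rule (q a) (π₁ w) a b)
    (covGet-cov (checkStep q) (≤-<-trans (π₁-≤ (π₂ w)) (π₂-< w eq)))
    (covGet-cov (checkStep q) (≤-<-trans (π₂-≤ (π₂ w)) (π₂-< w eq)))

check-⊗ : ∀ q t a b → check q (t ⊗ a ⊗ b) ≡ rule (q a) t a b (check q a) (check q b)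
check-⊗ q t a b = trans (check-unfold q (t ⊗ a ⊗ b)) (go (π₁-⊗ t _) (trans (cong π₁ (π₂-⊗ t _)) (π₁-⊗ a b))
  (trans (cong π₂ (π₂-⊗ t _)) (π₂-⊗ a b)))
  where
  go : ∀ {t t′ a a′ b b′} → t ≡ t′ → a ≡ a′ → b ≡ b′ →
    rule (q a) t a b (check q a) (check q b) ≡ rule (q a′) t′ a′ b′ (check q a′) (check q b′)
  go refl refl refl = refl

-- Two oracles are followed at once: they differ for monotonicity and coincide for soundness.
check-induction : (q q′ : ℕ → ℕ) (P : ℕ → ℕ → Set) →
  (∀ {ra rb ra′ rb′} t a b → P ra ra′ → P rb rb′ → P (rule (q a) t a b ra rb) (rule (q′ a) t a b ra′ rb′)) →
  P 0 0 → ∀ w → P (check q w) (check q′ w)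
check-induction q q′ P step p0 = <-rec (λ w → P (check q w) (check q′ w)) λ w ih →
  subst₂ P (sym (check-unfold q w)) (sym (check-unfold q′ w)) (go w (π₁ w) refl ih)
  where
  go : ∀ w t → π₁ w ≡ t → (∀ {i} → i < w → P (check q i) (check q′ i)) →
    P (rule (q (π₁ (π₂ w))) (π₁ w) (π₁ (π₂ w)) (π₂ (π₂ w)) (check q (π₁ (π₂ w))) (check q (π₂ (π₂ w))))
      (rule (q′ (π₁ (π₂ w))) (π₁ w) (π₁ (π₂ w)) (π₂ (π₂ w)) (check q′ (π₁ (π₂ w))) (check q′ (π₂ (π₂ w))))
  go w zero eq ih = subst₂ P (sym (rule-zero eq)) (sym (rule-zero eq)) p0
  go w (suc t) eq ih = step (π₁ w) _ _ (ih (≤-<-trans (π₁-≤ (π₂ w)) (π₂-< w eq)))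
                                       (ih (≤-<-trans (π₂-≤ (π₂ w)) (π₂-< w eq)))

-- Monotonicity

infix 4 _⊑_
-- The flat order in which `0` is the undefined value.
_⊑_ : ℕ → ℕ → Set
x ⊑ y = x ≡ 0 ⊎ x ≡ y

⊑-map₂ : (F : ℕ → ℕ → ℕ) → (∀ y → F 0 y ≡ 0) → (∀ x → F x 0 ≡ 0) →
  ∀ {x x′ y y′} → x ⊑ x′ → y ⊑ y′ → F x y ⊑ F x′ y′
⊑-map₂ F l r (inj₁ refl) _ = inj₁ (l _)
⊑-map₂ F l r (inj₂ refl) (inj₁ refl) = inj₁ (r _)
⊑-map₂ F l r (inj₂ refl) (inj₂ refl) = inj₂ refl

⊑-map : (F : ℕ → ℕ) → F 0 ≡ 0 → ∀ {x x′} → x ⊑ x′ → F x ⊑ F x′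
⊑-map F e (inj₁ refl) = inj₁ e
⊑-map F e (inj₂ refl) = inj₂ refl

ifeq-0 : ∀ x y → ifeq x y 0 ≡ 0
ifeq-0 x y = ifeq-elim (_≡ 0) x y (λ _ → refl) refl

opaque
  unfolding rule
  -- Every rule is strict in whatever it uses: an unknown answer yields `0`, and a missing premise
  -- `0` has kind `0`, which fails the guards.
  rule-mono : ∀ t a b {qa qa′ ra ra′ rb rb′} → qa ⊑ qa′ → ra ⊑ ra′ → rb ⊑ rb′ →
    rule qa t a b ra rb ⊑ rule qa′ t a b ra′ rb′
  rule-mono 0 a b q p r = inj₁ refl
  rule-mono 1 a b q p r = inj₂ refl
  rule-mono 2 a b q p r = inj₂ refl
  rule-mono 3 a b q p r = inj₂ refl
  rule-mono 4 a b q p r = inj₂ refl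
  rule-mono 5 a b q p r = ⊑-map (λ z → rule z 5 a b 0 0) refl q
  rule-mono 6 a b q p r = ⊑-map₂ (rule 0 6 a b) (λ _ → refl) (λ x → ifeq-0 (kindOf x) 1) p r
  rule-mono 7 a b q p r = ⊑-map₂ (rule 0 7 a b) (λ _ → refl) (λ x → ifeq-0 (kindOf x) 1) p r
  rule-mono 8 a b q p r = ⊑-map (λ z → rule 0 8 a b z 0) refl p
  rule-mono 9 a b q p r = ⊑-map₂ (rule 0 9 a b) (λ _ → refl) (λ x → ifeq-0 (kindOf x) 1) p r
  rule-mono 10 a b q p r = ⊑-map₂ (rule 0 10 a b) (λ _ → refl) (λ x → ifeq-0 (kindOf x) 2) p r
  rule-mono 11 a b q p r = inj₂ refl
  rule-mono 12 a b q p r = ⊑-map₂ (rule 0 12 a b) (λ _ → refl) (λ x → ifeq-0 (kindOf x) 2) p r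
  rule-mono 13 a b q p r = inj₂ refl
  rule-mono 14 a b q p r = ⊑-map₂ (rule 0 14 a b) (λ _ → refl) (λ x → ifeq-0 (kindOf x) 3) p r
  rule-mono 15 a b q p r = ⊑-map₂ (rule 0 15 a b) (λ _ → refl) (λ x → ifeq-0 (kindOf x) 3) p r
  rule-mono 16 a b q p r = ⊑-map₂ (rule 0 16 a b) (λ _ → refl) (λ x → ifeq-0 (kindOf x) 3) p r
  rule-mono 17 a b q p r = ⊑-map (λ z → rule 0 17 a b z 0) refl p
  rule-mono 18 a b q p r = ⊑-map₂ (rule 0 18 a b) (λ _ → refl) (λ x → ifeq-0 (kindOf x) 1) p r
  rule-mono (suc (suc (suc (suc (suc (suc (suc (suc (suc (suc (suc (suc (suc (suc (suc (suc (suc (suc (suc _))))))))))))))))))) a b q p r = inj₁ refl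

check-mono : ∀ {q q′} → (∀ n → q n ⊑ q′ n) → ∀ w → check q w ⊑ check q′ w
check-mono {q} {q′} le = check-induction q q′ _⊑_ (λ t a b → rule-mono t a b (le a)) (inj₁ refl)

-- Gödel numbers

opaque
  unfolding _⊗_
  ⌜pair⌝ : ∀ c d → ⌜ pair c d ⌝ ≡ 5 ⊗ ⌜ c ⌝ ⊗ ⌜ d ⌝
  ⌜pair⌝ c d = refl

  ⌜comp⌝ : ∀ c d → ⌜ comp c d ⌝ ≡ 6 ⊗ ⌜ c ⌝ ⊗ ⌜ d ⌝
  ⌜comp⌝ c d = refl

  ⌜prec⌝ : ∀ c d → ⌜ prec c d ⌝ ≡ 7 ⊗ ⌜ c ⌝ ⊗ ⌜ d ⌝
  ⌜prec⌝ c d = refl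

  ⌜mu⌝ : ∀ c → ⌜ mu c ⌝ ≡ 8 ⊗ ⌜ c ⌝
  ⌜mu⌝ c = refl

-- Indexed by the tag, so that a match at a literal tag leaves only the constructor that carries it.
data CodeView : ℕ → ℕ → Code → Set where
  zero   : ∀ {b} → CodeView 0 b zero
  succ   : ∀ {b} → CodeView 1 b succ
  left   : ∀ {b} → CodeView 2 b left
  right  : ∀ {b} → CodeView 3 b right
  oracle : ∀ {b} → CodeView 4 b oracle
  pair   : ∀ {b} c d → b ≡ ⌜ c ⌝ ⊗ ⌜ d ⌝ → CodeView 5 b (pair c d)
  comp   : ∀ {b} c d → b ≡ ⌜ c ⌝ ⊗ ⌜ d ⌝ → CodeView 6 b (comp c d)
  prec   : ∀ {b} c d → b ≡ ⌜ c ⌝ ⊗ ⌜ d ⌝ → CodeView 7 b (prec c d)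
  mu     : ∀ {b} c → b ≡ ⌜ c ⌝ → CodeView 8 b (mu c)

codeView : ∀ c → ∃[ t ] ∃[ b ] (t ⊗ b ≡ ⌜ c ⌝ × CodeView t b c)
codeView zero = 0 , 0 , ⊗≡⟨⟩ 0 0 , zero
codeView succ = 1 , 0 , ⊗≡⟨⟩ 1 0 , succ
codeView left = 2 , 0 , ⊗≡⟨⟩ 2 0 , left
codeView right = 3 , 0 , ⊗≡⟨⟩ 3 0 , right
codeView oracle = 4 , 0 , ⊗≡⟨⟩ 4 0 , oracle
codeView (pair c d) = 5 , ⌜ c ⌝ ⊗ ⌜ d ⌝ , sym (⌜pair⌝ c d) , pair c d refl
codeView (comp c d) = 6 , ⌜ c ⌝ ⊗ ⌜ d ⌝ , sym (⌜comp⌝ c d) , comp c d refl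
codeView (prec c d) = 7 , ⌜ c ⌝ ⊗ ⌜ d ⌝ , sym (⌜prec⌝ c d) , prec c d refl
codeView (mu c) = 8 , ⌜ c ⌝ , sym (⌜mu⌝ c) , mu c refl

viewCode : ∀ {t b} c → t ⊗ b ≡ ⌜ c ⌝ → CodeView t b c
viewCode {t} {b} c eq = go (codeView c)
  where
  go : ∃[ t ] ∃[ b ] (t ⊗ b ≡ ⌜ c ⌝ × CodeView t b c) → CodeView t b c
  go (t′ , b′ , eq′ , v) with refl , refl ← ⊗-injective (trans eq (sym eq′)) = v

⌜⌝-injective : ∀ {c d} → ⌜ c ⌝ ≡ ⌜ d ⌝ → c ≡ d
⌜⌝-injective {c} {d} eq = go (codeView c)
  where
  compare : ∀ {t b c d} → CodeView t b c → CodeView t b d → c ≡ d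
  go : ∃[ t ] ∃[ b ] (t ⊗ b ≡ ⌜ c ⌝ × CodeView t b c) → c ≡ d
  go (_ , _ , eq′ , v) = compare v (viewCode d (trans eq′ eq))
  compare zero zero = refl
  compare succ succ = refl
  compare left left = refl
  compare right right = refl
  compare oracle oracle = refl
  compare (pair c c′ p) (pair d d′ q) with r , r′ ← ⊗-injective (trans (sym p) q) =
    cong₂ pair (⌜⌝-injective r) (⌜⌝-injective r′)
  compare (comp c c′ p) (comp d d′ q) with r , r′ ← ⊗-injective (trans (sym p) q) =
    cong₂ comp (⌜⌝-injective r) (⌜⌝-injective r′)
  compare (prec c c′ p) (prec d d′ q) with r , r′ ← ⊗-injective (trans (sym p) q) =
    cong₂ prec (⌜⌝-injective r) (⌜⌝-injective r′)
  compare (mu c p) (mu d q) = cong mu (⌜⌝-injective (trans (sym p) q))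

-- Correctness of the checker

AgreesAt : Subset → ℕ → ℕ → Set
AgreesAt X n qn = qn ≡ 0 ⊎ (qn ≡ 1 × n ∉ X) ⊎ (qn ≡ 2 × n ∈ X)

Agrees : (ℕ → ℕ) → Subset → Set
Agrees q X = ∀ n → AgreesAt X n (q n)

-- Quantifying over the programs with number `c` makes judgments of kinds 1 and 2 vacuous when there
-- is none, so the rules for computations need not check their program numbers.
Meaning : Subset → (kind c n k : ℕ) → Set
Meaning X 1 c n k = ∀ d → c ≡ ⌜ d ⌝ → X ⊢ d [ n ]↦ k
Meaning X 2 c n k = ∀ d → c ≡ ⌜ d ⌝ → ∀ j → j < k → ∃[ y ] X ⊢ d [ n ⊗ j ]↦ suc y
Meaning X 3 c n k = ∃[ d ] c ≡ ⌜ d ⌝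
Meaning X 4 c n k = c ∈ X ′
Meaning X _ c n k = ⊤

Holds : Subset → ℕ → Set
Holds X F = Meaning X (kindOf F) (progOf F) (inputOf F) (outputOf F)

module _ (X : Subset) where

  holds-⊗ : ∀ {t c n k} → Meaning X t c n k → Holds X (t ⊗ c ⊗ n ⊗ k)
  holds-⊗ {t} {c} {n} {k} m
    rewrite π₁-⊗ t (c ⊗ n ⊗ k) | π₂-⊗ t (c ⊗ n ⊗ k) | π₁-⊗ c (n ⊗ k) | π₂-⊗ c (n ⊗ k)
          | π₁-⊗ n k | π₂-⊗ n k = m

  holds-code : ∀ {c} → ∃[ d ] c ≡ ⌜ d ⌝ → Holds X (isCode c)
  holds-code {c} m rewrite π₁-⊗ 3 (c ⊗ 0) | π₂-⊗ 3 (c ⊗ 0) | π₁-⊗ c 0 = m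

  holds-halts : ∀ {c} → c ∈ X ′ → Holds X (halts c)
  holds-halts {c} m rewrite π₁-⊗ 4 (c ⊗ 0) | π₂-⊗ 4 (c ⊗ 0) | π₁-⊗ c 0 = m

  meaning : ∀ {F t} → Holds X F → kindOf F ≡ t → Meaning X t (progOf F) (inputOf F) (outputOf F)
  meaning h refl = h

  guard : ∀ {F} x y → (x ≡ y → Holds X F) → Holds X (ifeq x y F)
  guard x y f = ifeq-elim (Holds X) x y f tt

  module _ {a b ra rb : ℕ} (ha : Holds X ra) (hb : Holds X rb) where
    private
      pair-case : kindOf ra ≡ 1 → kindOf rb ≡ 1 → inputOf rb ≡ inputOf ra →
        Meaning X 1 (5 ⊗ progOf ra ⊗ progOf rb) (inputOf ra) (outputOf ra ⊗ outputOf rb)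
      pair-case p r e d eq with viewCode d eq
      ... | pair c c′ eqs with p₁ , p₂ ← ⊗-injective eqs =
        ⊢-cast refl (sym (⊗≡⟨⟩ _ _)) (pair (meaning {ra} ha p c p₁) (⊢-cast e refl (meaning {rb} hb r c′ p₂)))

      comp-case : kindOf ra ≡ 1 → kindOf rb ≡ 1 → inputOf rb ≡ outputOf ra →
        Meaning X 1 (6 ⊗ progOf rb ⊗ progOf ra) (inputOf ra) (outputOf rb)
      comp-case p r e d eq with viewCode d eq
      ... | comp c c′ eqs with p₁ , p₂ ← ⊗-injective eqs =
        comp (meaning {ra} ha p c′ p₂) (⊢-cast e refl (meaning {rb} hb r c p₁))

      prec-zero-case : kindOf ra ≡ 1 → Meaning X 1 (7 ⊗ progOf ra ⊗ b) (inputOf ra ⊗ 0) (outputOf ra)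
      prec-zero-case p d eq with viewCode d eq
      ... | prec c c′ eqs with p₁ , p₂ ← ⊗-injective eqs =
        prec-zero (π₂-⊗ _ 0) (⊢-cast (sym (π₁-⊗ _ 0)) refl (meaning {ra} ha p c p₁))

      prec-suc-case : kindOf ra ≡ 1 → kindOf rb ≡ 1 → π₁ (progOf ra) ≡ 7 → progOf rb ≡ π₂ (π₂ (progOf ra)) →
        inputOf rb ≡ π₁ (inputOf ra) ⊗ π₂ (inputOf ra) ⊗ outputOf ra →
        Meaning X 1 (progOf ra) (π₁ (inputOf ra) ⊗ suc (π₂ (inputOf ra))) (outputOf rb)
      prec-suc-case p r e₁ e₂ e₃ d eq
        with viewCode d (trans (trans (cong (_⊗ π₂ (progOf ra)) (sym e₁)) (⊗-π _)) eq)
      ... | prec c c′ eqs = prec-suc (π₂-⊗ n (suc m))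
          (⊢-cast (trans (trans (sym (⊗-π _)) (⊗≡⟨⟩ n m)) (cong ⟨_, m ⟩ (sym (π₁-⊗ n _)))) refl (meaning {ra} ha p _ eq))
          (⊢-cast (trans e₃ (trans (⊗≡⟨⟩ n _) (cong₂ ⟨_,_⟩ (sym (π₁-⊗ n _)) (⊗≡⟨⟩ m _)))) refl
            (meaning {rb} hb r c′ (trans e₂ (trans (cong π₂ eqs) (π₂-⊗ _ _)))))
        where
        n = π₁ (inputOf ra)
        m = π₂ (inputOf ra)

      mu-case : kindOf ra ≡ 2 → kindOf rb ≡ 1 → progOf rb ≡ progOf ra →
        inputOf rb ≡ inputOf ra ⊗ outputOf ra → outputOf rb ≡ 0 →
        Meaning X 1 (8 ⊗ progOf ra) (inputOf ra) (outputOf ra)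
      mu-case p r e₁ e₂ e₃ d eq with viewCode d eq
      ... | mu c eqs = mu (⊢-cast (trans e₂ (⊗≡⟨⟩ _ _)) e₃ (meaning {rb} hb r c (trans e₁ eqs))) below
        where
        below : ∀ j → j < outputOf ra → ∃[ y ] X ⊢ c [ ⟨ inputOf ra , j ⟩ ]↦ suc y
        below j j< with y , der ← meaning {ra} ha p c eqs j j< = y , ⊢-cast (⊗≡⟨⟩ _ j) refl der

      below-suc-case : kindOf ra ≡ 2 → kindOf rb ≡ 1 → progOf rb ≡ progOf ra →
        inputOf rb ≡ inputOf ra ⊗ outputOf ra → ∀ {y} → outputOf rb ≡ suc y →
        Meaning X 2 (progOf ra) (inputOf ra) (suc (outputOf ra))
      below-suc-case p r e₁ e₂ e₃ d eq j (s≤s j≤) with m≤n⇒m<n∨m≡n j≤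
      ... | inj₁ j< = meaning {ra} ha p d eq j j<
      ... | inj₂ refl = _ , ⊢-cast e₂ e₃ (meaning {rb} hb r d (trans e₁ eq))

      leaf-code : ∀ a → ∃[ d ] a ⊗ 0 ≡ ⌜ d ⌝ ⊎ 5 ∸ a ≡ 0
      leaf-code 0 = inj₁ (zero , ⊗≡⟨⟩ 0 0)
      leaf-code 1 = inj₁ (succ , ⊗≡⟨⟩ 1 0)
      leaf-code 2 = inj₁ (left , ⊗≡⟨⟩ 2 0)
      leaf-code 3 = inj₁ (right , ⊗≡⟨⟩ 3 0)
      leaf-code 4 = inj₁ (oracle , ⊗≡⟨⟩ 4 0)
      leaf-code (suc (suc (suc (suc (suc a))))) = inj₂ (0∸n≡0 a)

      leaf-case : Holds X (ifz (5 ∸ a) 0 (isCode (a ⊗ 0)))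
      leaf-case with leaf-code a
      ... | inj₂ eq rewrite eq = tt
      ... | inj₁ p with 5 ∸ a
      ...   | zero = tt
      ...   | suc _ = holds-code p

      code₂-case : ∀ {t} (f : Code → Code → Code) → (∀ c d → ⌜ f c d ⌝ ≡ t ⊗ ⌜ c ⌝ ⊗ ⌜ d ⌝) →
        kindOf ra ≡ 3 → kindOf rb ≡ 3 → ∃[ d ] t ⊗ progOf ra ⊗ progOf rb ≡ ⌜ d ⌝
      code₂-case {t} f eq p r with c , e ← meaning {ra} ha p | d , e′ ← meaning {rb} hb r =
        f c d , trans (cong₂ (λ x y → t ⊗ x ⊗ y) e e′) (sym (eq c d))

      code₁-case : kindOf ra ≡ 3 → ∃[ d ] 8 ⊗ progOf ra ≡ ⌜ d ⌝
      code₁-case p with c , e ← meaning {ra} ha p = mu c , trans (cong (8 ⊗_) e) (sym (⌜mu⌝ c))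

      halts-case : kindOf ra ≡ 1 → kindOf rb ≡ 3 → progOf rb ≡ progOf ra → inputOf ra ≡ progOf ra → progOf ra ∈ X ′
      halts-case p r e₁ e₂ with c , e ← meaning {rb} hb r = c , trans (sym e₁) e ,
        outputOf ra , ⊢-cast e₂ refl (meaning {ra} ha p c (trans (sym e₁) e))

    opaque
      unfolding rule
      rule-sound : ∀ {qa} t → AgreesAt X a qa → Holds X (rule qa t a b ra rb)
      rule-sound 0 q = tt
      rule-sound 1 q = holds-⊗ λ d eq → case-zero d (trans (⊗≡⟨⟩ 0 0) eq)
        where
        case-zero : ∀ d → 0 ⊗ 0 ≡ ⌜ d ⌝ → X ⊢ d [ a ]↦ 0
        case-zero d eq with viewCode d eq
        ... | zero = zero
      rule-sound 2 q = holds-⊗ λ d eq → case-succ d (trans (⊗≡⟨⟩ 1 0) eq)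
        where
        case-succ : ∀ d → 1 ⊗ 0 ≡ ⌜ d ⌝ → X ⊢ d [ a ]↦ suc a
        case-succ d eq with viewCode d eq
        ... | succ = succ
      rule-sound 3 q = holds-⊗ λ d eq → case-left d (trans (⊗≡⟨⟩ 2 0) eq)
        where
        case-left : ∀ d → 2 ⊗ 0 ≡ ⌜ d ⌝ → X ⊢ d [ a ]↦ π₁ a
        case-left d eq with viewCode d eq
        ... | left = left
      rule-sound 4 q = holds-⊗ λ d eq → case-right d (trans (⊗≡⟨⟩ 3 0) eq)
        where
        case-right : ∀ d → 3 ⊗ 0 ≡ ⌜ d ⌝ → X ⊢ d [ a ]↦ π₂ a
        case-right d eq with viewCode d eq
        ... | right = right
      rule-sound 5 (inj₁ refl) = tt
      rule-sound 5 (inj₂ (inj₁ (refl , a∉X))) = holds-⊗ λ d eq → case-oracle d (trans (⊗≡⟨⟩ 4 0) eq)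
        where
        case-oracle : ∀ d → 4 ⊗ 0 ≡ ⌜ d ⌝ → X ⊢ d [ a ]↦ 0
        case-oracle d eq with viewCode d eq
        ... | oracle = oracle-no a∉X
      rule-sound 5 (inj₂ (inj₂ (refl , a∈X))) = holds-⊗ λ d eq → case-oracle d (trans (⊗≡⟨⟩ 4 0) eq)
        where
        case-oracle : ∀ d → 4 ⊗ 0 ≡ ⌜ d ⌝ → X ⊢ d [ a ]↦ 1
        case-oracle d eq with viewCode d eq
        ... | oracle = oracle-yes a∈X
      rule-sound 6 q = guard _ 1 λ p → guard _ 1 λ r → guard _ _ λ e → holds-⊗ (pair-case p r e)
      rule-sound 7 q = guard _ 1 λ p → guard _ 1 λ r → guard _ _ λ e → holds-⊗ (comp-case p r e)
      rule-sound 8 q = guard _ 1 λ p → holds-⊗ (prec-zero-case p)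
      rule-sound 9 q = guard _ 1 λ p → guard _ 1 λ r → guard _ 7 λ e₁ → guard _ _ λ e₂ → guard _ _ λ e₃ →
        holds-⊗ (prec-suc-case p r e₁ e₂ e₃)
      rule-sound 10 q = guard _ 2 λ p → guard _ 1 λ r → guard _ _ λ e₁ → guard _ _ λ e₂ → guard _ 0 λ e₃ →
        holds-⊗ (mu-case p r e₁ e₂ e₃)
      rule-sound 11 q = holds-⊗ λ d eq j ()
      rule-sound 12 q = guard _ 2 λ p → guard _ 1 λ r → guard _ _ λ e₁ → guard _ _ λ e₂ → last p r e₁ e₂ _ refl
        where
        last : kindOf ra ≡ 2 → kindOf rb ≡ 1 → progOf rb ≡ progOf ra → inputOf rb ≡ inputOf ra ⊗ outputOf ra →
          ∀ y → outputOf rb ≡ y → Holds X (ifz y 0 (positiveBelow (progOf ra) (inputOf ra) (suc (outputOf ra))))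
        last p r e₁ e₂ zero e₃ = tt
        last p r e₁ e₂ (suc y) e₃ = holds-⊗ (below-suc-case p r e₁ e₂ e₃)
      rule-sound 13 q = leaf-case
      rule-sound 14 q = guard _ 3 λ p → guard _ 3 λ r → holds-code (code₂-case pair ⌜pair⌝ p r)
      rule-sound 15 q = guard _ 3 λ p → guard _ 3 λ r → holds-code (code₂-case comp ⌜comp⌝ p r)
      rule-sound 16 q = guard _ 3 λ p → guard _ 3 λ r → holds-code (code₂-case prec ⌜prec⌝ p r)
      rule-sound 17 q = guard _ 3 λ p → holds-code (code₁-case p)
      rule-sound 18 q = guard _ 1 λ p → guard _ 3 λ r → guard _ _ λ e₁ → guard _ _ λ e₂ →
        holds-halts (halts-case p r e₁ e₂)
      rule-sound (suc (suc (suc (suc (suc (suc (suc (suc (suc (suc (suc (suc (suc (suc (suc (suc (suc (suc (suc _))))))))))))))))))) q = tt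

  check-sound : ∀ {q} → Agrees q X → ∀ w → Holds X (check q w)
  check-sound {q} agrees = check-induction q q (λ F _ → Holds X F)
    (λ t a b ha hb → rule-sound ha hb t (agrees a)) tt

-- Completeness of the checker

module _ (t c n k : ℕ) where
  kindOf-⊗ : kindOf (t ⊗ c ⊗ n ⊗ k) ≡ t
  kindOf-⊗ = π₁-⊗ t _

  progOf-⊗ : progOf (t ⊗ c ⊗ n ⊗ k) ≡ c
  progOf-⊗ = trans (cong π₁ (π₂-⊗ t _)) (π₁-⊗ c _)

  inputOf-⊗ : inputOf (t ⊗ c ⊗ n ⊗ k) ≡ n
  inputOf-⊗ = trans (cong (λ z → π₁ (π₂ z)) (π₂-⊗ t _)) (trans (cong π₁ (π₂-⊗ c _)) (π₁-⊗ n k))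

  outputOf-⊗ : outputOf (t ⊗ c ⊗ n ⊗ k) ≡ k
  outputOf-⊗ = trans (cong (λ z → π₂ (π₂ z)) (π₂-⊗ t _)) (trans (cong π₂ (π₂-⊗ c _)) (π₂-⊗ n k))

opaque
  unfolding rule

  rule-pair : ∀ {qa a b} c d n x y →
    rule qa 6 a b (computes c n x) (computes d n y) ≡ computes (5 ⊗ c ⊗ d) n (x ⊗ y)
  rule-pair c d n x y rewrite kindOf-⊗ 1 c n x | kindOf-⊗ 1 d n y | inputOf-⊗ 1 c n x | inputOf-⊗ 1 d n y
    | progOf-⊗ 1 c n x | progOf-⊗ 1 d n y | outputOf-⊗ 1 c n x | outputOf-⊗ 1 d n y = ifeq-refl n _

  rule-comp : ∀ {qa a b} c d n m k →
    rule qa 7 a b (computes d n m) (computes c m k) ≡ computes (6 ⊗ c ⊗ d) n k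
  rule-comp c d n m k rewrite kindOf-⊗ 1 d n m | kindOf-⊗ 1 c m k | inputOf-⊗ 1 d n m | inputOf-⊗ 1 c m k
    | progOf-⊗ 1 d n m | progOf-⊗ 1 c m k | outputOf-⊗ 1 d n m | outputOf-⊗ 1 c m k = ifeq-refl m _

  rule-prec-zero : ∀ {qa a rb} c d n x →
    rule qa 8 a d (computes c n x) rb ≡ computes (7 ⊗ c ⊗ d) (n ⊗ 0) x
  rule-prec-zero c d n x rewrite kindOf-⊗ 1 c n x | inputOf-⊗ 1 c n x
    | progOf-⊗ 1 c n x | outputOf-⊗ 1 c n x = refl

  rule-prec-suc : ∀ {qa a b} c d n k x y →
    rule qa 9 a b (computes (7 ⊗ c ⊗ d) (n ⊗ k) x) (computes d (n ⊗ k ⊗ x) y) ≡ computes (7 ⊗ c ⊗ d) (n ⊗ suc k) y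
  rule-prec-suc c d n k x y
    rewrite kindOf-⊗ 1 (7 ⊗ c ⊗ d) (n ⊗ k) x | kindOf-⊗ 1 d (n ⊗ k ⊗ x) y
    | inputOf-⊗ 1 (7 ⊗ c ⊗ d) (n ⊗ k) x | inputOf-⊗ 1 d (n ⊗ k ⊗ x) y
    | progOf-⊗ 1 (7 ⊗ c ⊗ d) (n ⊗ k) x | progOf-⊗ 1 d (n ⊗ k ⊗ x) y
    | outputOf-⊗ 1 (7 ⊗ c ⊗ d) (n ⊗ k) x | outputOf-⊗ 1 d (n ⊗ k ⊗ x) y
    | π₁-⊗ 7 (c ⊗ d) | π₂-⊗ 7 (c ⊗ d) | π₂-⊗ c d | π₁-⊗ n k | π₂-⊗ n k
    = trans (ifeq-refl d _) (ifeq-refl (n ⊗ k ⊗ x) _)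

  rule-mu : ∀ {qa a b} c n k →
    rule qa 10 a b (positiveBelow c n k) (computes c (n ⊗ k) 0) ≡ computes (8 ⊗ c) n k
  rule-mu c n k
    rewrite kindOf-⊗ 2 c n k | inputOf-⊗ 2 c n k | progOf-⊗ 2 c n k | outputOf-⊗ 2 c n k
    | kindOf-⊗ 1 c (n ⊗ k) 0 | inputOf-⊗ 1 c (n ⊗ k) 0 | progOf-⊗ 1 c (n ⊗ k) 0 | outputOf-⊗ 1 c (n ⊗ k) 0
    = trans (ifeq-refl c _) (ifeq-refl (n ⊗ k) _)

  rule-below-suc : ∀ {qa a b} c n k y →
    rule qa 12 a b (positiveBelow c n k) (computes c (n ⊗ k) (suc y)) ≡ positiveBelow c n (suc k)
  rule-below-suc c n k y
    rewrite kindOf-⊗ 2 c n k | inputOf-⊗ 2 c n k | progOf-⊗ 2 c n k | outputOf-⊗ 2 c n k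
    | kindOf-⊗ 1 c (n ⊗ k) (suc y) | inputOf-⊗ 1 c (n ⊗ k) (suc y)
    | progOf-⊗ 1 c (n ⊗ k) (suc y) | outputOf-⊗ 1 c (n ⊗ k) (suc y)
    = trans (ifeq-refl c _) (ifeq-refl (n ⊗ k) _)

  rule-code : ∀ {qa a b} c d →
    rule qa 14 a b (isCode c) (isCode d) ≡ isCode (5 ⊗ c ⊗ d) ×
    rule qa 15 a b (isCode c) (isCode d) ≡ isCode (6 ⊗ c ⊗ d) ×
    rule qa 16 a b (isCode c) (isCode d) ≡ isCode (7 ⊗ c ⊗ d)
  rule-code c d rewrite π₁-⊗ 3 (c ⊗ 0) | π₂-⊗ 3 (c ⊗ 0) | π₁-⊗ c 0
    | π₁-⊗ 3 (d ⊗ 0) | π₂-⊗ 3 (d ⊗ 0) | π₁-⊗ d 0 = refl , refl , refl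

  rule-code-mu : ∀ {qa a b rb} c → rule qa 17 a b (isCode c) rb ≡ isCode (8 ⊗ c)
  rule-code-mu c rewrite π₁-⊗ 3 (c ⊗ 0) | π₂-⊗ 3 (c ⊗ 0) | π₁-⊗ c 0 = refl

  rule-halts : ∀ {qa a b} c k → rule qa 18 a b (computes c c k) (isCode c) ≡ halts c
  rule-halts c k rewrite π₁-⊗ 3 (c ⊗ 0) | π₂-⊗ 3 (c ⊗ 0) | π₁-⊗ c 0
    | kindOf-⊗ 1 c c k | inputOf-⊗ 1 c c k | progOf-⊗ 1 c c k = trans (ifeq-refl c _) (ifeq-refl c _)

module _ (X : Subset) where

  -- The use principle is built in: one derivation `w` works for all partial oracles that agree with
  -- `X` and are defined below `ℓ`.
  Provable : ℕ → Set
  Provable F = ∃[ w ] ∃[ ℓ ] ∀ q → Agrees q X → (∀ n → n < ℓ → q n ≢ 0) → check q w ≡ F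

  by-rule₀ : ∀ {F} t a b → (∀ {qa ra rb} → AgreesAt X a qa → qa ≢ 0 → rule qa t a b ra rb ≡ F) → Provable F
  by-rule₀ t a b eq = t ⊗ a ⊗ b , suc a , λ q agrees def →
    trans (check-⊗ q t a b) (eq (agrees a) (def a ≤-refl))

  by-rule₁ : ∀ {F Fa} t b → Provable Fa → (∀ {qa a rb} → rule qa t a b Fa rb ≡ F) → Provable F
  by-rule₁ t b (a , ℓ , p) eq = t ⊗ a ⊗ b , ℓ , λ q agrees def →
    trans (check-⊗ q t a b) (trans (cong (λ ra → rule (q a) t a b ra (check q b)) (p q agrees def)) eq)

  by-rule₂ : ∀ {F Fa Fb} t → Provable Fa → Provable Fb → (∀ {qa a b} → rule qa t a b Fa Fb ≡ F) → Provable F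
  by-rule₂ t (a , ℓ , p) (b , ℓ′ , p′) eq = t ⊗ a ⊗ b , ℓ ⊔ ℓ′ , λ q agrees def →
    trans (check-⊗ q t a b) (trans (cong₂ (rule (q a) t a b)
      (p q agrees λ n n< → def n (≤-trans n< (m≤m⊔n ℓ ℓ′)))
      (p′ q agrees λ n n< → def n (≤-trans n< (m≤n⊔m ℓ ℓ′)))) eq)

  Provable-cast : ∀ {F F′} → F ≡ F′ → Provable F → Provable F′
  Provable-cast refl p = p

  opaque
    unfolding rule
    zero-provable : ∀ n → Provable (computes ⌜ zero ⌝ n 0)
    zero-provable n = by-rule₀ 1 n 0 λ _ _ → refl

    succ-provable : ∀ n → Provable (computes ⌜ succ ⌝ n (suc n))
    succ-provable n = by-rule₀ 2 n 0 λ _ _ → refl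

    left-provable : ∀ n → Provable (computes ⌜ left ⌝ n (π₁ n))
    left-provable n = by-rule₀ 3 n 0 λ _ _ → refl

    right-provable : ∀ n → Provable (computes ⌜ right ⌝ n (π₂ n))
    right-provable n = by-rule₀ 4 n 0 λ _ _ → refl

    oracle-yes-provable : ∀ {n} → n ∈ X → Provable (computes ⌜ oracle ⌝ n 1)
    oracle-yes-provable {n} n∈X = by-rule₀ 5 n 0 λ {_} {ra} {rb} → go {_} {ra} {rb}
      where
      go : ∀ {qa ra rb} → AgreesAt X n qa → qa ≢ 0 → rule qa 5 n 0 ra rb ≡ computes ⌜ oracle ⌝ n 1
      go (inj₁ e) ne = contradiction e ne
      go (inj₂ (inj₁ (_ , n∉X))) _ = contradiction n∈X n∉X
      go (inj₂ (inj₂ (refl , _))) _ = refl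

    oracle-no-provable : ∀ {n} → n ∉ X → Provable (computes ⌜ oracle ⌝ n 0)
    oracle-no-provable {n} n∉X = by-rule₀ 5 n 0 λ {_} {ra} {rb} → go {_} {ra} {rb}
      where
      go : ∀ {qa ra rb} → AgreesAt X n qa → qa ≢ 0 → rule qa 5 n 0 ra rb ≡ computes ⌜ oracle ⌝ n 0
      go (inj₁ e) ne = contradiction e ne
      go (inj₂ (inj₁ (refl , _))) _ = refl
      go (inj₂ (inj₂ (_ , n∈X))) _ = contradiction n∈X n∉X

    below-zero-provable : ∀ c n → Provable (positiveBelow c n 0)
    below-zero-provable c n = by-rule₀ 11 c n λ _ _ → refl

    leaf-code-provable : ∀ a → 5 ∸ a ≢ 0 → Provable (isCode (a ⊗ 0))
    leaf-code-provable a ne = by-rule₀ 13 a 0 λ _ _ → go (5 ∸ a) ne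
      where
      go : ∀ d → d ≢ 0 → ifz d 0 (isCode (a ⊗ 0)) ≡ isCode (a ⊗ 0)
      go zero ne = contradiction refl ne
      go (suc _) ne = refl

  computes-provable : ∀ {c n k} → X ⊢ c [ n ]↦ k → Provable (computes ⌜ c ⌝ n k)
  computes-provable (zero {n}) = zero-provable n
  computes-provable (succ {n}) = succ-provable n
  computes-provable (left {n}) = left-provable n
  computes-provable (right {n}) = right-provable n
  computes-provable (oracle-yes n∈X) = oracle-yes-provable n∈X
  computes-provable (oracle-no n∉X) = oracle-no-provable n∉X
  computes-provable (pair {c} {d} {n} {x} {y} p r) =
    Provable-cast (cong₂ (λ c′ → computes c′ n) (sym (⌜pair⌝ c d)) (⊗≡⟨⟩ x y))
      (by-rule₂ 6 (computes-provable p) (computes-provable r) (rule-pair _ _ n x y))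
  computes-provable (comp {c} {d} {n} {m} {k} p r) =
    Provable-cast (cong (λ c′ → computes c′ n k) (sym (⌜comp⌝ c d)))
      (by-rule₂ 7 (computes-provable p) (computes-provable r) (rule-comp _ _ n m k))
  computes-provable (prec-zero {c} {d} {n} {x} e p) =
    Provable-cast (cong₂ (λ c′ m → computes c′ m x) (sym (⌜prec⌝ c d)) (trans (cong (π₁ n ⊗_) (sym e)) (⊗-π n)))
      (by-rule₁ 8 ⌜ d ⌝ (computes-provable p) (rule-prec-zero _ _ (π₁ n) x))
  computes-provable (prec-suc {c} {d} {n} {k} {x} {y} e p r) =
    Provable-cast (cong₂ (λ c′ m → computes c′ m y) (sym (⌜prec⌝ c d)) (trans (cong (π₁ n ⊗_) (sym e)) (⊗-π n)))
      (by-rule₂ 9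
        (Provable-cast (cong₂ (λ c′ m → computes c′ m x) (⌜prec⌝ c d) (sym (⊗≡⟨⟩ (π₁ n) k))) (computes-provable p))
        (Provable-cast (cong (λ m → computes ⌜ d ⌝ m y)
          (sym (trans (⊗≡⟨⟩ (π₁ n) _) (cong ⟨ π₁ n ,_⟩ (⊗≡⟨⟩ k x))))) (computes-provable r))
        (rule-prec-suc _ _ (π₁ n) k x y))
  computes-provable (mu {c} {n} {k} p below) =
    Provable-cast (cong (λ c′ → computes c′ n k) (sym (⌜mu⌝ c)))
      (by-rule₂ 10 (go k below)
        (Provable-cast (cong (λ m → computes ⌜ c ⌝ m 0) (sym (⊗≡⟨⟩ n k))) (computes-provable p))
        (rule-mu _ n k))
    where
    go : ∀ k → (∀ j → j < k → ∃[ y ] X ⊢ c [ ⟨ n , j ⟩ ]↦ suc y) → Provable (positiveBelow ⌜ c ⌝ n k)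
    go zero _ = below-zero-provable ⌜ c ⌝ n
    go (suc k) below with y , p ← below k ≤-refl =
      by-rule₂ 12 (go k (λ j j<k → below j (m<n⇒m<1+n j<k)))
        (Provable-cast (cong (λ m → computes ⌜ c ⌝ m (suc y)) (sym (⊗≡⟨⟩ n k))) (computes-provable p))
        (rule-below-suc _ n k y)

  isCode-provable : ∀ c → Provable (isCode ⌜ c ⌝)
  isCode-provable zero = Provable-cast (cong isCode (⊗≡⟨⟩ 0 0)) (leaf-code-provable 0 λ ())
  isCode-provable succ = Provable-cast (cong isCode (⊗≡⟨⟩ 1 0)) (leaf-code-provable 1 λ ())
  isCode-provable left = Provable-cast (cong isCode (⊗≡⟨⟩ 2 0)) (leaf-code-provable 2 λ ())
  isCode-provable right = Provable-cast (cong isCode (⊗≡⟨⟩ 3 0)) (leaf-code-provable 3 λ ())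
  isCode-provable oracle = Provable-cast (cong isCode (⊗≡⟨⟩ 4 0)) (leaf-code-provable 4 λ ())
  isCode-provable (pair c d) = Provable-cast (cong isCode (sym (⌜pair⌝ c d)))
    (by-rule₂ 14 (isCode-provable c) (isCode-provable d) (proj₁ (rule-code _ _)))
  isCode-provable (comp c d) = Provable-cast (cong isCode (sym (⌜comp⌝ c d)))
    (by-rule₂ 15 (isCode-provable c) (isCode-provable d) (proj₁ (proj₂ (rule-code _ _))))
  isCode-provable (prec c d) = Provable-cast (cong isCode (sym (⌜prec⌝ c d)))
    (by-rule₂ 16 (isCode-provable c) (isCode-provable d) (proj₂ (proj₂ (rule-code _ _))))
  isCode-provable (mu c) = Provable-cast (cong isCode (sym (⌜mu⌝ c)))
    (by-rule₁ 17 0 (isCode-provable c) (rule-code-mu _))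

  halts-provable : ∀ {e} → e ∈ X ′ → Provable (halts e)
  halts-provable (c , refl , k , p) =
    by-rule₂ 18 (computes-provable p) (isCode-provable c) (rule-halts ⌜ c ⌝ k)

-- Strings as numbers

parity half tail head len : ℕ → ℕ
parity = natrec 0 (λ _ a → 1 ∸ a)
half = natrec 0 (λ k a → a + parity k)
tail v = half (v ∸ 1)
head v = ifz v 0 (ifz (parity v) 2 1)

-- The answer at n of the string numbered v: 0 unknown, 1 no, 2 yes.
query : ℕ → ℕ → ℕ
query v n = head (natrec v (λ _ → tail) n)

len v = sum< (λ n → sg (query v n)) v

parity-double : ∀ x → parity (2 * x) ≡ 0
parity-double zero = refl
parity-double (suc x) rewrite +-suc x (x + 0) | parity-double x = refl

half-double : ∀ x → half (2 * x) ≡ x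
half-double zero = refl
half-double (suc x) rewrite +-suc x (x + 0) | parity-double x | half-double x =
  trans (+-assoc x 0 1) (+-comm x 1)

tail-encode : ∀ b σ → tail (encodeString (b ∷ σ)) ≡ encodeString σ
tail-encode false σ = half-double _
tail-encode true σ rewrite half-double (encodeString σ) | parity-double (encodeString σ) = +-identityʳ _

stringLookup : List Bool → ℕ → ℕ
stringLookup [] n = 0
stringLookup (b ∷ σ) zero = if b then 2 else 1
stringLookup (b ∷ σ) (suc n) = stringLookup σ n

query-encode : ∀ σ n → query (encodeString σ) n ≡ stringLookup σ n
query-encode [] n = cong head (go n)
  where
  go : ∀ n → natrec 0 (λ _ → tail) n ≡ 0
  go zero = refl
  go (suc n) = cong tail (go n)
query-encode (false ∷ σ) zero rewrite parity-double (encodeString σ) = refl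
query-encode (true ∷ σ) zero rewrite parity-double (encodeString σ) = refl
query-encode (b ∷ σ) (suc n) =
  trans (cong head (shift _ n)) (trans (cong (λ v → query v n) (tail-encode b σ)) (query-encode σ n))
  where
  shift : ∀ v n → natrec v (λ _ → tail) (suc n) ≡ natrec (tail v) (λ _ → tail) n
  shift v zero = refl
  shift v (suc n) = cong tail (shift v n)

stringLookup-< : ∀ σ n → n < length σ → stringLookup σ n ≢ 0
stringLookup-< (false ∷ σ) zero _ = λ ()
stringLookup-< (true ∷ σ) zero _ = λ ()
stringLookup-< (b ∷ σ) (suc n) (s≤s n<) = stringLookup-< σ n n<

stringLookup-≥ : ∀ σ n → length σ ≤ n → stringLookup σ n ≡ 0
stringLookup-≥ [] n _ = refl
stringLookup-≥ (b ∷ σ) (suc n) (s≤s ≤n) = stringLookup-≥ σ n ≤n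

stringLookup-++ : ∀ σ ρ n → stringLookup σ n ⊑ stringLookup (σ ++ ρ) n
stringLookup-++ [] ρ n = inj₁ refl
stringLookup-++ (b ∷ σ) ρ zero = inj₂ refl
stringLookup-++ (b ∷ σ) ρ (suc n) = stringLookup-++ σ ρ n

-- Justifies the bound of the sum that defines `len`.
length≤encode : ∀ σ → length σ ≤ encodeString σ
length≤encode [] = z≤n
length≤encode (false ∷ σ) = s≤s (≤-trans (length≤encode σ) (m≤m+n _ _))
length≤encode (true ∷ σ) = s≤s (≤-trans (length≤encode σ) (≤-trans (m≤m+n _ _) (n≤1+n _)))

sum<-indicator : ∀ f L n → (∀ i → i < L → f i ≡ 1) → (∀ i → L ≤ i → f i ≡ 0) → L ≤ n → sum< f n ≡ L
sum<-indicator f L zero one zer z≤n = refl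
sum<-indicator f L (suc n) one zer L≤ with m≤n⇒m<n∨m≡n L≤
... | inj₁ (s≤s L≤n) rewrite sum<-indicator f L n one zer L≤n | zer n L≤n = +-identityʳ L
... | inj₂ refl rewrite one n ≤-refl = trans (cong (_+ 1) (ones n (λ i i<n → one i (m<n⇒m<1+n i<n)))) (+-comm n 1)
  where
  ones : ∀ n → (∀ i → i < n → f i ≡ 1) → sum< f n ≡ n
  ones zero _ = refl
  ones (suc n) one rewrite one n ≤-refl =
    trans (cong (_+ 1) (ones n (λ i i<n → one i (m<n⇒m<1+n i<n)))) (+-comm n 1)

sg-≢0 : ∀ n → n ≢ 0 → sg n ≡ 1
sg-≢0 zero ne = contradiction refl ne
sg-≢0 (suc n) ne = refl

len-encode : ∀ σ → len (encodeString σ) ≡ length σ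
len-encode σ = sum<-indicator _ (length σ) (encodeString σ)
  (λ n n< → sg-≢0 _ λ e → stringLookup-< σ n n< (trans (sym (query-encode σ n)) e))
  (λ n ≤n → cong sg (trans (query-encode σ n) (stringLookup-≥ σ n ≤n)))
  (length≤encode σ)

≺-tail : ∀ {b σ X} → (b ∷ σ) ≺ X → σ ≺ (X ∘ suc)
≺-tail p i = p (suc i)

stringLookup-agrees : ∀ σ {X} → σ ≺ X → Agrees (stringLookup σ) X
stringLookup-agrees [] p n = inj₁ refl
stringLookup-agrees (false ∷ σ) p zero = inj₂ (inj₁ (refl , Equivalence.to (p zero)))
stringLookup-agrees (true ∷ σ) p zero = inj₂ (inj₂ (refl , Equivalence.from (p zero) tt))
stringLookup-agrees (b ∷ σ) {X} p (suc n) = stringLookup-agrees σ {X ∘ suc} (≺-tail {b} {σ} {X} p) n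

query-agrees : ∀ σ {X} → σ ≺ X → Agrees (query (encodeString σ)) X
query-agrees σ {X} p n = subst (AgreesAt X n) (sym (query-encode σ n)) (stringLookup-agrees σ {X} p n)

-- Approximation of the jump

opaque
  -- The length of the string bounds the derivations as well as the oracle questions, so a longer
  -- string sees more of both.
  jumpApprox : ℕ → ℕ → ℕ
  jumpApprox v a = sg (sum< (λ w → ifeq (check (query v) w) (halts a) 1) (len v))

jump : List Bool → ℕ → ℕ
jump σ = jumpApprox (encodeString σ)

sg≤1 : ∀ n → sg n ≤ 1
sg≤1 zero = z≤n
sg≤1 (suc n) = ≤-refl

sg-positive : ∀ n → sg n ≢ 0 → n ≢ 0
sg-positive zero ne = ne
sg-positive (suc n) _ = λ ()

opaque
  unfolding jumpApprox

  jumpApprox≤1 : ∀ v a → jumpApprox v a ≤ 1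
  jumpApprox≤1 v a = sg≤1 _

  jump-witness : ∀ σ a → jump σ a ≢ 0 → ∃[ w ] (w < length σ × check (query (encodeString σ)) w ≡ halts a)
  jump-witness σ a ne with w , w< , ne′ ← sum<-≢0 _ (len (encodeString σ)) (sg-positive _ ne) =
    w , subst (w <_) (len-encode σ) w< , proj₁ (ifeq-≢0 _ (halts a) ne′)

  jump-from-witness : ∀ σ a w → w < length σ → check (query (encodeString σ)) w ≡ halts a → jump σ a ≡ 1
  jump-from-witness σ a w w< eq = sg-≢0 _ λ z → 1+n≰n (≤-trans (≤-reflexive (sym (ifeq-≡ 1 eq)))
    (≤-trans (sum<-term _ _ w (subst (w <_) (sym (len-encode σ)) w<)) (≤-reflexive z)))

halts≢0 : ∀ a → halts a ≢ 0
halts≢0 a eq with () ← trans (sym (π₁-⊗ 4 (a ⊗ 0))) (cong π₁ eq)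

-- A derivation that succeeds with the answers of `σ` has the same conclusion with those of an
-- extension, by `check-mono`.
jump-mono : ∀ σ ρ a → jump σ a ≤ jump (σ ++ ρ) a
jump-mono σ ρ a = go (jump σ a) refl
  where
  ext : ∀ n → query (encodeString σ) n ⊑ query (encodeString (σ ++ ρ)) n
  ext n = subst₂ _⊑_ (sym (query-encode σ n)) (sym (query-encode (σ ++ ρ) n)) (stringLookup-++ σ ρ n)
  go : ∀ j → jump σ a ≡ j → jump σ a ≤ jump (σ ++ ρ) a
  go zero eq rewrite eq = z≤n
  go (suc j) eq with w , w< , e ← jump-witness σ a (λ z → 1+n≢0 (trans (sym eq) z)) | check-mono ext w
  ... | inj₁ z = contradiction (trans (sym e) z) (halts≢0 a)
  ... | inj₂ e′ = ≤-trans (jumpApprox≤1 (encodeString σ) a) (≤-reflexive (sym (jump-from-witness (σ ++ ρ) a w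
      (<-≤-trans w< (≤-trans (m≤m+n _ _) (≤-reflexive (sym (length-++ σ))))) (trans (sym e′) e))))

jump-sound : ∀ σ {X} a → σ ≺ X → jump σ a ≢ 0 → a ∈ X ′
jump-sound σ {X} a p ne with w , _ , eq ← jump-witness σ a ne =
  subst (_∈ X ′) (trans (cong π₁ (π₂-⊗ 4 (a ⊗ 0))) (π₁-⊗ a 0))
    (meaning X {halts a} (subst (Holds X) eq (check-sound X (query-agrees σ p) w)) (π₁-⊗ 4 (a ⊗ 0)))

jump-complete : ∀ {X} a → a ∈ X ′ → ∃[ ℓ ] ∀ σ → σ ≺ X → ℓ ≤ length σ → jump σ a ≡ 1
-- The length has to exceed the witness `w` and to cover the use `ℓ`.
jump-complete {X} a a∈ with w , ℓ , p ← halts-provable X a∈ = suc w + ℓ , λ σ σ≺X ≤len →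
  jump-from-witness σ a w (≤-trans (m≤m+n (suc w) ℓ) ≤len)
    (p _ (query-agrees σ σ≺X) λ n n<ℓ e → stringLookup-< σ n
      (<-≤-trans n<ℓ (≤-trans (m≤n+m ℓ (suc w)) ≤len)) (trans (sym (query-encode σ n)) e))

-- Evaluation of formulas

formulaRule : (t j ra rb rc : ℕ) → ℕ
formulaRule t j ra rb rc = nth (j ∷ 1 ∸ ra ∷ rb * rc ∷ sg (rb + rc) ∷ []) t

formulaStep : ℕ → ℕ → ℕ → ℕ
formulaStep v u t = formulaRule (π₁ u) (jumpApprox v (π₂ u))
  (covGet u t (π₂ u)) (covGet u t (π₁ (π₂ u))) (covGet u t (π₂ (π₂ u)))

evalFormula : ℕ → ℕ → ℕ
evalFormula v = cov (formulaStep v)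

truth : (ℕ → ℕ) → Formula → ℕ
truth j (atom n) = j n
truth j (not φ) = 1 ∸ truth j φ
truth j (and φ ψ) = truth j φ * truth j ψ
truth j (or φ ψ) = sg (truth j φ + truth j ψ)

-- The tag is positive because `b` is surely below the pair only then; atoms need no earlier value
-- and are treated directly.
evalFormula-⊗ : ∀ v t b → evalFormula v (suc t ⊗ b) ≡
  formulaRule (suc t) (jumpApprox v b) (evalFormula v b) (evalFormula v (π₁ b)) (evalFormula v (π₂ b))
evalFormula-⊗ v t b = go (suc t ⊗ b) (π₁-⊗ (suc t) b) (π₂-⊗ (suc t) b) (⊗-<₂ t b)
  where
  go : ∀ u → π₁ u ≡ suc t → π₂ u ≡ b → b < u → evalFormula v u ≡
    formulaRule (suc t) (jumpApprox v b) (evalFormula v b) (evalFormula v (π₁ b)) (evalFormula v (π₂ b))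
  go u eq refl b<u rewrite eq
    | covGet-cov (formulaStep v) b<u
    | covGet-cov (formulaStep v) (≤-<-trans (π₁-≤ (π₂ u)) b<u)
    | covGet-cov (formulaStep v) (≤-<-trans (π₂-≤ (π₂ u)) b<u) = refl

evalFormula-encode : ∀ v φ → evalFormula v (encodeFormula φ) ≡ truth (jumpApprox v) φ
evalFormula-encode v (atom n) = trans (cong (evalFormula v) (sym (⊗≡⟨⟩ 0 n))) (go (0 ⊗ n) (π₁-⊗ 0 n) (π₂-⊗ 0 n))
  where
  go : ∀ u → π₁ u ≡ 0 → π₂ u ≡ n → evalFormula v u ≡ jumpApprox v n
  go u eq refl rewrite eq = refl
evalFormula-encode v (not φ) =
  trans (cong (evalFormula v) (sym (⊗≡⟨⟩ 1 (encodeFormula φ)))) (trans (evalFormula-⊗ v 0 (encodeFormula φ)) (cong (1 ∸_) (evalFormula-encode v φ)))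
evalFormula-encode v (and φ ψ) = trans (cong (evalFormula v) (sym (trans (cong (2 ⊗_) (⊗≡⟨⟩ φ# ψ#)) (⊗≡⟨⟩ 2 ⟨ φ# , ψ# ⟩))))
  (trans (evalFormula-⊗ v 1 (φ# ⊗ ψ#)) (cong₂ _*_
    (trans (cong (evalFormula v) (π₁-⊗ φ# ψ#)) (evalFormula-encode v φ))
    (trans (cong (evalFormula v) (π₂-⊗ φ# ψ#)) (evalFormula-encode v ψ))))
  where
  φ# = encodeFormula φ
  ψ# = encodeFormula ψ
evalFormula-encode v (or φ ψ) = trans (cong (evalFormula v) (sym (trans (cong (3 ⊗_) (⊗≡⟨⟩ φ# ψ#)) (⊗≡⟨⟩ 3 ⟨ φ# , ψ# ⟩))))
  (trans (evalFormula-⊗ v 2 (φ# ⊗ ψ#)) (cong₂ (λ x y → sg (x + y))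
    (trans (cong (evalFormula v) (π₁-⊗ φ# ψ#)) (evalFormula-encode v φ))
    (trans (cong (evalFormula v) (π₂-⊗ φ# ψ#)) (evalFormula-encode v ψ))))
  where
  φ# = encodeFormula φ
  ψ# = encodeFormula ψ

-- Candidate programs and the moving target

constNumber : ℕ → ℕ
constNumber = natrec ⌜ zero ⌝ (λ _ a → 6 ⊗ ⌜ succ ⌝ ⊗ a)

constNumber≡ : ∀ n → constNumber n ≡ ⌜ constCode n ⌝
constNumber≡ zero = refl
constNumber≡ (suc n) = trans (cong (λ z → 6 ⊗ ⌜ succ ⌝ ⊗ z) (constNumber≡ n)) (sym (⌜comp⌝ succ (constCode n)))

-- The program φ_m modified to run on ⟨⟨k , j⟩ , e⟩ instead of its input e.
opaque
  idCode : Code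
  idCode = pair left right

  ⊢-id : ∀ {A n} → A ⊢ idCode [ n ]↦ n
  ⊢-id {n = n} = ⊢-cast refl (⟨⟩-unpair n) (pair left right)

candidateCode : Code → ℕ → ℕ → Code
candidateCode c k j = comp c (pair (constCode (k ⊗ j)) idCode)

candidate : ℕ → ℕ → ℕ → ℕ
candidate m k j = 6 ⊗ m ⊗ 5 ⊗ constNumber (k ⊗ j) ⊗ ⌜ idCode ⌝

candidate≡ : ∀ c k j → candidate ⌜ c ⌝ k j ≡ ⌜ candidateCode c k j ⌝
candidate≡ c k j = trans (cong (λ z → 6 ⊗ ⌜ c ⌝ ⊗ 5 ⊗ z ⊗ ⌜ idCode ⌝) (constNumber≡ (k ⊗ j)))
  (sym (trans (⌜comp⌝ c (pair (constCode (k ⊗ j)) idCode))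
    (cong (λ z → 6 ⊗ ⌜ c ⌝ ⊗ z) (⌜pair⌝ (constCode (k ⊗ j)) idCode))))

-- The factor 2 pays for approximation: a target is left at measure above 2/N, of which late changes
-- account for at most 1/N, so more than 1/N would remain for each of N disjoint events.
#candidates : ℕ → ℕ
#candidates k = 2 * suc k

-- When `c` of the `2 ^ s` strings are counted, the first test asks whether their measure is at most
-- 1/(k + 1); the second makes the successor wrap around.
nextTarget : (k s t c : ℕ) → ℕ
nextTarget k s t c = ifz (suc k * c ∸ 2 ^ s) t (ifz (#candidates k ∸ suc t) 0 (suc t))

module Construction (f : ℕ → ℕ) where

  guess : (m k j v : ℕ) → ℕ
  guess m k j v = evalFormula v (f (candidate m k j))

  -- If exactly one candidate is guessed to be in the second jump, the
  -- weighted sum is its index.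
  guessIndex : (m k v : ℕ) → ℕ
  guessIndex m k v = sum< (λ j → j * guess m k j v) (#candidates k)

  count : (m k i s : ℕ) → ℕ
  count m k i s = sum< (λ x → ifeq (guessIndex m k (x + (2 ^ s ∸ 1))) i 1) (2 ^ s)

  target : (m k s : ℕ) → ℕ
  target m k = natrec 0 (λ s t → nextTarget k s t (count m k t s))

  -- Zero iff s ≥ t and the target at stage s differs from i, where
  -- z = ⟨⟨⟨k , i⟩ , e⟩ , t⟩ and e = candidate m k i.  Here m is read off e,
  -- which is the number of the very program that performs the search.
  moved : (z s : ℕ) → ℕ
  moved z s = (π₂ z ∸ s) + ifeq
    (target (π₁ (π₂ (π₂ (π₁ z)))) (π₁ (π₁ (π₁ z))) s) (π₂ (π₁ (π₁ z))) 1

  -- Here `y` pairs k with a lower bound on the length, which turns "infinitely often, for every k"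
  -- into one universal and one existential quantifier.
  onTarget : (m y v : ℕ) → ℕ
  onTarget m y v = ifz (π₂ y ∸ len v) (ifeq (guessIndex m (π₁ y) v) (target m (π₁ y) (len v)) 1) 0

-- Computability of the construction

module ConstructionTerms (A : Subset) where
  open Terms A

  iterT : ∀ {n} → Tm 1 → Tm n → Tm n → Tm n
  iterT g t n = rec t (app g (var v1 ∷ [])) n

  covGetT : ∀ {n} → Tm n → Tm n → Tm n → Tm n
  covGetT w t i = fstT (rec t (sndT (var v1)) (w ∸T sucT i))

  -- The variables of `G` are the argument, the table of earlier values and a parameter, in both
  -- uses the number of a string.
  covT : Tm 3 → Tm 2
  covT G = app G (var v0 ∷ rec (lit 0) (app G (var v0 ∷ var v1 ∷ var v3 ∷ []) ⊗T var v1) (var v0) ∷ var v1 ∷ [])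

  parityT halfT tailT headT lenT : Tm 1
  parityT = fun₁ parity (rec (lit 0) (lit 1 ∸T var v1) (var v0)) (λ _ → refl)
  halfT = fun₁ half (rec (lit 0) (var v1 +T app parityT (var v0 ∷ [])) (var v0)) (λ _ → refl)
  tailT = fun₁ tail (app halfT (var v0 ∸T lit 1 ∷ [])) (λ _ → refl)
  headT = fun₁ head (ifzT (var v0) (lit 0) (ifzT (app parityT (var v0 ∷ [])) (lit 2) (lit 1))) (λ _ → refl)

  queryT : Tm 2
  queryT = fun₂ query (app headT (iterT tailT (var v0) (var v1) ∷ [])) (λ _ _ → refl)

  lenT = fun₁ len (sumT (sgT (app queryT (var v1 ∷ var v0 ∷ []))) (var v0)) (λ _ → refl)

  computesT : ∀ {n} → Tm n → Tm n → Tm n → Tm n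
  computesT c n k = lit 1 ⊗T c ⊗T n ⊗T k

  progT inputT outputT : ∀ {n} → Tm n → Tm n
  progT t = fstT (sndT t)
  inputT t = fstT (sndT (sndT t))
  outputT t = sndT (sndT (sndT t))

  -- Variables: qa, t, a, b, ra, rb.
  ruleT′ : Tm 6
  ruleT′ = nthT
    ( lit 0
    ∷ computesT (lit ⌜ zero ⌝) a (lit 0)
    ∷ computesT (lit ⌜ succ ⌝) a (sucT a)
    ∷ computesT (lit ⌜ left ⌝) a (fstT a)
    ∷ computesT (lit ⌜ right ⌝) a (sndT a)
    ∷ ifzT qa (lit 0) (computesT (lit ⌜ oracle ⌝) a (qa ∸T lit 1))
    ∷ ifeqT (fstT ra) (lit 1) (ifeqT (fstT rb) (lit 1) (ifeqT (inputT rb) (inputT ra)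
        (computesT (lit 5 ⊗T progT ra ⊗T progT rb) (inputT ra) (outputT ra ⊗T outputT rb))))
    ∷ ifeqT (fstT ra) (lit 1) (ifeqT (fstT rb) (lit 1) (ifeqT (inputT rb) (outputT ra)
        (computesT (lit 6 ⊗T progT rb ⊗T progT ra) (inputT ra) (outputT rb))))
    ∷ ifeqT (fstT ra) (lit 1) (computesT (lit 7 ⊗T progT ra ⊗T b) (inputT ra ⊗T lit 0) (outputT ra))
    ∷ ifeqT (fstT ra) (lit 1) (ifeqT (fstT rb) (lit 1) (ifeqT (fstT (progT ra)) (lit 7)
        (ifeqT (progT rb) (sndT (sndT (progT ra)))
        (ifeqT (inputT rb) (fstT (inputT ra) ⊗T sndT (inputT ra) ⊗T outputT ra)
        (computesT (progT ra) (fstT (inputT ra) ⊗T sucT (sndT (inputT ra))) (outputT rb))))))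
    ∷ ifeqT (fstT ra) (lit 2) (ifeqT (fstT rb) (lit 1) (ifeqT (progT rb) (progT ra)
        (ifeqT (inputT rb) (inputT ra ⊗T outputT ra) (ifeqT (outputT rb) (lit 0)
        (computesT (lit 8 ⊗T progT ra) (inputT ra) (outputT ra))))))
    ∷ (lit 2 ⊗T a ⊗T b ⊗T lit 0)
    ∷ ifeqT (fstT ra) (lit 2) (ifeqT (fstT rb) (lit 1) (ifeqT (progT rb) (progT ra)
        (ifeqT (inputT rb) (inputT ra ⊗T outputT ra) (ifzT (outputT rb) (lit 0)
        (lit 2 ⊗T progT ra ⊗T inputT ra ⊗T sucT (outputT ra))))))
    ∷ ifzT (lit 5 ∸T a) (lit 0) (isCodeT (a ⊗T lit 0))
    ∷ ifeqT (fstT ra) (lit 3) (ifeqT (fstT rb) (lit 3) (isCodeT (lit 5 ⊗T progT ra ⊗T progT rb)))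
    ∷ ifeqT (fstT ra) (lit 3) (ifeqT (fstT rb) (lit 3) (isCodeT (lit 6 ⊗T progT ra ⊗T progT rb)))
    ∷ ifeqT (fstT ra) (lit 3) (ifeqT (fstT rb) (lit 3) (isCodeT (lit 7 ⊗T progT ra ⊗T progT rb)))
    ∷ ifeqT (fstT ra) (lit 3) (isCodeT (lit 8 ⊗T progT ra))
    ∷ ifeqT (fstT ra) (lit 1) (ifeqT (fstT rb) (lit 3) (ifeqT (progT rb) (progT ra)
        (ifeqT (inputT ra) (progT ra) (lit 4 ⊗T progT ra ⊗T lit 0))))
    ∷ []) (var v1)
    where
    qa a b ra rb : Tm 6
    qa = var v0
    a = var v2
    b = var v3
    ra = var v4
    rb = var v5
    isCodeT : Tm 6 → Tm 6
    isCodeT c = lit 3 ⊗T c ⊗T lit 0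

  opaque
    unfolding rule
    eval-ruleT′ : ∀ qa t a b ra rb → eval ruleT′ (qa ∷ t ∷ a ∷ b ∷ ra ∷ rb ∷ []) ≡ rule qa t a b ra rb
    eval-ruleT′ qa t a b ra rb = refl

  ruleT : Tm 6
  ruleT = conv ruleT′
    {λ ρ → rule (Vec.lookup ρ v0) (Vec.lookup ρ v1) (Vec.lookup ρ v2) (Vec.lookup ρ v3) (Vec.lookup ρ v4) (Vec.lookup ρ v5)}
    λ { (qa ∷ t ∷ a ∷ b ∷ ra ∷ rb ∷ []) → eval-ruleT′ qa t a b ra rb }

  -- Variables: w, t, v.
  checkStepT : Tm 3
  checkStepT = fun₃ (λ w t v → checkStep (query v) w t)
    (app ruleT (app queryT (var v2 ∷ a ∷ []) ∷ fstT (var v0) ∷ a ∷ b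
      ∷ covGetT (var v0) (var v1) a ∷ covGetT (var v0) (var v1) b ∷ []))
    (λ _ _ _ → refl)
    where
    a b : Tm 3
    a = fstT (sndT (var v0))
    b = sndT (sndT (var v0))

  checkT : Tm 2
  checkT = fun₂ (λ w v → check (query v) w) (covT checkStepT) (λ _ _ → refl)

  jumpT′ : Tm 2
  jumpT′ = sgT (sumT (ifeqT (app checkT (var v0 ∷ var v1 ∷ [])) (lit 4 ⊗T var v2 ⊗T lit 0) (lit 1))
    (app lenT (var v0 ∷ [])))

  opaque
    unfolding jumpApprox
    eval-jumpT′ : ∀ v a → eval jumpT′ (v ∷ a ∷ []) ≡ jumpApprox v a
    eval-jumpT′ v a = refl

  jumpT : Tm 2
  jumpT = fun₂ jumpApprox jumpT′ eval-jumpT′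

  formulaStepT : Tm 3
  formulaStepT = fun₃ (λ u t v → formulaStep v u t)
    (nthT (app jumpT (var v2 ∷ b ∷ []) ∷ (lit 1 ∸T get b) ∷ (get (fstT b) *T get (sndT b)) ∷ sgT (get (fstT b) +T get (sndT b)) ∷ [])
      (fstT (var v0)))
    (λ _ _ _ → refl)
    where
    b : Tm 3
    b = sndT (var v0)
    get : Tm 3 → Tm 3
    get = covGetT (var v0) (var v1)

  evalFormulaT : Tm 2
  evalFormulaT = fun₂ (λ u v → evalFormula v u) (covT formulaStepT) (λ _ _ → refl)

  constNumberT : Tm 1
  constNumberT = fun₁ constNumber (rec (lit ⌜ zero ⌝) (lit 6 ⊗T lit ⌜ succ ⌝ ⊗T var v1) (var v0)) (λ _ → refl)

  candidateT : Tm 3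
  candidateT = fun₃ candidate
    (lit 6 ⊗T var v0 ⊗T lit 5 ⊗T app constNumberT ((var v1 ⊗T var v2) ∷ []) ⊗T lit ⌜ idCode ⌝) (λ _ _ _ → refl)

  module _ (f : ℕ → ℕ) (fCode : Code) (fCorrect : ∀ n → A ⊢ fCode [ n ]↦ f n) where
    open Construction f

    guessT : Tm 4
    guessT = fun₄ guess
      (app evalFormulaT (unary fCode f fCorrect (app candidateT (var v0 ∷ var v1 ∷ var v2 ∷ [])) ∷ var v3 ∷ []))
      (λ _ _ _ _ → refl)

    #candidatesT : Tm 1
    #candidatesT = fun₁ #candidates (lit 2 *T sucT (var v0)) (λ _ → refl)

    guessIndexT : Tm 3
    guessIndexT = fun₃ guessIndex
      (sumT (var v0 *T app guessT (var v1 ∷ var v2 ∷ var v0 ∷ var v3 ∷ [])) (app #candidatesT (var v1 ∷ [])))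
      (λ _ _ _ → refl)

    countT : Tm 4
    countT = fun₄ count
      (sumT (ifeqT (app guessIndexT (var v1 ∷ var v2 ∷ (var v0 +T (2^T (var v4) ∸T lit 1)) ∷ [])) (var v3) (lit 1))
        (2^T (var v3)))
      (λ _ _ _ _ → refl)

    nextTargetT : Tm 4
    nextTargetT = fun₄ nextTarget
      (ifzT (sucT (var v0) *T var v3 ∸T 2^T (var v1)) (var v2)
        (ifzT (app #candidatesT (var v0 ∷ []) ∸T sucT (var v2)) (lit 0) (sucT (var v2))))
      (λ _ _ _ _ → refl)

    targetT : Tm 3
    targetT = fun₃ target
      (rec (lit 0)
        (app nextTargetT (var v3 ∷ var v0 ∷ var v1 ∷ app countT (var v2 ∷ var v3 ∷ var v1 ∷ var v0 ∷ []) ∷ []))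
        (var v2))
      (λ _ _ _ → refl)

    movedT : Tm 2
    movedT = fun₂ moved
      ((sndT z ∸T var v1) +T ifeqT
        (app targetT (fstT (sndT (sndT (fstT z))) ∷ fstT (fstT (fstT z)) ∷ var v1 ∷ [])) (sndT (fstT (fstT z))) (lit 1))
      (λ _ _ → refl)
      where
      z : Tm 2
      z = var v0

    onTargetT : ℕ → Tm 2
    onTargetT m = fun₂ (onTarget m)
      (ifzT (sndT (var v0) ∸T app lenT (var v1 ∷ []))
        (ifeqT (app guessIndexT (lit m ∷ fstT (var v0) ∷ var v1 ∷ []))
          (app targetT (lit m ∷ fstT (var v0) ∷ app lenT (var v1 ∷ []) ∷ [])) (lit 1))
        (lit 0))
      (λ _ _ → refl)

-- Determinism and least witnesses

⊢-deterministic : ∀ {A c n k k′} → A ⊢ c [ n ]↦ k → A ⊢ c [ n ]↦ k′ → k ≡ k′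
⊢-deterministic zero zero = refl
⊢-deterministic succ succ = refl
⊢-deterministic left left = refl
⊢-deterministic right right = refl
⊢-deterministic (oracle-yes _) (oracle-yes _) = refl
⊢-deterministic (oracle-yes p) (oracle-no q) = contradiction p q
⊢-deterministic (oracle-no p) (oracle-yes q) = contradiction q p
⊢-deterministic (oracle-no _) (oracle-no _) = refl
⊢-deterministic (pair p q) (pair p′ q′) = cong₂ ⟨_,_⟩ (⊢-deterministic p p′) (⊢-deterministic q q′)
⊢-deterministic (comp p q) (comp p′ q′) with refl ← ⊢-deterministic p p′ = ⊢-deterministic q q′
⊢-deterministic (prec-zero _ p) (prec-zero _ p′) = ⊢-deterministic p p′
⊢-deterministic (prec-zero e _) (prec-suc e′ _ _) = contradiction (trans (sym e) e′) λ ()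
⊢-deterministic (prec-suc e _ _) (prec-zero e′ _) = contradiction (trans (sym e′) e) λ ()
⊢-deterministic (prec-suc e p q) (prec-suc e′ p′ q′) with refl ← suc-injective (trans (sym e) e′)
  with refl ← ⊢-deterministic p p′ = ⊢-deterministic q q′
⊢-deterministic (mu {k = k} p below) (mu {k = k′} p′ below′) with <-cmp k k′
... | tri≈ _ eq _ = eq
... | tri< k<k′ _ _ with _ , q ← below′ k k<k′ = contradiction (⊢-deterministic p q) λ ()
... | tri> _ _ k′<k with _ , q ← below k′ k′<k = contradiction (⊢-deterministic p′ q) λ ()

least : {P : Pred ℕ 0ℓ} → Decidable P → ∀ n → P n → ∃[ m ] (P m × ∀ j → j < m → ¬ P j)
least {P} P? n p = go n 0 (λ j ()) (subst P (sym (+-identityʳ n)) p)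
  where
  go : ∀ d m → (∀ j → j < m → ¬ P j) → P (d + m) → ∃[ n ] (P n × ∀ j → j < n → ¬ P j)
  go zero m below p = m , p , below
  go (suc d) m below p with P? m
  ... | yes pm = m , pm , below
  ... | no ¬pm = go d (suc m) below′ (subst P (sym (+-suc d m)) p)
    where
    below′ : ∀ j → j < suc m → ¬ P j
    below′ j (s≤s j≤m) with m≤n⇒m<n∨m≡n j≤m
    ... | inj₁ j<m = below j j<m
    ... | inj₂ refl = ¬pm

positive : ∀ {n} → n ≢ 0 → ∃[ y ] n ≡ suc y
positive {zero} ne = contradiction refl ne
positive {suc y} _ = y , refl

-- The second jump contains the number of a program searching for t such
-- that the program searching for a zero of W⟨⟨-,t⟩,·⟩ is not in the jump.
module SecondJump (em : ∀ {ℓ} → ExcludedMiddle ℓ)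
  (W : ℕ → ℕ → ℕ) (wCode : Code) (wCorrect : ∀ z s → ∅ ⊢ wCode [ ⟨ z , s ⟩ ]↦ W z s) where

  -- The program ignores its input, so its halting on its own number is just the success of the
  -- search for `z`.
  searchCode : ℕ → Code
  searchCode z = comp (mu wCode) (constCode z)

  searchNumber : ℕ → ℕ
  searchNumber z = 6 ⊗ ⌜ mu wCode ⌝ ⊗ constNumber z

  searchNumber≡ : ∀ z → searchNumber z ≡ ⌜ searchCode z ⌝
  searchNumber≡ z = trans (cong (λ y → 6 ⊗ ⌜ mu wCode ⌝ ⊗ y) (constNumber≡ z)) (sym (⌜comp⌝ (mu wCode) (constCode z)))

  search∈ : ∀ {z} s → W z s ≡ 0 → searchNumber z ∈ ∅ ′
  search∈ {z} s eq with s₀ , eq₀ , below ← least (λ s → W z s ≟ 0) s eq =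
    searchCode z , searchNumber≡ z , s₀ , comp (⊢-constCode z)
      (mu (⊢-cast refl eq₀ (wCorrect z s₀)) λ j j< →
        let y , e = positive (below j j<) in y , ⊢-cast refl e (wCorrect z j))

  search∈⁻ : ∀ {z} → searchNumber z ∈ ∅ ′ → ∃[ s ] W z s ≡ 0
  search∈⁻ {z} (c , eq , k , p) = go (⌜⌝-injective (trans (sym eq) (searchNumber≡ z))) p
    where
    run : ∀ {e} → ∅ ⊢ searchCode z [ e ]↦ k → ∃[ s ] W z s ≡ 0
    run (comp p (mu q _)) with refl ← ⊢-deterministic p (⊢-constCode z) = k , ⊢-deterministic (wCorrect z k) q
    go : ∀ {c e} → c ≡ searchCode z → ∅ ⊢ c [ e ]↦ k → ∃[ s ] W z s ≡ 0
    go refl p = run p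

  opaque
    searchNumberT : Terms.Tm (∅ ′) 1
    searchNumberT = Terms.fun₁ (∅ ′) searchNumber (lit 6 ⊗T lit ⌜ mu wCode ⌝ ⊗T app constNumberT (var v0 ∷ [])) (λ _ → refl)
      where
      open Terms (∅ ′)
      open ConstructionTerms (∅ ′)

    searchNumberCode : Code
    searchNumberCode = Terms.unaryCode (∅ ′) searchNumberT

    ⊢-searchNumber : ∀ z → ∅ ′ ⊢ searchNumberCode [ z ]↦ searchNumber z
    ⊢-searchNumber z = Terms.⊢-unaryCode (∅ ′) searchNumberT z

  opaque
    -- The oracle answers `0` exactly outside its set, so minimisation stops at the first `t` for
    -- which the search never succeeds.
    mainCode : Code
    mainCode = mu (comp oracle searchNumberCode)

    main-halts : ∀ x t → searchNumber ⟨ x , t ⟩ ∉ ∅ ′ → ∃[ k ] ∅ ′ ⊢ mainCode [ x ]↦ k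
    main-halts x t t∉ with t₀ , p , below ← least {λ t → searchNumber ⟨ x , t ⟩ ∉ ∅ ′} (λ _ → em) t t∉ =
      t₀ , mu (comp (⊢-searchNumber _) (oracle-no p))
        λ j j< → 0 , comp (⊢-searchNumber _) (oracle-yes (decidable-stable em (below j j<)))

    main-halts⁻ : ∀ {x k} → ∅ ′ ⊢ mainCode [ x ]↦ k → searchNumber ⟨ x , k ⟩ ∉ ∅ ′
    main-halts⁻ {x} {k} (mu (comp {m = m} p (oracle-no m∉)) _) k∈ =
      m∉ (subst (_∈ ∅ ′) (⊢-deterministic (⊢-searchNumber ⟨ x , k ⟩) p) k∈)

  mainNumber : ℕ
  mainNumber = ⌜ mainCode ⌝

  module _ (k i : ℕ) where
    private
      e x : ℕ
      e = candidate mainNumber k i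
      x = (k ⊗ i) ⊗ e

    ⊢-input : ∅ ′ ⊢ pair (constCode (k ⊗ i)) idCode [ e ]↦ x
    ⊢-input = ⊢-cast refl (sym (⊗≡⟨⟩ (k ⊗ i) e)) (pair (⊢-constCode (k ⊗ i)) ⊢-id)

    candidate∈ : ∀ t → (∀ s → W ⟨ x , t ⟩ s ≢ 0) → e ∈ ∅ ′ ′
    candidate∈ t never with k′ , p ← main-halts x t (λ q → let s , eq = search∈⁻ q in never s eq) =
      candidateCode mainCode k i , candidate≡ mainCode k i , k′ , comp ⊢-input p

    candidate∈⁻ : e ∈ ∅ ′ ′ → ∃[ t ] ∀ s → W ⟨ x , t ⟩ s ≢ 0
    candidate∈⁻ (c , eq , t , p) = t , go (⌜⌝-injective (trans (sym eq) (candidate≡ mainCode k i))) p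
      where
      run : ∅ ′ ⊢ candidateCode mainCode k i [ e ]↦ t → ∀ s → W ⟨ x , t ⟩ s ≢ 0
      run (comp p q) s eq = main-halts⁻ (⊢-cast (⊢-deterministic p ⊢-input) refl q) (search∈ s eq)
      go : ∀ {c} → c ≡ candidateCode mainCode k i → ∅ ′ ⊢ c [ e ]↦ t → ∀ s → W ⟨ x , t ⟩ s ≢ 0
      go refl p = run p

-- Sums over the strings of a given length

stringSum : (List Bool → ℕ) → ℕ → ℕ
stringSum g zero = g []
stringSum g (suc s) = stringSum (g ∘ (false ∷_)) s + stringSum (g ∘ (true ∷_)) s

stringSum-mono : ∀ {f g : List Bool → ℕ} s → (∀ σ → f σ ≤ g σ) → stringSum f s ≤ stringSum g s
stringSum-mono zero le = le []
stringSum-mono (suc s) le = +-mono-≤ (stringSum-mono s (le ∘ (false ∷_))) (stringSum-mono s (le ∘ (true ∷_)))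

stringSum-+ : ∀ f g s → stringSum (λ σ → f σ + g σ) s ≡ stringSum f s + stringSum g s
stringSum-+ f g zero = refl
stringSum-+ f g (suc s)
  rewrite stringSum-+ (f ∘ (false ∷_)) (g ∘ (false ∷_)) s | stringSum-+ (f ∘ (true ∷_)) (g ∘ (true ∷_)) s =
  +-*-Solver.solve 4 (λ a b c d → (a :+ b) :+ (c :+ d) := (a :+ c) :+ (b :+ d)) refl
    (stringSum (f ∘ (false ∷_)) s) _ (stringSum (f ∘ (true ∷_)) s) _
  where open +-*-Solver using (_:+_; _:=_)

stringSum-const : ∀ c s → stringSum (λ _ → c) s ≡ 2 ^ s * c
stringSum-const c zero = sym (+-identityʳ c)
stringSum-const c (suc s) rewrite stringSum-const c s =
  trans (cong (2 ^ s * c +_) (sym (+-identityʳ (2 ^ s * c)))) (sym (*-assoc 2 (2 ^ s) c))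

-- Every string of length `s` has `2 ^ d` extensions of length `s + d`.
stringSum-take : ∀ g s d → stringSum (g ∘ take s) (s + d) ≡ 2 ^ d * stringSum g s
stringSum-take g zero d = stringSum-const (g []) d
stringSum-take g (suc s) d
  rewrite stringSum-take (g ∘ (false ∷_)) s d | stringSum-take (g ∘ (true ∷_)) s d =
  sym (*-distribˡ-+ (2 ^ d) (stringSum (g ∘ (false ∷_)) s) _)

stringSum-sum< : ∀ (g : ℕ → List Bool → ℕ) n s →
  stringSum (λ σ → sum< (λ i → g i σ) n) s ≡ sum< (λ i → stringSum (g i) s) n
stringSum-sum< g zero s = trans (stringSum-const 0 s) (*-zeroʳ (2 ^ s))
stringSum-sum< g (suc n) s = trans (stringSum-+ (λ σ → sum< (λ i → g i σ) n) (g n) s)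
  (cong (_+ stringSum (g n) s) (stringSum-sum< g n s))

sum<-*ˡ : ∀ c f n → sum< (λ i → c * f i) n ≡ c * sum< f n
sum<-*ˡ c f zero = sym (*-zeroʳ c)
sum<-*ˡ c f (suc n) = trans (cong (_+ c * f n) (sum<-*ˡ c f n)) (sym (*-distribˡ-+ c (sum< f n) (f n)))

sum<-const : ∀ c n → sum< (λ _ → c) n ≡ n * c
sum<-const c zero = refl
sum<-const c (suc n) = trans (cong (_+ c) (sum<-const c n)) (+-comm (n * c) c)

sum<-ifeq≤1 : ∀ x n → sum< (λ i → ifeq x i 1) n ≤ 1
sum<-ifeq≤1 x n = go n
  where
  below : ∀ n → n ≤ x → sum< (λ i → ifeq x i 1) n ≡ 0
  below zero _ = refl
  below (suc n) n<x rewrite below n (<⇒≤ n<x) = ifeq-≢ {x} {n} 1 λ { refl → 1+n≰n n<x }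
  go : ∀ n → sum< (λ i → ifeq x i 1) n ≤ 1
  go zero = z≤n
  go (suc n) with x ≟ n
  ... | yes refl rewrite below n ≤-refl = ≤-reflexive (ifeq-refl n 1)
  ... | no x≢n rewrite ifeq-≢ {x} {n} 1 x≢n = ≤-trans (≤-reflexive (+-identityʳ _)) (go n)

2^>0 : ∀ n → 0 < 2 ^ n
2^>0 n = m^n>0 2 n

-- Along a path sel changes only when the bounded monotone function h does,
-- so beyond some level it changes only on a set of small measure.
module Stabilisation (em : ∀ {ℓ} → ExcludedMiddle ℓ) (sel h : List Bool → ℕ) (B : ℕ)
  (h≤B : ∀ σ → h σ ≤ B)
  (h-mono : ∀ σ ρ → h σ ≤ h (σ ++ ρ))
  (sel-stable : ∀ σ ρ → h σ ≡ h (σ ++ ρ) → sel σ ≡ sel (σ ++ ρ)) where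

  H : ℕ → ℕ
  H = stringSum h

  h-take : ∀ s σ → h (take s σ) ≤ h σ
  h-take s σ = ≤-trans (h-mono (take s σ) (drop s σ)) (≤-reflexive (cong h (take++drop≡id s σ)))

  -- In terms of means over the strings of one length: after level `s` the mean of `h` rises by at
  -- most 1/C.
  Stable : ℕ → ℕ → Set
  Stable C s = ∀ d → C * H (s + d) ≤ C * (2 ^ d * H s) + 2 ^ (s + d)

  -- Otherwise the mean of `h` would rise by more than 1/C again and again from `t` on, and after
  -- `C * B + 1` rises it would exceed `B`.
  stable′ : ∀ C t → ∃[ s ] (t ≤ s × Stable C s)
  stable′ C t = decidable-stable em λ unstable → let s , _ , le = climb unstable (suc (C * B)) in
    <⇒≱ (grow s) le
    where
    grow : ∀ s → C * H s < suc (C * B) * 2 ^ s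
    grow s = ≤-<-trans (*-monoʳ-≤ C (≤-trans (stringSum-mono s h≤B) (≤-reflexive (stringSum-const B s))))
      (≤-<-trans (≤-reflexive (+-*-Solver.solve 3 (λ c p b → c :* (p :* b) := c :* b :* p) refl C (2 ^ s) B))
        (m<n+m (C * B * 2 ^ s) (2^>0 s)))
      where open +-*-Solver using (_:*_; _:=_)
    climb : ¬ (∃[ s ] (t ≤ s × Stable C s)) → ∀ j → ∃[ s ] (t ≤ s × j * 2 ^ s ≤ C * H s)
    climb unstable zero = t , ≤-refl , z≤n
    climb unstable (suc j) with s , t≤s , le ← climb unstable j = s + d , ≤-trans t≤s (m≤m+n s d) , (begin
      suc j * 2 ^ (s + d)                  ≡⟨ cong (λ x → 2 ^ (s + d) + j * x) (^-distribˡ-+-* 2 s d) ⟩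
      2 ^ (s + d) + j * (2 ^ s * 2 ^ d)    ≡⟨ +-*-Solver.solve 4 (λ j a b x → x :+ j :* (a :* b) := b :* (j :* a) :+ x)
                                                refl j (2 ^ s) (2 ^ d) (2 ^ (s + d)) ⟩
      2 ^ d * (j * 2 ^ s) + 2 ^ (s + d)    ≤⟨ +-monoˡ-≤ _ (*-monoʳ-≤ (2 ^ d) le) ⟩
      2 ^ d * (C * H s) + 2 ^ (s + d)      ≡⟨ cong (_+ 2 ^ (s + d)) (+-*-Solver.solve 3 (λ a c b → a :* (c :* b) := c :* (a :* b))
                                                refl (2 ^ d) C (H s)) ⟩
      C * (2 ^ d * H s) + 2 ^ (s + d)      ≤⟨ <⇒≤ (proj₂ growth) ⟩
      C * H (s + d)                        ∎)
      where
      open ≤-Reasoning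
      open +-*-Solver using (_:*_; _:+_; _:=_)
      growth : ∃[ d ] C * (2 ^ d * H s) + 2 ^ (s + d) < C * H (s + d)
      growth = decidable-stable em λ none → unstable (s , t≤s , λ d → ≮⇒≥ λ lt → none (d , lt))
      d = proj₁ growth

  -- Opaque because levels obtained from it would unfold to the whole proof.
  opaque
    stable : ∀ C t → ∃[ s ] (t ≤ s × Stable C s)
    stable = stable′

  changed : ℕ → List Bool → ℕ
  changed s σ = sg (h σ ∸ h (take s σ))

  sg≤ : ∀ n → sg n ≤ n
  sg≤ zero = z≤n
  sg≤ (suc n) = s≤s z≤n

  -- Markov's inequality: a change raises the natural number `h` by at least 1, while its mean rises
  -- by at most 1/C.
  changed-bound : ∀ {C s} → Stable C s → ∀ d → C * stringSum (changed s) (s + d) ≤ 2 ^ (s + d)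
  changed-bound {C} {s} st d = +-cancelˡ-≤ (C * (2 ^ d * H s)) _ _ (begin
    C * (2 ^ d * H s) + C * stringSum (changed s) (s + d)
      ≡⟨ sym (*-distribˡ-+ C (2 ^ d * H s) _) ⟩
    C * (2 ^ d * H s + stringSum (changed s) (s + d))
      ≡⟨ cong (λ x → C * (x + stringSum (changed s) (s + d))) (sym (stringSum-take h s d)) ⟩
    C * (stringSum (h ∘ take s) (s + d) + stringSum (changed s) (s + d))
      ≡⟨ cong (C *_) (sym (stringSum-+ (h ∘ take s) (changed s) (s + d))) ⟩
    C * stringSum (λ σ → h (take s σ) + changed s σ) (s + d)
      ≤⟨ *-monoʳ-≤ C (stringSum-mono (s + d) λ σ → ≤-trans (+-monoʳ-≤ (h (take s σ)) (sg≤ _))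
           (≤-reflexive (m+[n∸m]≡n (h-take s σ)))) ⟩
    C * H (s + d)
      ≤⟨ st d ⟩
    C * (2 ^ d * H s) + 2 ^ (s + d) ∎)
    where open ≤-Reasoning

  hit : ℕ → List Bool → ℕ
  hit i σ = ifeq (sel σ) i 1

  hits : ℕ → ℕ → ℕ
  hits i = stringSum (hit i)

  -- Where `h` has not grown since level `s`, the value of `sel` is still the one at level `s`.
  hit-take : ∀ i s σ → hit i σ ≤ hit i (take s σ) + changed s σ
  hit-take i s σ with h (take s σ) ≟ h σ
  ... | yes eq = ≤-trans (≤-reflexive (cong (λ x → ifeq x i 1) (sym
      (trans (sel-stable (take s σ) (drop s σ) (trans eq (cong h (sym (take++drop≡id s σ)))))
        (cong sel (take++drop≡id s σ)))))) (m≤m+n _ _)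
  ... | no ne = ≤-trans (ifeq-elim (_≤ 1) (sel σ) i (λ _ → ≤-refl) z≤n)
      (≤-trans (≤-reflexive (sym (sg-≢0 (h σ ∸ h (take s σ)) λ e → ne (≤-antisym (h-take s σ) (m∸n≡0⇒m≤n e))))) (m≤n+m _ _))

  cover-sum : ∀ i s d → stringSum (λ σ → hit i (take s σ) + changed s σ) (s + d) ≡
    2 ^ d * hits i s + stringSum (changed s) (s + d)
  cover-sum i s d = trans (stringSum-+ (hit i ∘ take s) (changed s) (s + d))
    (cong (_+ stringSum (changed s) (s + d)) (stringSum-take (hit i) s d))

  -- A string selects only one value, so the events are disjoint.
  hits-total : ∀ n s → sum< (λ i → hits i s) n ≤ 2 ^ s
  hits-total n s = ≤-trans (≤-reflexive (sym (stringSum-sum< hit n s)))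
    (≤-trans (stringSum-mono s (λ σ → sum<-ifeq≤1 (sel σ) n))
      (≤-reflexive (trans (stringSum-const 1 s) (*-identityʳ (2 ^ s)))))

-- The limit of the target

module Target (em : ∀ {ℓ} → ExcludedMiddle ℓ) (k : ℕ) (hits : ℕ → ℕ → ℕ) (τ : ℕ → ℕ)
  (τ-zero : τ 0 ≡ 0) (τ-suc : ∀ s → τ (suc s) ≡ nextTarget k s (τ s) (hits (τ s) s)) where

  N : ℕ
  N = #candidates k

  1<N : 1 < N
  1<N = s≤s (≤-trans (s≤s z≤n) (m≤n+m (suc (k + 0)) k))

  τ<N : ∀ s → τ s < N
  τ<N zero rewrite τ-zero = s≤s z≤n
  τ<N (suc s) rewrite τ-suc s = go (suc k * hits (τ s) s ∸ 2 ^ s) (N ∸ suc (τ s)) refl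
    where
    go : ∀ a b → N ∸ suc (τ s) ≡ b → ifz a (τ s) (ifz b 0 (suc (τ s))) < N
    go zero b _ = τ<N s
    go (suc a) zero _ = s≤s z≤n
    go (suc a) (suc b) eq = m∸n≢0⇒n<m λ z → 1+n≢0 (trans (sym eq) z)

  Moves : ℕ → Set
  Moves s = τ (suc s) ≢ τ s

  moves-large : ∀ s → Moves s → 2 ^ s < suc k * hits (τ s) s
  moves-large s mv = ≰⇒> λ le → mv (trans (τ-suc s)
    (cong (λ a → ifz a (τ s) (ifz (N ∸ suc (τ s)) 0 (suc (τ s)))) (m≤n⇒m∸n≡0 le)))

  stays-small : ∀ s → τ (suc s) ≡ τ s → suc k * hits (τ s) s ≤ 2 ^ s
  stays-small s eq = ≮⇒≥ λ lt → go _ _ refl refl lt (trans (sym (τ-suc s)) eq)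
    where
    go : ∀ a b → suc k * hits (τ s) s ∸ 2 ^ s ≡ a → N ∸ suc (τ s) ≡ b → 2 ^ s < suc k * hits (τ s) s →
      ifz a (τ s) (ifz b 0 (suc (τ s))) ≢ τ s
    go zero b e₁ e₂ lt _ = <⇒≱ lt (m∸n≡0⇒m≤n e₁)
    go (suc a) (suc b) e₁ e₂ lt e = 1+n≢n e
    -- A wrap that leaves the target in place would go from `0` to `0`, with a single candidate.
    go (suc a) zero e₁ e₂ lt e = <⇒≱ 1<N (subst (λ x → N ≤ suc x) (sym e) (m∸n≡0⇒m≤n e₂))

  moves-next : ∀ s → Moves s → τ (suc s) ≡ ifz (N ∸ suc (τ s)) 0 (suc (τ s))
  moves-next s mv = trans (τ-suc s) (go (suc k * hits (τ s) s ∸ 2 ^ s) refl)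
    where
    go : ∀ a → suc k * hits (τ s) s ∸ 2 ^ s ≡ a →
      ifz a (τ s) (ifz (N ∸ suc (τ s)) 0 (suc (τ s))) ≡ ifz (N ∸ suc (τ s)) 0 (suc (τ s))
    go zero e = contradiction (trans (τ-suc s) (cong (λ a → ifz a (τ s) (ifz (N ∸ suc (τ s)) 0 (suc (τ s)))) e)) mv
    go (suc a) _ = refl

  ConvergesTo : ℕ → Set
  ConvergesTo i = ∃[ t ] ∀ d → τ (d + t) ≡ i

  module Divergent (diverges : ¬ (∃[ i ] ConvergesTo i)) where

    Leaves : ℕ → ℕ → Set
    Leaves t i = ∃[ s ] (t ≤ s × τ s ≡ i × Moves s)

    -- Divergence gives a move at or after `t`, and up to the first one the target keeps its value.
    leaves-current : ∀ t → Leaves t (τ t)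
    leaves-current t = let d , mv , below = least {λ d → Moves (d + t)} (λ _ → em) (proj₁ some) (proj₂ some) in
      d + t , m≤n+m t d , constant d below , mv
      where
      some : ∃[ d ] Moves (d + t)
      some = decidable-stable em λ none → diverges (τ t , t , λ d → go none d)
        where
        go : ¬ (∃[ d ] Moves (d + t)) → ∀ d → τ (d + t) ≡ τ t
        go none zero = refl
        go none (suc d) = trans (decidable-stable em λ ne → none (d , ne)) (go none d)
      constant : ∀ d → (∀ j → j < d → ¬ Moves (j + t)) → τ (d + t) ≡ τ t
      constant zero _ = refl
      constant (suc d) below = trans (decidable-stable em (below d ≤-refl))
        (constant d λ j j<d → below j (m<n⇒m<1+n j<d))

    leaves-next : ∀ {t i} → Leaves t i → Leaves t (ifz (N ∸ suc i) 0 (suc i))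
    leaves-next {t} (s , t≤s , refl , mv) with s′ , s<s′ , eq , mv′ ← leaves-current (suc s) =
      s′ , ≤-trans t≤s (<⇒≤ s<s′) , trans eq (moves-next s mv) , mv′

    leaves-suc : ∀ {t i} → suc i < N → Leaves t i → Leaves t (suc i)
    leaves-suc {t} {i} lt l = go (N ∸ suc i) refl (leaves-next l)
      where
      go : ∀ a → N ∸ suc i ≡ a → Leaves t (ifz a 0 (suc i)) → Leaves t (suc i)
      go zero e _ = contradiction (m∸n≡0⇒m≤n e) (<⇒≱ lt)
      go (suc a) _ l = l

    leaves-zero : ∀ t → Leaves t 0
    leaves-zero t = go (N ∸ τ t) (τ t) refl (τ<N t) (leaves-current t)
      where
      -- The distance `d` to the end of the cycle decreases until the target wraps to `0`.
      go : ∀ d i → N ∸ i ≡ d → i < N → Leaves t i → Leaves t 0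
      go zero i e i<N _ = contradiction (m∸n≡0⇒m≤n e) (<⇒≱ i<N)
      go (suc d) i e i<N l with suc i ≟ N
      ... | yes eq = subst (Leaves t) (cong (λ a → ifz a 0 (suc i)) (trans (cong (_∸ suc i) (sym eq)) (n∸n≡0 i))) (leaves-next l)
      ... | no ne = go d (suc i) (suc-injective (trans (sym (+-∸-assoc 1 i<N)) e)) (≤∧≢⇒< i<N ne) (leaves-suc (≤∧≢⇒< i<N ne) l)

    leaves-all : ∀ t i → i < N → Leaves t i
    leaves-all t zero _ = leaves-zero t
    leaves-all t (suc i) lt = leaves-suc lt (leaves-all t i (<⇒≤ lt))

module Convergence (em : ∀ {ℓ} → ExcludedMiddle ℓ) (sel h : List Bool → ℕ) (B : ℕ)
  (h≤B : ∀ σ → h σ ≤ B)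
  (h-mono : ∀ σ ρ → h σ ≤ h (σ ++ ρ))
  (sel-stable : ∀ σ ρ → h σ ≡ h (σ ++ ρ) → sel σ ≡ sel (σ ++ ρ))
  (k : ℕ) (τ : ℕ → ℕ) (τ-zero : τ 0 ≡ 0)
  (τ-suc : ∀ s → τ (suc s) ≡ nextTarget k s (τ s) (stringSum (λ σ → ifeq (sel σ) (τ s) 1) s)) where

  open Stabilisation em sel h B h≤B h-mono sel-stable public
  open Target em k hits τ τ-zero τ-suc public

  cover-≤ : ∀ i s d → hits i (s + d) ≤ 2 ^ d * hits i s + stringSum (changed s) (s + d)
  cover-≤ i s d = ≤-trans (stringSum-mono (s + d) (hit-take i s)) (≤-reflexive (cover-sum i s d))

  -- If τ moved forever, each of the N = 2 (k + 1) disjoint events sel = i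
  -- would have measure more than 1/N at a level where the measures have
  -- almost stabilised.
  converges′ : ∃[ i ] ConvergesTo i
  converges′ = decidable-stable em λ diverges → let s , _ , st = stable N 0 in
    <⇒≱ (total s) (*-monoʳ-≤ N (hits-total N s) ∙≥ big diverges s st)
    where
    _∙≥_ : ∀ {a b c} → b ≤ c → a ≤ b → a ≤ c
    p ∙≥ q = ≤-trans q p
    total : ∀ s → N * 2 ^ s < N * suc (2 ^ s)
    total s = *-monoʳ-< N ≤-refl
    big : ¬ (∃[ i ] ConvergesTo i) → ∀ s → Stable N s → N * suc (2 ^ s) ≤ N * sum< (λ i → hits i s) N
    big diverges s st = ≤-trans (≤-reflexive (sym (sum<-const (suc (2 ^ s)) N)))
      (≤-trans (sum<-mono N each) (≤-reflexive (sum<-*ˡ N (λ i → hits i s) N)))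
      where
      open Divergent diverges
      each : ∀ i → i < N → suc (2 ^ s) ≤ N * hits i s
      -- The stage `s′` is a late one at which the target leaves `i`; its measure is then compared
      -- with that at the stable level `s`.
      each i i<N with s′ , s≤s′ , refl , mv ← leaves-all s i i<N = *-cancelˡ-< (2 ^ d) _ _ (+-cancelʳ-< P _ _ (begin-strict
        2 ^ d * 2 ^ s + P                       ≡⟨ cong (_+ P) (trans (*-comm (2 ^ d) (2 ^ s)) (sym (^-distribˡ-+-* 2 s d))) ⟩
        P + P                                   ≡⟨ cong (P +_) (sym (+-identityʳ P)) ⟩
        2 * P                                   <⟨ *-monoʳ-< 2 (subst (λ s → 2 ^ s < suc k * hits i s) (sym (m+[n∸m]≡n s≤s′)) (moves-large s′ mv)) ⟩
        2 * (suc k * hits i (s + d))            ≤⟨ *-monoʳ-≤ 2 (*-monoʳ-≤ (suc k) (cover-≤ i s d)) ⟩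
        2 * (suc k * (2 ^ d * hits i s + ch))   ≡⟨ solve 4 (λ k p x c → con 2 :* (k :* (p :* x :+ c)) := p :* (con 2 :* k :* x) :+ con 2 :* k :* c)
                                                     refl (suc k) (2 ^ d) (hits i s) ch ⟩
        2 ^ d * (N * hits i s) + N * ch         ≤⟨ +-monoʳ-≤ _ (changed-bound {N} {s} st d) ⟩
        2 ^ d * (N * hits i s) + P              ∎))
        where
        open ≤-Reasoning
        open +-*-Solver using (solve; con; _:*_; _:+_; _:=_)
        d = s′ ∸ s
        P = 2 ^ (s + d)
        ch = stringSum (changed s) (s + d)

  opaque
    converges : ∃[ i ] ConvergesTo i
    converges = converges′

  -- Every path that is on target somewhere beyond the level passes through
  -- a string of positive weight.
  module _ {i : ℕ} (conv : ConvergesTo i) where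

    private
      choice : ∃[ s ] (proj₁ conv ≤ s × Stable N s)
      choice = stable N (proj₁ conv)

    level : ℕ
    level = proj₁ choice

    coverWeight : List Bool → ℕ
    coverWeight σ = hit i (take level σ) + changed level σ

    τ-const : ∀ s → level ≤ s → τ s ≡ i
    τ-const s le = trans (cong τ (sym (m∸n+n≡m (≤-trans (proj₁ (proj₂ choice)) le)))) (proj₂ conv (s ∸ proj₁ conv))

    -- The target stays put at the level, so the event there has measure at most 1/(k + 1); later
    -- changes add at most 1/N.
    coverWeight-bound : ∀ d → suc k * stringSum coverWeight (level + d) ≤ 2 * 2 ^ (level + d)
    coverWeight-bound d = begin
      suc k * stringSum coverWeight (s + d)   ≡⟨ cong (suc k *_) (cover-sum i s d) ⟩
      suc k * (2 ^ d * hits i s + ch)         ≡⟨ solve 4 (λ k p x c → k :* (p :* x :+ c) := p :* (k :* x) :+ k :* c)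
                                                   refl (suc k) (2 ^ d) (hits i s) ch ⟩
      2 ^ d * (suc k * hits i s) + suc k * ch ≤⟨ +-mono-≤ (*-monoʳ-≤ (2 ^ d) small) changes ⟩
      2 ^ d * 2 ^ s + P                       ≡⟨ cong (_+ P) (trans (*-comm (2 ^ d) (2 ^ s)) (sym (^-distribˡ-+-* 2 s d))) ⟩
      P + P                                   ≡⟨ cong (P +_) (sym (+-identityʳ P)) ⟩
      2 * P                                   ∎
      where
      open ≤-Reasoning
      open +-*-Solver using (solve; con; _:*_; _:+_; _:=_)
      s = level
      P = 2 ^ (s + d)
      ch = stringSum (changed s) (s + d)
      small : suc k * hits i s ≤ 2 ^ s
      small = subst (λ j → suc k * hits j s ≤ 2 ^ s) (τ-const s ≤-refl)
        (stays-small s (trans (τ-const (suc s) (n≤1+n s)) (sym (τ-const s ≤-refl))))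
      changes : suc k * ch ≤ P
      changes = ≤-trans (*-monoˡ-≤ ch (m≤m+n (suc k) _)) (changed-bound {N} {s} (proj₂ (proj₂ choice)) d)

-- Enumeration of strings by their numbers

sum<-+ : ∀ (f g : ℕ → ℕ) n → sum< (λ i → f i + g i) n ≡ sum< f n + sum< g n
sum<-+ f g zero = refl
sum<-+ f g (suc n) rewrite sum<-+ f g n =
  +-*-Solver.solve 4 (λ a b c d → (a :+ b) :+ (c :+ d) := (a :+ c) :+ (b :+ d)) refl (sum< f n) (sum< g n) (f n) (g n)
  where open +-*-Solver using (_:+_; _:=_)

sum<-double : ∀ (f : ℕ → ℕ) n → sum< f (2 * n) ≡ sum< (λ i → f (2 * i)) n + sum< (λ i → f (suc (2 * i))) n
sum<-double f zero = refl
sum<-double f (suc n) rewrite +-suc n (n + 0) | sum<-double f n =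
  +-*-Solver.solve 4 (λ a b c d → ((a :+ b) :+ c) :+ d := (a :+ c) :+ (b :+ d)) refl
    (sum< (λ i → f (2 * i)) n) _ (f (2 * n)) (f (suc (2 * n)))
  where open +-*-Solver using (_:+_; _:=_)

sum<-suc : ∀ (f : ℕ → ℕ) n → sum< f (suc n) ≡ f 0 + sum< (f ∘ suc) n
sum<-suc f zero = sym (+-identityʳ (f 0))
sum<-suc f (suc n) = trans (cong (_+ f (suc n)) (sum<-suc f n)) (+-assoc (f 0) _ _)

sum<-weaken : ∀ f {m n} → m ≤ n → sum< f m ≤ sum< f n
sum<-weaken f {m} {n} m≤n = subst (λ n → sum< f m ≤ sum< f n) (m∸n+n≡m m≤n) (go (n ∸ m))
  where
  go : ∀ d → sum< f m ≤ sum< f (d + m)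
  go zero = ≤-refl
  go (suc d) = ≤-trans (go d) (m≤m+n _ _)

2^∸1 : ∀ s → 2 ^ suc s ∸ 1 ≡ 1 + 2 * (2 ^ s ∸ 1)
2^∸1 s with 2 ^ s | 2^>0 s
... | suc n | _ = +-suc n (n + 0)

-- The strings of length s are numbered from 2 ^ s ∸ 1 on.
sum<-strings : ∀ (g : ℕ → ℕ) s → sum< (λ x → g (x + (2 ^ s ∸ 1))) (2 ^ s) ≡ stringSum (g ∘ encodeString) s
sum<-strings g zero = refl
sum<-strings g (suc s) = trans (sum<-double _ (2 ^ s)) (cong₂ _+_
  (trans (sum<-cong (2 ^ s) λ x _ → cong g (trans (cong (2 * x +_) (2^∸1 s)) (evens x (2 ^ s ∸ 1))))
    (sum<-strings (λ x → g (1 + 2 * x)) s))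
  (trans (sum<-cong (2 ^ s) λ x _ → cong g (trans (cong (suc (2 * x) +_) (2^∸1 s)) (odds x (2 ^ s ∸ 1))))
    (sum<-strings (λ x → g (2 + 2 * x)) s)))
  where
  open +-*-Solver using (solve; con; _:*_; _:+_; _:=_)
  evens : ∀ x p → 2 * x + (1 + 2 * p) ≡ 1 + 2 * (x + p)
  evens = solve 2 (λ x p → con 2 :* x :+ (con 1 :+ con 2 :* p) := con 1 :+ con 2 :* (x :+ p)) refl
  odds : ∀ x p → suc (2 * x) + (1 + 2 * p) ≡ 2 + 2 * (x + p)
  odds = solve 2 (λ x p → con 1 :+ con 2 :* x :+ (con 1 :+ con 2 :* p) := con 2 :+ con 2 :* (x :+ p)) refl

increment : List Bool → List Bool
increment [] = false ∷ []
increment (false ∷ σ) = true ∷ σ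
increment (true ∷ σ) = false ∷ increment σ

decodeString : ℕ → List Bool
decodeString = natrec [] (λ _ → increment)

decode-odd : ∀ n → decodeString (1 + 2 * n) ≡ false ∷ decodeString n
decode-odd zero = refl
decode-odd (suc n) rewrite +-suc n (n + 0) = cong (increment ∘ increment) (decode-odd n)

decode-even : ∀ n → decodeString (2 + 2 * n) ≡ true ∷ decodeString n
decode-even n = cong increment (decode-odd n)

decode-encode : ∀ σ → decodeString (encodeString σ) ≡ σ
decode-encode [] = refl
decode-encode (false ∷ σ) = trans (decode-odd (encodeString σ)) (cong (false ∷_) (decode-encode σ))
decode-encode (true ∷ σ) = trans (decode-even (encodeString σ)) (cong (true ∷_) (decode-encode σ))

-- Minimal strings of a set

minimal : (List Bool → Bool) → List Bool → Bool
minimal W [] = W []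
minimal W (b ∷ σ) = if W [] then false else minimal (W ∘ (b ∷_)) σ

indicator : Bool → ℕ
indicator b = if b then 1 else 0

minimal-prefix : ∀ W σ {X} → σ ≺ X → W σ ≡ true → ∃[ ρ ] (ρ ≺ X × minimal W ρ ≡ true)
minimal-prefix W σ p w with W [] in eq
... | true = [] , (λ ()) , eq
minimal-prefix W [] p w | false = contradiction (trans (sym eq) w) λ ()
minimal-prefix W (b ∷ σ) {X} p w | false
  with ρ , q , m ← minimal-prefix (W ∘ (b ∷_)) σ {X ∘ suc} (≺-tail {b} {σ} {X} p) w =
  b ∷ ρ , (λ { zero → p zero ; (suc i) → q i }) , trans (cong (if_then false else minimal (W ∘ (b ∷_)) ρ) eq) m

-- Ranges over the strings of length at most `L`, of which there are `treeSize L`.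
treeSum : (List Bool → ℕ) → ℕ → ℕ
treeSum g zero = g []
treeSum g (suc L) = g [] + (treeSum (g ∘ (false ∷_)) L + treeSum (g ∘ (true ∷_)) L)

treeSize : ℕ → ℕ
treeSize zero = 1
treeSize (suc L) = suc (2 * treeSize L)

≤treeSize : ∀ L → L ≤ treeSize L
≤treeSize zero = z≤n
≤treeSize (suc L) = s≤s (≤-trans (≤treeSize L) (m≤m+n _ _))

sum<-decode : ∀ g L → sum< (g ∘ decodeString) (treeSize L) ≡ treeSum g L
sum<-decode g zero = refl
sum<-decode g (suc L) = trans (sum<-suc _ (2 * treeSize L)) (cong (g [] +_) (trans (sum<-double _ (treeSize L)) (cong₂ _+_
  (trans (sum<-cong (treeSize L) λ i _ → cong g (decode-odd i)) (sum<-decode (g ∘ (false ∷_)) L))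
  (trans (sum<-cong (treeSize L) λ i _ → cong g (decode-even i)) (sum<-decode (g ∘ (true ∷_)) L)))))

treeSum-0 : ∀ L → treeSum (λ _ → 0) L ≡ 0
treeSum-0 zero = refl
treeSum-0 (suc L) rewrite treeSum-0 L = refl

minimalWeight : (List Bool → Bool) → ℕ → List Bool → ℕ
minimalWeight W L σ = if minimal W σ then 2 ^ (L ∸ length σ) else 0

-- A form of Kraft's inequality: minimal strings are incomparable, and all their extensions of
-- length `L` lie in the closed set `W`.
minimal-sum : ∀ W → (∀ σ ρ → W σ ≡ true → W (σ ++ ρ) ≡ true) →
  ∀ L → treeSum (minimalWeight W L) L ≤ stringSum (indicator ∘ W) L
minimal-sum W closed zero = ≤-refl
minimal-sum W closed (suc L) with W [] in eq
... | true = ≤-reflexive (trans (cong (2 ^ suc L +_) (cong₂ _+_ (treeSum-0 L) (treeSum-0 L)))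
    (trans (+-identityʳ _) (sym (cong₂ _+_ (ones (false ∷_) λ σ → closed [] (false ∷ σ) eq)
      (trans (ones (true ∷_) λ σ → closed [] (true ∷ σ) eq) (sym (+-identityʳ (2 ^ L))))))))
    where
    ones : ∀ (c : List Bool → List Bool) → (∀ σ → W (c σ) ≡ true) → stringSum (indicator ∘ W ∘ c) L ≡ 2 ^ L
    ones c all = trans (go L (λ σ → cong indicator (all σ))) (trans (stringSum-const 1 L) (*-identityʳ (2 ^ L)))
      where
      go : ∀ {f g : List Bool → ℕ} s → (∀ σ → f σ ≡ g σ) → stringSum f s ≡ stringSum g s
      go zero eq = eq []
      go (suc s) eq = cong₂ _+_ (go s (eq ∘ (false ∷_))) (go s (eq ∘ (true ∷_)))
... | false = +-mono-≤ (minimal-sum (W ∘ (false ∷_)) (λ σ ρ → closed (false ∷ σ) ρ) L)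
                       (minimal-sum (W ∘ (true ∷_)) (λ σ ρ → closed (true ∷ σ) ρ) L)

-- Cylinders not in the cover are replaced by ones of small total measure,
-- since a cover has no empty members.
coverString : (List Bool → Bool) → ℕ → ℕ → List Bool
coverString W c i = if minimal W (decodeString i) then decodeString i else replicate (suc (c + i)) false

weight : ℕ → List Bool → ℕ
weight L σ = 2 ^ (L ∸ length σ)

∸-suc : ∀ {m n} → n < m → m ∸ n ≡ suc (m ∸ suc n)
∸-suc {suc m} (s≤s le) = +-∸-assoc 1 le

-- A geometric sum; adding the missing tail `2 ^ (L ∸ (c + n))` turns the estimate into an equation
-- that can be proved by induction.
filler-sum : ∀ L c n → c + n ≤ L → sum< (λ i → 2 ^ (L ∸ suc (c + i))) n ≤ 2 ^ (L ∸ c)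
filler-sum L c n le = ≤-trans (m≤m+n _ _) (≤-reflexive (go n le))
  where
  go : ∀ n → c + n ≤ L → sum< (λ i → 2 ^ (L ∸ suc (c + i))) n + 2 ^ (L ∸ (c + n)) ≡ 2 ^ (L ∸ c)
  go zero le = cong (λ m → 2 ^ (L ∸ m)) (+-identityʳ c)
  go (suc n) le rewrite +-suc c n = trans (+-assoc (sum< _ n) _ _)
    (trans (cong (sum< (λ i → 2 ^ (L ∸ suc (c + i))) n +_)
      (trans (cong (2 ^ (L ∸ suc (c + n)) +_) (sym (+-identityʳ _)))
        (cong (2 ^_) (sym (∸-suc le)))))
      (go n (<⇒≤ le)))

cover-weight : ∀ W → (∀ σ ρ → W σ ≡ true → W (σ ++ ρ) ≡ true) →
  ∀ L c n → c + n ≤ L → sum< (weight L ∘ coverString W c) n ≤ stringSum (indicator ∘ W) L + 2 ^ (L ∸ c)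
cover-weight W closed L c n le = begin
  sum< (weight L ∘ coverString W c) n
    ≤⟨ sum<-mono n (λ i _ → split i) ⟩
  sum< (λ i → minimalWeight W L (decodeString i) + 2 ^ (L ∸ suc (c + i))) n
    ≡⟨ sum<-+ _ _ n ⟩
  sum< (minimalWeight W L ∘ decodeString) n + sum< (λ i → 2 ^ (L ∸ suc (c + i))) n
    ≤⟨ +-mono-≤ (sum<-weaken _ (≤-trans (≤-trans (m≤n+m n c) le) (≤treeSize L))) (filler-sum L c n le) ⟩
  sum< (minimalWeight W L ∘ decodeString) (treeSize L) + 2 ^ (L ∸ c)
    ≡⟨ cong (_+ 2 ^ (L ∸ c)) (sum<-decode (minimalWeight W L) L) ⟩
  treeSum (minimalWeight W L) L + 2 ^ (L ∸ c)
    ≤⟨ +-monoˡ-≤ _ (minimal-sum W closed L) ⟩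
  stringSum (indicator ∘ W) L + 2 ^ (L ∸ c) ∎
  where
  open ≤-Reasoning
  split : ∀ i → weight L (coverString W c i) ≤ minimalWeight W L (decodeString i) + 2 ^ (L ∸ suc (c + i))
  split i with minimal W (decodeString i)
  ... | true = m≤m+n _ _
  ... | false rewrite length-replicate (c + i) {false} = ≤-refl

-- Dyadic measures of covers

½^ : ℕ → ℚ
½^ zero = 1ℚ
½^ (suc n) = ½ ℚ.* ½^ n

μ≡½^ : ∀ σ → μ[ σ ] ≡ ½^ (length σ)
μ≡½^ [] = refl
μ≡½^ (b ∷ σ) = cong (½ ℚ.*_) (μ≡½^ σ)

-- Unnormalised rationals store the denominator minus one, here `2 ^ n ∸ 1`, written in the form to
-- which the product with one half computes.
½^-denominator : ℕ → ℕ
½^-denominator zero = 0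
½^-denominator (suc n) = ½^-denominator n + suc (½^-denominator n + 0)

½^≃ : ∀ n → toℚᵘ (½^ n) ℚᵘ.≃ mkℚᵘ (ℤ.+ 1) (½^-denominator n)
½^≃ zero = ℚᵘ.≃-refl
½^≃ (suc n) = ℚᵘ.≃-trans (ℚ.toℚᵘ-homo-* ½ (½^ n)) (ℚᵘ.*-congˡ {mkℚᵘ (ℤ.+ 1) 1} (½^≃ n))

½^-nonNegative : ∀ n → 0ℚ ℚ.≤ ½^ n
½^-nonNegative n = ℚ.toℚᵘ-cancel-≤ (ℚᵘ.≤-respʳ-≃ (ℚᵘ.≃-sym (½^≃ n)) (ℚᵘ.*≤* (+≤+ z≤n)))

-- For a positive fraction with denominator `q + 1` the exponent `q` suffices, because `2 ^ q` is at
-- least `q + 1`.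
½^-small : ∀ ε → 0ℚ ℚ.< ε → ∃[ n ] ½^ n ℚ.≤ ε
½^-small (mkℚ +[1+ p ] q c) _ = q , ℚ.toℚᵘ-cancel-≤ (ℚᵘ.≤-respˡ-≃ (ℚᵘ.≃-sym (½^≃ q))
  (ℚᵘ.*≤* (+≤+ (s≤s (≤-trans (≤-reflexive (+-identityʳ q)) (≤-trans (q≤ q) (m≤m+n _ _)))))))
  where
  q≤ : ∀ n → n ≤ ½^-denominator n
  q≤ zero = z≤n
  q≤ (suc n) = ≤-trans (s≤s (q≤ n)) (≤-trans (≤-reflexive (cong suc (sym (+-identityʳ _)))) (m≤n+m _ (½^-denominator n)))
½^-small (mkℚ (ℤ.+ 0) q c) (ℚ.*<* (ℤ.+<+ ()))
½^-small (mkℚ -[1+ p ] q c) (ℚ.*<* ())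

½^-double : ∀ n → 2 · ½^ (suc n) ≡ ½^ n
½^-double n = begin
  ½ ℚ.* x ℚ.+ (½ ℚ.* x ℚ.+ 0ℚ)  ≡⟨ cong (½ ℚ.* x ℚ.+_) (ℚ.+-identityʳ (½ ℚ.* x)) ⟩
  ½ ℚ.* x ℚ.+ ½ ℚ.* x           ≡⟨ sym (ℚ.*-distribʳ-+ x ½ ½) ⟩
  1ℚ ℚ.* x                      ≡⟨ ℚ.*-identityˡ x ⟩
  x                             ∎
  where
  open ≡-Reasoning
  x = ½^ n

½^-scale : ∀ d n → (2 ^ d) · ½^ (d + n) ≡ ½^ n
½^-scale zero n = ℚ.+-identityʳ (½^ n)
½^-scale (suc d) n = begin
  (2 * 2 ^ d) · ½^ (suc (d + n))   ≡⟨ cong (_· ½^ (suc (d + n))) (*-comm 2 (2 ^ d)) ⟩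
  (2 ^ d * 2) · ½^ (suc (d + n))   ≡⟨ sym (×-assocˡ ℚ.+-0-monoid (½^ (suc (d + n))) (2 ^ d) 2) ⟩
  (2 ^ d) · (2 · ½^ (suc (d + n))) ≡⟨ cong ((2 ^ d) ·_) (½^-double (d + n)) ⟩
  (2 ^ d) · ½^ (d + n)             ≡⟨ ½^-scale d n ⟩
  ½^ n                             ∎
  where open ≡-Reasoning

½^-weight : ∀ {L n} → n ≤ L → ½^ n ≡ (2 ^ (L ∸ n)) · ½^ L
½^-weight {L} {n} n≤L = trans (sym (½^-scale (L ∸ n) n)) (cong (λ m → (2 ^ (L ∸ n)) · ½^ m) (m∸n+n≡m n≤L))

·-mono : ∀ {m n x} → 0ℚ ℚ.≤ x → m ≤ n → m · x ℚ.≤ n · x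
·-mono {n = zero} p z≤n = ℚ.≤-refl
·-mono {n = suc n} {x} p z≤n = subst (ℚ._≤ x ℚ.+ n · x) (ℚ.+-identityʳ 0ℚ) (ℚ.+-mono-≤ p (·-mono {0} {n} p z≤n))
·-mono {x = x} p (s≤s le) = ℚ.+-monoʳ-≤ x (·-mono p le)

-- Measures of strings of length at most `L` are multiples of `½^ L`, which reduces sums of
-- rationals to sums of natural numbers.
∑-weight : ∀ L n (s : ℕ → List Bool) → (∀ i → i < n → length (s i) ≤ L) →
  ∑[ n ] (μ[_] ∘ s) ≡ sum< (weight L ∘ s) n · ½^ L
∑-weight L zero s le = refl
∑-weight L (suc n) s le = begin
  μ[ s 0 ] ℚ.+ ∑[ n ] (μ[_] ∘ s ∘ suc)
    ≡⟨ cong₂ ℚ._+_ (trans (μ≡½^ (s 0)) (½^-weight (le 0 (s≤s z≤n)))) (∑-weight L n (s ∘ suc) (λ i i<n → le (suc i) (s≤s i<n))) ⟩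
  weight L (s 0) · ½^ L ℚ.+ sum< (weight L ∘ s ∘ suc) n · ½^ L
    ≡⟨ sym (×-homo-+ ℚ.+-0-monoid (½^ L) (weight L (s 0)) _) ⟩
  (weight L (s 0) + sum< (weight L ∘ s ∘ suc) n) · ½^ L
    ≡⟨ cong (_· ½^ L) (sym (sum<-suc (weight L ∘ s) n)) ⟩
  sum< (weight L ∘ s) (suc n) · ½^ L ∎
  where open ≡-Reasoning

-- Half of `½^ c` is spent on the minimal strings of `W`, the other half on the filler strings.
open-cover : ∀ W → (∀ σ ρ → W σ ≡ true → W (σ ++ ρ) ≡ true) → ∀ c s₀ →
  (∀ d → 2 ^ suc c * stringSum (indicator ∘ W) (s₀ + d) ≤ 2 ^ (s₀ + d)) →
  ∃[ s ] ((∀ X σ → σ ≺ X → W σ ≡ true → ∃[ i ] s i ≺ X) × (∀ n → ∑[ n ] (μ[_] ∘ s) ℚ.≤ ½^ c))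
open-cover W closed c s₀ small = s , covers , bound
  where
  s : ℕ → List Bool
  s = coverString W (suc c)
  covers : ∀ X σ → σ ≺ X → W σ ≡ true → ∃[ i ] s i ≺ X
  covers X σ p w with ρ , q , m ← minimal-prefix W σ {X} p w =
    encodeString ρ , subst (_≺ X) (sym eq) q
    where
    eq : s (encodeString ρ) ≡ ρ
    eq = trans (cong (λ τ → if minimal W τ then τ else replicate (suc (suc c + encodeString ρ)) false) (decode-encode ρ))
      (cong (λ b → if b then ρ else replicate (suc (suc c + encodeString ρ)) false) m)
  bound : ∀ n → ∑[ n ] (μ[_] ∘ s) ℚ.≤ ½^ c
  bound n = ℚ.≤-trans (ℚ.≤-reflexive (∑-weight L n s λ i i<n →
      ≤-trans (sum<-term (length ∘ s) n i i<n) (≤-trans (m≤m+n d₁ (suc c + n)) (m≤n+m d s₀))))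
    (ℚ.≤-trans (·-mono (½^-nonNegative L) total) (ℚ.≤-reflexive (sym (½^-weight c≤L))))
    where
    -- The common length `L` must lie beyond `s₀` for `small`, beyond the lengths of the first `n`
    -- strings for `∑-weight`, and beyond `suc c + n` for `cover-weight`.
    d₁ d L : ℕ
    d₁ = sum< (length ∘ s) n
    d = d₁ + (suc c + n)
    L = s₀ + d
    1+c+n≤L : suc c + n ≤ L
    1+c+n≤L = ≤-trans (m≤n+m (suc c + n) d₁) (m≤n+m d s₀)
    1+c≤L : suc c ≤ L
    1+c≤L = ≤-trans (m≤m+n (suc c) n) 1+c+n≤L
    c≤L : c ≤ L
    c≤L = <⇒≤ 1+c≤L
    clopen : stringSum (indicator ∘ W) L ≤ 2 ^ (L ∸ suc c)
    clopen = *-cancelˡ-≤ (2 ^ suc c) {{m^n≢0 2 (suc c)}} (≤-trans (small d)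
      (≤-reflexive (trans (cong (2 ^_) (sym (m+[n∸m]≡n 1+c≤L))) (^-distribˡ-+-* 2 (suc c) (L ∸ suc c)))))
    total : sum< (weight L ∘ s) n ≤ 2 ^ (L ∸ c)
    total = ≤-trans (cover-weight W closed L (suc c) n 1+c+n≤L) (≤-trans (+-monoˡ-≤ _ clopen)
      (≤-reflexive (trans (cong ((2 ^ (L ∸ suc c)) +_) (sym (+-identityʳ _))) (cong (2 ^_) (sym (∸-suc 1+c≤L))))))

-- Atoms of formulas

-- Applied to approximations of the jump, this counts the changes; as it ignores the connectives,
-- negation does not spoil monotonicity.
atomSum : (ℕ → ℕ) → Formula → ℕ
atomSum j (atom n) = j n
atomSum j (not φ) = atomSum j φ
atomSum j (and φ ψ) = atomSum j φ + atomSum j ψ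
atomSum j (or φ ψ) = atomSum j φ + atomSum j ψ

atomSum-mono : ∀ {j j′} → (∀ n → j n ≤ j′ n) → ∀ φ → atomSum j φ ≤ atomSum j′ φ
atomSum-mono le (atom n) = le n
atomSum-mono le (not φ) = atomSum-mono le φ
atomSum-mono le (and φ ψ) = +-mono-≤ (atomSum-mono le φ) (atomSum-mono le ψ)
atomSum-mono le (or φ ψ) = +-mono-≤ (atomSum-mono le φ) (atomSum-mono le ψ)

+-mono-≡ : ∀ {a a′ b b′} → a ≤ a′ → b ≤ b′ → a + b ≡ a′ + b′ → a ≡ a′ × b ≡ b′
+-mono-≡ {a} {a′} {b} {b′} p q eq = a≡ , +-cancelˡ-≡ a b b′ (trans eq (cong (_+ b′) (sym a≡)))
  where
  a≡ : a ≡ a′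
  a≡ = ≤-antisym p (+-cancelʳ-≤ b a′ a (≤-trans (+-monoʳ-≤ a′ q) (≤-reflexive (sym eq))))

-- A sum of monotone terms stays constant only if each term does, so no atom has changed.
atomSum-truth : ∀ {j j′} → (∀ n → j n ≤ j′ n) → ∀ φ → atomSum j φ ≡ atomSum j′ φ → truth j φ ≡ truth j′ φ
atomSum-truth le (atom n) eq = eq
atomSum-truth le (not φ) eq = cong (1 ∸_) (atomSum-truth le φ eq)
atomSum-truth le (and φ ψ) eq with p , q ← +-mono-≡ (atomSum-mono le φ) (atomSum-mono le ψ) eq =
  cong₂ _*_ (atomSum-truth le φ p) (atomSum-truth le ψ q)
atomSum-truth le (or φ ψ) eq with p , q ← +-mono-≡ (atomSum-mono le φ) (atomSum-mono le ψ) eq =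
  cong₂ (λ x y → sg (x + y)) (atomSum-truth le φ p) (atomSum-truth le ψ q)

sum<-mono-≡ : ∀ {f g : ℕ → ℕ} n → (∀ i → f i ≤ g i) → sum< f n ≡ sum< g n → ∀ i → i < n → f i ≡ g i
sum<-mono-≡ (suc n) le eq i (s≤s i≤n) with p , q ← +-mono-≡ (sum<-mono n λ i _ → le i) (le n) eq | m≤n⇒m<n∨m≡n i≤n
... | inj₁ i<n = sum<-mono-≡ n le p i i<n
... | inj₂ refl = q

-- Convergence along the initial segments of a set

Eventually : Subset → (List Bool → Set) → Set
Eventually X P = ∃[ ℓ ] ∀ σ → σ ≺ X → ℓ ≤ length σ → P σ

eventually-map₂ : ∀ {X} {P Q S : List Bool → Set} → (∀ σ → P σ → Q σ → S σ) →
  Eventually X P → Eventually X Q → Eventually X S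
eventually-map₂ f (ℓ , p) (ℓ′ , q) = ℓ ⊔ ℓ′ , λ σ σ≺X le →
  f σ (p σ σ≺X (≤-trans (m≤m⊔n ℓ ℓ′) le)) (q σ σ≺X (≤-trans (m≤n⊔m ℓ ℓ′) le))

eventually-all : ∀ {X} {P : ℕ → List Bool → Set} n → (∀ i → i < n → Eventually X (P i)) →
  Eventually X (λ σ → ∀ i → i < n → P i σ)
eventually-all zero _ = 0 , λ σ _ _ i ()
eventually-all {X} {P} (suc n) ev = eventually-map₂ {X} join (eventually-all {X} {P} n (λ i i<n → ev i (m<n⇒m<1+n i<n))) (ev n ≤-refl)
  where
  join : ∀ σ → (∀ i → i < n → P i σ) → P n σ → ∀ i → i < suc n → P i σ
  join σ f p i (s≤s i≤n) with m≤n⇒m<n∨m≡n i≤n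
  ... | inj₁ i<n = f i i<n
  ... | inj₂ refl = p

module _ (em : ∀ {ℓ} → ExcludedMiddle ℓ) where

  segment : ∀ X s → ∃[ σ ] (σ ≺ X × length σ ≡ s)
  segment X zero = [] , (λ ()) , refl
  segment X (suc s) with σ , p , eq ← segment (X ∘ suc) s | em {P = 0 ∈ X}
  ... | yes 0∈X = true ∷ σ , (λ { zero → mk⇔ (λ _ → tt) (λ _ → 0∈X) ; (suc i) → p i }) , cong suc eq
  ... | no 0∉X = false ∷ σ , (λ { zero → mk⇔ 0∉X (λ ()) ; (suc i) → p i }) , cong suc eq

  -- Both outcomes are carried along because negation exchanges them; excluded middle is applied at
  -- the atoms only.
  truth-converges : ∀ X φ →
    (X ′ ⊨ φ × Eventually X (λ σ → truth (jump σ) φ ≡ 1)) ⊎ (¬ (X ′ ⊨ φ) × Eventually X (λ σ → truth (jump σ) φ ≡ 0))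
  truth-converges X (atom a) with em {P = a ∈ X ′}
  ... | yes p = inj₁ (p , jump-complete a p)
  ... | no np = inj₂ (np , 0 , λ σ σ≺X _ → zero-case σ σ≺X (jump σ a) refl)
    where
    zero-case : ∀ σ → σ ≺ X → ∀ j → jump σ a ≡ j → jump σ a ≡ 0
    zero-case σ σ≺X zero e = e
    zero-case σ σ≺X (suc j) e = contradiction (jump-sound σ {X} a σ≺X (λ z → 1+n≢0 (trans (sym e) z))) np
  truth-converges X (not φ) with truth-converges X φ
  ... | inj₁ (p , ℓ , ev) = inj₂ ((λ np → np p) , ℓ , λ σ a b → cong (1 ∸_) (ev σ a b))
  ... | inj₂ (np , ℓ , ev) = inj₁ (np , ℓ , λ σ a b → cong (1 ∸_) (ev σ a b))
  truth-converges X (and φ ψ) with truth-converges X φ | truth-converges X ψ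
  ... | inj₁ (p , ev) | inj₁ (q , ev′) = inj₁ ((p , q) , eventually-map₂ {X} (λ _ → cong₂ _*_) ev ev′)
  ... | inj₂ (np , ℓ , ev) | _ = inj₂ (np ∘ proj₁ , ℓ , λ σ a b → cong (_* truth (jump σ) ψ) (ev σ a b))
  ... | inj₁ _ | inj₂ (nq , ℓ , ev) =
    inj₂ (nq ∘ proj₂ , ℓ , λ σ a b → trans (cong (truth (jump σ) φ *_) (ev σ a b)) (*-zeroʳ (truth (jump σ) φ)))
  truth-converges X (or φ ψ) with truth-converges X φ | truth-converges X ψ
  ... | inj₁ (p , ℓ , ev) | _ = inj₁ (inj₁ p , ℓ , λ σ a b → cong (λ x → sg (x + truth (jump σ) ψ)) (ev σ a b))
  ... | inj₂ _ | inj₁ (q , ℓ , ev) = inj₁ (inj₂ q , ℓ , λ σ a b →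
    trans (cong (λ y → sg (truth (jump σ) φ + y)) (ev σ a b)) (cong sg (+-comm (truth (jump σ) φ) 1)))
  ... | inj₂ (np , ev) | inj₂ (nq , ev′) =
    inj₂ ((λ { (inj₁ p) → np p ; (inj₂ q) → nq q }) , eventually-map₂ {X} (λ _ → cong₂ (λ x y → sg (x + y))) ev ev′)

-- Indicators and covers given by weights

sum<-weighted-ifeq : ∀ i n → i < n → sum< (λ j → j * ifeq j i 1) n ≡ i
sum<-weighted-ifeq i (suc n) (s≤s i≤n) with m≤n⇒m<n∨m≡n i≤n
... | inj₁ i<n rewrite ifeq-≢ {n} {i} 1 (>⇒≢ i<n) | *-zeroʳ n = trans (+-identityʳ _) (sum<-weighted-ifeq i n i<n)
... | inj₂ refl rewrite ifeq-refl n 1 = trans (cong (_+ n * 1) (zeros n ≤-refl)) (*-identityʳ n)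
  where
  zeros : ∀ m → m ≤ n → sum< (λ j → j * ifeq j n 1) m ≡ 0
  zeros zero _ = refl
  zeros (suc m) m<n rewrite ifeq-≢ {m} {n} 1 (<⇒≢ m<n) | *-zeroʳ m = trans (+-identityʳ _) (zeros m (<⇒≤ m<n))

nonzero : ℕ → Bool
nonzero zero = false
nonzero (suc _) = true

nonzero-T : ∀ n → T (nonzero n) → n ≢ 0
nonzero-T (suc n) _ ()

T-nonzero : ∀ n → n ≢ 0 → T (nonzero n)
T-nonzero zero ne = contradiction refl ne
T-nonzero (suc n) _ = tt

nonzero-true : ∀ n → n ≢ 0 → nonzero n ≡ true
nonzero-true zero ne = contradiction refl ne
nonzero-true (suc n) _ = refl

nonzero-≢0 : ∀ n → nonzero n ≡ true → n ≢ 0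
nonzero-≢0 (suc n) _ ()

indicator-nonzero : ∀ n → indicator (nonzero n) ≤ n
indicator-nonzero zero = z≤n
indicator-nonzero (suc n) = s≤s z≤n

if-nonzero : ∀ n → n ≤ 1 → n ≡ (if nonzero n then 1 else 0)
if-nonzero zero _ = refl
if-nonzero (suc zero) _ = refl
if-nonzero (suc (suc n)) (s≤s ())

sg-mono : ∀ {a b} → a ≤ b → sg a ≤ sg b
sg-mono {b = b} z≤n = z≤n
sg-mono (s≤s _) = ≤-refl

take-++ : ∀ n (σ ρ : List Bool) → n ≤ length σ → take n (σ ++ ρ) ≡ take n σ
take-++ zero σ ρ _ = refl
take-++ (suc n) (b ∷ σ) ρ (s≤s le) = cong (b ∷_) (take-++ n σ ρ le)

module WeightedSet (w : List Bool → ℕ) (ℓ : ℕ) (w-mono : ∀ σ ρ → ℓ ≤ length σ → w σ ≤ w (σ ++ ρ)) where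

  -- Short strings are left out because the weight is known to be monotone only from length `ℓ` on,
  -- while `open-cover` asks for closure under extension.
  W : List Bool → Bool
  W σ = if nonzero (ℓ ∸ length σ) then false else nonzero (w σ)

  W-⇐ : ∀ σ → ℓ ≤ length σ → w σ ≢ 0 → W σ ≡ true
  W-⇐ σ le ne rewrite m≤n⇒m∸n≡0 le = nonzero-true _ ne

  W-⇒ : ∀ σ → W σ ≡ true → ℓ ≤ length σ × w σ ≢ 0
  W-⇒ σ p with ℓ ∸ length σ in eq
  ... | zero = m∸n≡0⇒m≤n eq , nonzero-≢0 _ p

  W-closed : ∀ σ ρ → W σ ≡ true → W (σ ++ ρ) ≡ true
  W-closed σ ρ p with le , ne ← W-⇒ σ p = W-⇐ (σ ++ ρ)
    (≤-trans le (≤-trans (m≤m+n _ _) (≤-reflexive (sym (length-++ σ)))))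
    λ z → ne (n≤0⇒n≡0 (≤-trans (w-mono σ ρ le) (≤-reflexive z)))

  indicator-W : ∀ σ → indicator (W σ) ≤ w σ
  indicator-W σ with nonzero (ℓ ∸ length σ)
  ... | true = z≤n
  ... | false = indicator-nonzero (w σ)

  weighted-cover : ∀ c → (∀ d → 2 ^ (2 + c) * stringSum w (ℓ + d) ≤ 2 * 2 ^ (ℓ + d)) →
    ∃[ s ] ((∀ X σ → σ ≺ X → ℓ ≤ length σ → w σ ≢ 0 → ∃[ i ] s i ≺ X) × (∀ n → ∑[ n ] (μ[_] ∘ s) ℚ.≤ ½^ c))
  weighted-cover c bound with s , covers , sums ← open-cover W W-closed c ℓ (λ d → *-cancelˡ-≤ 2
      (≤-trans (≤-reflexive (sym (*-assoc 2 (2 ^ suc c) _)))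
        (≤-trans (*-monoʳ-≤ (2 ^ (2 + c)) (stringSum-mono (ℓ + d) indicator-W)) (bound d)))) =
    s , (λ X σ σ≺X le ne → covers X σ σ≺X (W-⇐ σ le ne)) , sums

-- The null class

module NullClass (em : ∀ {ℓ} → ExcludedMiddle ℓ) (φ : ℕ → Formula) (m : ℕ) where

  f : ℕ → ℕ
  f = encodeFormula ∘ φ

  open Construction f

  selected : ℕ → List Bool → ℕ
  selected k σ = guessIndex m k (encodeString σ)

  guess≡ : ∀ k j σ → guess m k j (encodeString σ) ≡ truth (jump σ) (φ (candidate m k j))
  guess≡ k j σ = evalFormula-encode (encodeString σ) (φ (candidate m k j))

  atoms : ℕ → List Bool → ℕ
  atoms k σ = sum< (λ j → atomSum (jump σ) (φ (candidate m k j))) (#candidates k)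

  atomBound : ℕ → ℕ
  atomBound k = sum< (λ j → atomSum (λ _ → 1) (φ (candidate m k j))) (#candidates k)

  atoms-bound : ∀ k σ → atoms k σ ≤ atomBound k
  atoms-bound k σ = sum<-mono (#candidates k) λ j _ →
    atomSum-mono (jumpApprox≤1 (encodeString σ)) (φ (candidate m k j))

  atoms-mono : ∀ k σ ρ → atoms k σ ≤ atoms k (σ ++ ρ)
  atoms-mono k σ ρ = sum<-mono (#candidates k) λ j _ → atomSum-mono (jump-mono σ ρ) (φ (candidate m k j))

  selected-stable : ∀ k σ ρ → atoms k σ ≡ atoms k (σ ++ ρ) → selected k σ ≡ selected k (σ ++ ρ)
  selected-stable k σ ρ eq = sum<-cong (#candidates k) λ j j<N → cong (j *_)
    (trans (guess≡ k j σ) (trans (atomSum-truth (jump-mono σ ρ) (φ (candidate m k j))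
      (sum<-mono-≡ (#candidates k) (λ j → atomSum-mono (jump-mono σ ρ) (φ (candidate m k j))) eq j j<N))
      (sym (guess≡ k j (σ ++ ρ)))))

  target-suc : ∀ k s → target m k (suc s) ≡
    nextTarget k s (target m k s) (stringSum (λ σ → ifeq (selected k σ) (target m k s) 1) s)
  target-suc k s = cong (nextTarget k s (target m k s))
    (sum<-strings (λ v → ifeq (guessIndex m k v) (target m k s) 1) s)

  module Threshold (k : ℕ) = Convergence em (selected k) (atoms k) (atomBound k) (atoms-bound k)
    (atoms-mono k) (selected-stable k) k (target m k) refl (target-suc k)

  onTargetRelation : ℕ → List Bool → Bool
  onTargetRelation y σ = nonzero (onTarget m y (encodeString σ))

  S : Class
  S X = ∀ y → ∃[ σ ] (σ ≺ X × T (onTargetRelation y σ))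

  onTarget≤1 : ∀ y v → onTarget m y v ≤ 1
  onTarget≤1 y v = go (π₂ y ∸ len v)
    where
    go : ∀ a → ifz a (ifeq (guessIndex m (π₁ y) v) (target m (π₁ y) (len v)) 1) 0 ≤ 1
    go zero = ifeq-elim (_≤ 1) (guessIndex m (π₁ y) v) _ (λ _ → ≤-refl) z≤n
    go (suc a) = z≤n

  onTarget-⇒ : ∀ y σ → T (onTargetRelation y σ) →
    π₂ y ≤ length σ × selected (π₁ y) σ ≡ target m (π₁ y) (length σ)
  onTarget-⇒ y σ p = go (π₂ y ∸ len (encodeString σ)) refl (nonzero-T (onTarget m y (encodeString σ)) p)
    where
    go : ∀ a → π₂ y ∸ len (encodeString σ) ≡ a →
      ifz a (ifeq (selected (π₁ y) σ) (target m (π₁ y) (len (encodeString σ))) 1) 0 ≢ 0 →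
      π₂ y ≤ length σ × selected (π₁ y) σ ≡ target m (π₁ y) (length σ)
    go zero e ne = subst (π₂ y ≤_) (len-encode σ) (m∸n≡0⇒m≤n e) ,
      trans (proj₁ (ifeq-≢0 _ (target m (π₁ y) (len (encodeString σ))) ne)) (cong (target m (π₁ y)) (len-encode σ))
    go (suc a) e ne = contradiction refl ne

  onTarget-⇐ : ∀ y σ → π₂ y ≤ length σ → selected (π₁ y) σ ≡ target m (π₁ y) (length σ) → T (onTargetRelation y σ)
  onTarget-⇐ y σ le eq = T-nonzero _ λ z → 1+n≢0 (trans (sym value) z)
    where
    value : onTarget m y (encodeString σ) ≡ 1
    value = trans (cong (λ a → ifz a (ifeq (selected (π₁ y) σ) (target m (π₁ y) (len (encodeString σ))) 1) 0)
        (m≤n⇒m∸n≡0 (subst (π₂ y ≤_) (sym (len-encode σ)) le)))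
      (ifeq-≡ 1 (trans eq (cong (target m (π₁ y)) (sym (len-encode σ)))))

  module _ (k : ℕ) where
    open Threshold k

    private
      i : ℕ
      i = proj₁ converges
      conv : ConvergesTo i
      conv = proj₂ converges

    coverLevel : ℕ
    coverLevel = level conv

    cover : List Bool → ℕ
    cover = coverWeight conv

    -- From the level on, the prefix that is tested stays the same, and the indicator of a change
    -- can only grow because `atoms` does.
    cover-mono : ∀ σ ρ → coverLevel ≤ length σ → cover σ ≤ cover (σ ++ ρ)
    cover-mono σ ρ le = subst (λ τ → cover σ ≤ hit i τ + sg (atoms k (σ ++ ρ) ∸ atoms k τ))
      (sym (take-++ coverLevel σ ρ le))
      (+-monoʳ-≤ (hit i (take coverLevel σ)) (sg-mono (∸-monoˡ-≤ (atoms k (take coverLevel σ)) (atoms-mono k σ ρ))))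

    cover-bound : ∀ d → suc k * stringSum cover (coverLevel + d) ≤ 2 * 2 ^ (coverLevel + d)
    cover-bound = coverWeight-bound conv

    cover-meets : ∀ X → X ∈ S → ∃[ σ ] (σ ≺ X × coverLevel ≤ length σ × cover σ ≢ 0)
    -- The instance for `k` and `coverLevel` supplies a segment on target at a stage where the
    -- target equals its limit.
    cover-meets X X∈S = go (X∈S (k ⊗ coverLevel))
      where
      go : ∃[ σ ] (σ ≺ X × T (onTargetRelation (k ⊗ coverLevel) σ)) → ∃[ σ ] (σ ≺ X × coverLevel ≤ length σ × cover σ ≢ 0)
      go (σ , σ≺X , on) = σ , σ≺X , le ,
        λ z → 1+n≢0 (trans (sym hit≡1) (n≤0⇒n≡0 (≤-trans (hit-take i coverLevel σ) (≤-reflexive z))))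
        where
        le : coverLevel ≤ length σ
        le = subst (_≤ length σ) (π₂-⊗ k coverLevel) (proj₁ (onTarget-⇒ (k ⊗ coverLevel) σ on))
        hit≡1 : hit i σ ≡ 1
        hit≡1 = ifeq-≡ 1 (trans (subst (λ k → selected k σ ≡ target m k (length σ)) (π₁-⊗ k coverLevel)
          (proj₂ (onTarget-⇒ (k ⊗ coverLevel) σ on))) (τ-const conv (length σ) le))

  null-S : Null S
  null-S ε 0<ε = go (½^-small ε 0<ε)
    where
    go : ∃[ c ] ½^ c ℚ.≤ ε → ∃[ s ] ((∀ X → X ∈ S → ∃[ i ] s i ≺ X) × (∀ n → ∑[ n ] (μ[_] ∘ s) ℚ.≤ ε))
    -- With `suc k` equal to `2 ^ (2 + c)` the clopen sets have measure at most 2/(k + 1), half of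
    -- `½^ c`, as `open-cover` requires.
    go (c , ½^c≤ε) = at (2 ^ (2 + c) ∸ 1) (m+[n∸m]≡n (2^>0 (2 + c)))
      where
      at : ∀ k → suc k ≡ 2 ^ (2 + c) → ∃[ s ] ((∀ X → X ∈ S → ∃[ i ] s i ≺ X) × (∀ n → ∑[ n ] (μ[_] ∘ s) ℚ.≤ ε))
      at k eq = let s , covers , bound = weighted-cover c (λ d → subst (λ K → K * stringSum (cover k) (coverLevel k + d) ≤ 2 * 2 ^ (coverLevel k + d)) eq (cover-bound k d)) in
        s , (λ X X∈S → let σ , σ≺X , le , ne = cover-meets k X X∈S in covers X σ σ≺X le ne) , λ n → ℚ.≤-trans (bound n) ½^c≤ε
        where open WeightedSet (cover k) (coverLevel k) (cover-mono k)

  module _ (R : Subset) (reduces : ∀ x → x ∈ ∅ ′ ′ ⇔ R ′ ⊨ φ x)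
    (candidate-in : ∀ k i t → (∀ s → t ≤ s → target m k s ≡ i) → candidate m k i ∈ ∅ ′ ′)
    (candidate-out : ∀ k i → candidate m k i ∈ ∅ ′ ′ → ∃[ t ] ∀ s → t ≤ s → target m k s ≡ i) where

    R∈S : R ∈ S
    R∈S y = finish (eventually-all {R} {Guessed} (#candidates k) λ j _ → guesses j)
      where
      k : ℕ
      k = π₁ y
      open Threshold k
      i t₀ : ℕ
      i = proj₁ converges
      t₀ = proj₁ (proj₂ converges)
      late : ∀ s → t₀ ≤ s → target m k s ≡ i
      late s le = trans (cong (target m k) (sym (m∸n+n≡m le))) (proj₂ (proj₂ converges) (s ∸ t₀))
      i<N : i < #candidates k
      i<N = subst (_< #candidates k) (late t₀ ≤-refl) (τ<N t₀)
      target-in : ∀ {j} → j ≡ i → candidate m k j ∈ ∅ ′ ′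
      target-in refl = candidate-in k i t₀ late
      target-unique : ∀ {j} → candidate m k j ∈ ∅ ′ ′ → j ≡ i
      target-unique {j} p = let t , eq = candidate-out k j p in
        trans (sym (eq (t + t₀) (m≤m+n t t₀))) (late (t + t₀) (m≤n+m t₀ t))
      Guessed : ℕ → List Bool → Set
      Guessed j σ = guess m k j (encodeString σ) ≡ ifeq j i 1
      guesses : ∀ j → Eventually R (Guessed j)
      guesses j = go (truth-converges em R (φ e))
        where
        e : ℕ
        e = candidate m k j
        go : (R ′ ⊨ φ e × Eventually R (λ σ → truth (jump σ) (φ e) ≡ 1)) ⊎
          (¬ (R ′ ⊨ φ e) × Eventually R (λ σ → truth (jump σ) (φ e) ≡ 0)) → Eventually R (Guessed j)
        go (inj₁ (p , ℓ , ev)) = ℓ , λ σ a b → trans (guess≡ k j σ) (trans (ev σ a b)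
          (sym (ifeq-≡ 1 (target-unique (Equivalence.from (reduces e) p)))))
        go (inj₂ (np , ℓ , ev)) = ℓ , λ σ a b → trans (guess≡ k j σ) (trans (ev σ a b)
          (sym (ifeq-≢ {j} {i} 1 λ j≡i → np (Equivalence.to (reduces e) (target-in j≡i)))))
      finish : Eventually R (λ σ → ∀ j → j < #candidates k → Guessed j σ) → ∃[ σ ] (σ ≺ R × T (onTargetRelation y σ))
      -- This length suffices for the guesses, for the limit of the target and for the lower bound
      -- in `y`.
      finish (ℓ , ev) = let σ , σ≺R , len≡ = segment em R (ℓ + (t₀ + π₂ y)) in σ , σ≺R , at σ σ≺R len≡
        where
        at : ∀ σ → σ ≺ R → length σ ≡ ℓ + (t₀ + π₂ y) → T (onTargetRelation y σ)
        at σ σ≺R len≡ = onTarget-⇐ y σ (≤-trans (≤-trans (m≤n+m (π₂ y) t₀) (m≤n+m _ ℓ)) (≤-reflexive (sym len≡)))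
          (trans selected≡ (sym (late (length σ) (≤-trans (≤-trans (m≤m+n t₀ (π₂ y)) (m≤n+m _ ℓ)) (≤-reflexive (sym len≡))))))
          where
          selected≡ : selected k σ ≡ i
          selected≡ = trans (sum<-cong (#candidates k) λ j j<N → cong (j *_)
              (ev σ σ≺R (≤-trans (m≤m+n ℓ _) (≤-reflexive (sym len≡))) j j<N))
            (sum<-weighted-ifeq i (#candidates k) i<N)

-- Second-jump membership of the candidates and conclusion

moved-candidate : ∀ f m k i t s → let open Construction f in
  moved ⟨ (k ⊗ i) ⊗ candidate m k i , t ⟩ s ≡ (t ∸ s) + ifeq (target m k s) i 1
moved-candidate f m k i t s = cong₂ (λ u v → (u ∸ s) + v) t≡
    (trans (cong₂ (λ k′ i′ → ifeq (target (π₁ (π₂ (π₂ (π₁ z)))) k′ s) i′ 1) k≡ i≡)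
      (cong (λ m′ → ifeq (target m′ k s) i 1) m≡))
  where
  open Construction f
  e x z : ℕ
  e = candidate m k i
  x = (k ⊗ i) ⊗ e
  z = ⟨ x , t ⟩
  t≡ : π₂ z ≡ t
  t≡ = cong proj₂ (unpair-⟨⟩ x t)
  x≡ : π₁ z ≡ x
  x≡ = cong proj₁ (unpair-⟨⟩ x t)
  k≡ : π₁ (π₁ (π₁ z)) ≡ k
  k≡ = trans (cong (λ x → π₁ (π₁ x)) x≡) (trans (cong π₁ (π₁-⊗ (k ⊗ i) e)) (π₁-⊗ k i))
  i≡ : π₂ (π₁ (π₁ z)) ≡ i
  i≡ = trans (cong (λ x → π₂ (π₁ x)) x≡) (trans (cong π₂ (π₁-⊗ (k ⊗ i) e)) (π₂-⊗ k i))
  m≡ : π₁ (π₂ (π₂ (π₁ z))) ≡ m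
  m≡ = trans (cong (λ x → π₁ (π₂ (π₂ x))) x≡) (trans (cong (λ e → π₁ (π₂ e)) (π₂-⊗ (k ⊗ i) e))
    (trans (cong π₁ (π₂-⊗ 6 _)) (π₁-⊗ m _)))

opaque
  moved-computable : ∀ f → Computable f → ∃[ c ] ∀ z s → ∅ ⊢ c [ ⟨ z , s ⟩ ]↦ Construction.moved f z s
  moved-computable f (fCode , fCorrect) = binaryCode t , ⊢-binaryCode t
    where
    open Terms ∅
    t : Tm 2
    t = ConstructionTerms.movedT ∅ f fCode fCorrect

  onTarget-computable : ∀ f → Computable f → ∀ m → ∃[ c ] ∀ y v → ∅ ⊢ c [ ⟨ y , v ⟩ ]↦ Construction.onTarget f m y v
  onTarget-computable f (fCode , fCorrect) m = binaryCode t , ⊢-binaryCode t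
    where
    open Terms ∅
    t : Tm 2
    t = ConstructionTerms.onTargetT ∅ f fCode fCorrect m

module Decision (em : ∀ {ℓ} → ExcludedMiddle ℓ) (f : ℕ → ℕ) (wCode : Code)
  (wCorrect : ∀ z s → ∅ ⊢ wCode [ ⟨ z , s ⟩ ]↦ Construction.moved f z s) where

  open Construction f
  open SecondJump em moved wCode wCorrect using (mainNumber; candidate∈; candidate∈⁻) public

  candidate-in : ∀ k i t → (∀ s → t ≤ s → target mainNumber k s ≡ i) → candidate mainNumber k i ∈ ∅ ′ ′
  candidate-in k i t stays = candidate∈ k i t λ s z → go s (trans (sym (moved-candidate f mainNumber k i t s)) z)
    where
    go : ∀ s → (t ∸ s) + ifeq (target mainNumber k s) i 1 ≢ 0
    go s z = 1+n≢0 (trans (sym (ifeq-≡ 1 (stays s (m∸n≡0⇒m≤n (m+n≡0⇒m≡0 (t ∸ s) z))))) (m+n≡0⇒n≡0 (t ∸ s) z))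

  candidate-out : ∀ k i → candidate mainNumber k i ∈ ∅ ′ ′ → ∃[ t ] ∀ s → t ≤ s → target mainNumber k s ≡ i
  candidate-out k i e∈ = let t , never = candidate∈⁻ k i e∈ in t , λ s t≤s →
    proj₁ (ifeq-≢0 (target mainNumber k s) i {1} λ z →
      never s (trans (moved-candidate f mainNumber k i t s) (cong₂ _+_ (m≤n⇒m∸n≡0 t≤s) z)))

corollary3p4 : (∀ {ℓ} → ExcludedMiddle ℓ) → ¬ (∃[ R ] (Superhigh R × Weakly2Random R))
corollary3p4 em (R , (φ , computable , reduces) , random) = go (moved-computable (encodeFormula ∘ φ) computable)
  where
  go : ¬ (∃[ c ] ∀ z s → ∅ ⊢ c [ ⟨ z , s ⟩ ]↦ Construction.moved (encodeFormula ∘ φ) z s)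
  -- There is no circularity: `moved` decodes m from its argument, so `wCode` precedes `mainNumber`,
  -- which then fixes the class.
  go (wCode , wCorrect) = random S (onTargetRelation , relation , λ X → mk⇔ id id) null-S
      (R∈S R reduces candidate-in candidate-out)
    where
    open Decision em (encodeFormula ∘ φ) wCode wCorrect
    open NullClass em φ mainNumber
    relation : ComputableRelation onTargetRelation
    relation = let c , correct = onTarget-computable (encodeFormula ∘ φ) computable mainNumber in
      c , λ y σ → subst (λ x → ∅ ⊢ c [ ⟨ y , encodeString σ ⟩ ]↦ x) (if-nonzero _ (onTarget≤1 y (encodeString σ)))
        (correct y (encodeString σ))
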